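{- Let $p$ be a prime and let $f(x)=a_0+a_1x+\cdots+a_mx^m\in\mathbb{Z}_p[x]$. Let $\nu,\kappa\in\mathbb{Z}$ with $0\le 2\kappa<\nu$. Suppose $r_0\in\mathbb{Z}$ satisfies $f(r_0)\equiv 0\pmod{p^\nu}$ and $v_p(f'(r_0))=\kappa$. Put $c_j=p^{(j-2)\kappa}\frac{f^{(j)}(r_0)}{j!}$ for $j=0,1,\dots,m$ (and $c_j=0$ for $j>m$). Then the series \[ r=r_0+p^\kappa\sum_{n=0}^\infty\bigg[\sum_{k=0}^n\frac{(-1)^{n-k+1}}{c_1^k\,(n+1)!}\binom{2n+1}{n-k}B_{n+k,k}(1!\,c_1,2!\,c_2,\dots)\bigg]\Big(\frac{c_0}{c_1}\Big)^{n+1} \] converges in $\mathbb{Z}_p$, and $r$ is a $p$-adic root of $f$ lifting $r_0$.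
   Context: $v_p$ is the $p$-adic valuation and $\mathbb{Z}_p$ the ring of $p$-adic integers. For a sequence $x_1,x_2,\dots$, the $(n,k)$-th partial Bell polynomial is $B_{n,k}(x_1,x_2,\dots)=\sum \frac{n!}{i_1!i_2!\cdots}\left(\frac{x_1}{1!}\right)^{i_1}\left(\frac{x_2}{2!}\right)^{i_2}\cdots$, the sum over all sequences $(i_1,i_2,\dots)$ of nonnegative integers with $i_1+i_2+\cdots=k$ and $i_1+2i_2+\cdots=n$ (with $B_{0,0}=1$). -}

module Defs where

open import Data.Nat as ℕ using (ℕ; zero; suc; _≡ᵇ_; _!)
open import Data.Nat.Combinatorics using (_C_)
open import Data.Integer as ℤ using (ℤ; +_; -[1+_])
open import Data.Integer.Divisibility using (_∣_)
open import Data.Bool using (Bool; true; false; if_then_else_; _∧_)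
open import Data.List as List using (List; []; _∷_; concatMap; map; upTo)
open import Data.Vec as Vec using (Vec; []; _∷_)
open import Data.Product using (Σ; _×_; _,_)
open import Relation.Nullary using (¬_)

-- p-adic integers, represented by sequences of approximations.
-- A sequence x : ℕ → ℤ is a p-adic integer when it is coherent:
-- x (n+1) ≡ x n (mod p^n).  It represents the p-adic limit of x n.

Seq : Set
Seq = ℕ → ℤ

Coherent : ℕ → Seq → Set
Coherent p x = ∀ n → (+ (p ℕ.^ n)) ∣ (x (suc n) ℤ.- x n)

_≈[_]_ : Seq → ℕ → Seq → Set
x ≈[ p ] y = ∀ n → (+ (p ℕ.^ n)) ∣ (x n ℤ.- y n)

const : ℤ → Seq
const a = λ _ → a

constℕ : ℕ → Seq
constℕ a = const (+ a)

infixl 6 _⊕_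
infixl 7 _⊗_

_⊕_ : Seq → Seq → Seq
(x ⊕ y) n = x n ℤ.+ y n

_⊗_ : Seq → Seq → Seq
(x ⊗ y) n = x n ℤ.* y n

DivZp : ℕ → Seq → Seq → Set
DivZp p d y = Σ Seq λ z → Coherent p z × (y ≈[ p ] (d ⊗ z))

HasVal : ℕ → Seq → ℕ → Set
HasVal p y κ = DivZp p (constℕ (p ℕ.^ κ)) y × ¬ DivZp p (constℕ (p ℕ.^ suc κ)) y

-- Q_p as the field of fractions of Z_p: a pair (numerator , denominator).

Qp : Set
Qp = Seq × Seq

_≃[_]_ : Qp → ℕ → Qp → Set
(a , d) ≃[ p ] (b , e) = (a ⊗ e) ≈[ p ] (b ⊗ d)

ι : Seq → Qp
ι x = x , constℕ 1

ιℤ : ℤ → Qp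
ιℤ a = ι (const a)

ιℕ : ℕ → Qp
ιℕ a = ι (constℕ a)

0q 1q : Qp
0q = ιℕ 0
1q = ιℕ 1

infixl 6 _+q_
infixl 7 _*q_ _/q_
infixr 8 _^q_

_+q_ : Qp → Qp → Qp
(a , d) +q (b , e) = (a ⊗ e ⊕ b ⊗ d) , (d ⊗ e)

_*q_ : Qp → Qp → Qp
(a , d) *q (b , e) = (a ⊗ b) , (d ⊗ e)

invq : Qp → Qp
invq (a , d) = d , a

_/q_ : Qp → Qp → Qp
x /q y = x *q invq y

_^q_ : Qp → ℕ → Qp
x ^q zero = 1q
x ^q suc n = x *q (x ^q n)

Σq : ℕ → (ℕ → Qp) → Qp
Σq zero f = 0q
Σq (suc N) f = Σq N f +q f N

Πq : List Qp → Qp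
Πq [] = 1q
Πq (x ∷ xs) = x *q Πq xs

-- Polynomials over Z_p: coefficient lists [a_0, a_1, ..., a_m].

Poly : Set
Poly = List Seq

eval : Poly → Seq → Seq
eval [] x = constℕ 0
eval (a ∷ as) x = a ⊕ x ⊗ eval as x

deriv : Poly → Poly
deriv [] = []
deriv (a ∷ as) = go 1 as
  where
  go : ℕ → Poly → Poly
  go i [] = []
  go i (b ∷ bs) = (constℕ i ⊗ b) ∷ go (suc i) bs

derivN : ℕ → Poly → Poly
derivN zero f = f
derivN (suc j) f = deriv (derivN j f)

-- Partial Bell polynomials B_{n,k}(x_1, x_2, ...), by the explicit sum
-- over (i_1, ..., i_n) with i_1 + i_2 + ... = k and i_1 + 2 i_2 + ... = n.
-- (For j > n necessarily i_j = 0, so vectors of length n suffice; also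
-- i_j ≤ n.)  The sequence x is indexed from 1: x_j = x j.

vecs : (l b : ℕ) → List (Vec ℕ l)
vecs zero b = [] ∷ []
vecs (suc l) b = concatMap (λ v → map (λ i → i ∷ v) (upTo (suc b))) (vecs l b)

sumV : ∀ {l} → Vec ℕ l → ℕ
sumV [] = 0
sumV (i ∷ v) = i ℕ.+ sumV v

wsumFrom : ∀ {l} → ℕ → Vec ℕ l → ℕ
wsumFrom s [] = 0
wsumFrom s (i ∷ v) = s ℕ.* i ℕ.+ wsumFrom (suc s) v

factProd : ∀ {l} → Vec ℕ l → ℕ
factProd [] = 1
factProd (i ∷ v) = (i !) ℕ.* factProd v

powProdFrom : ∀ {l} → ℕ → (ℕ → Qp) → Vec ℕ l → Qp
powProdFrom s x [] = 1q
powProdFrom s x (i ∷ v) = ((x s /q ιℕ (s !)) ^q i) *q powProdFrom (suc s) x v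

bellTerm : (n : ℕ) → (ℕ → Qp) → Vec ℕ n → Qp
bellTerm n x v = (ιℕ (n !) /q ιℕ (factProd v)) *q powProdFrom 1 x v

sumList : List Qp → Qp
sumList [] = 0q
sumList (q ∷ qs) = q +q sumList qs

B : (n k : ℕ) → (ℕ → Qp) → Qp
B n k x = sumList (map (λ v → if (sumV v ≡ᵇ k) ∧ (wsumFrom 1 v ≡ᵇ n)
                                then bellTerm n x v else 0q)
                       (vecs n n))

-- c_j = p^{(j-2)κ} f^{(j)}(r0) / j!   (written as p^{jκ} f^{(j)}(r0) / (p^{2κ} j!);
-- this is 0 for j > m automatically)
cCoef : (p κ : ℕ) → Poly → ℤ → ℕ → Qp
cCoef p κ f r0 j =
  (constℕ (p ℕ.^ (j ℕ.* κ)) ⊗ eval (derivN j f) (const r0)) ,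
  constℕ ((p ℕ.^ (2 ℕ.* κ)) ℕ.* (j !))

seriesTerm : (p κ : ℕ) → Poly → ℤ → ℕ → Qp
seriesTerm p κ f r0 n =
  Σq (suc n) (λ k →
      (ιℤ (-[1+ 0 ] ℤ.^ (n ℕ.∸ k ℕ.+ 1)) /q ((c 1 ^q k) *q ιℕ (suc n !)))
      *q ιℕ ((2 ℕ.* n ℕ.+ 1) C (n ℕ.∸ k))
      *q B (n ℕ.+ k) k (λ j → ιℕ (j !) *q c j))
  *q ((c 0 /q c 1) ^q suc n)
  where
  c : ℕ → Qp
  c = cCoef p κ f r0

ConvergesTo : ℕ → (ℕ → Qp) → Seq → Set
ConvergesTo p t s =
  ∀ m → Σ ℕ λ N → ∀ M → N ℕ.≤ M →
    Σ Seq λ z → Coherent p z × (Σq M t ≃[ p ] ι (s ⊕ constℕ (p ℕ.^ m) ⊗ z))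

module Submission where

{-
Put c(w) = c₀ + c₁ w + c₂ w² + …, so that f(r₀ + p^κ w) = p^(2κ) c(w). All c_j are p-adic
integers, c₁ is a unit and p divides c₀, so a contraction argument gives s ≡ 0 mod p with c(s) = 0.

Let h(w) = (c₁ + c₂ w + …) / c₁ and let g be the power series with g(w h(w)) = w. Since
s h(s) = - c₀ / c₁, evaluating this identity at s gives s = Σ g_m (- c₀ / c₁)^m, where the partial
sums up to m = M are correct modulo s^(M+1). No convergence of g itself is involved: the partial
sums of g(w h(w)) are polynomials in w which agree with w up to the order M.

It remains to see that g_m is the inner sum. Differentiate Σ g_m (w h)^m = w, multiply by a
polynomial P(h) and compare coefficients of w^n. If P = Σ_k (-1)^k A_k h^k is a suitable multiple
of the polynomial in h of degree n that agrees with h^-(n+1) to the order n at h = 1, then all terms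
except that of g_(n+1) disappear, because n-th differences of the sequence k ↦ h^(m+k) are
divisible by (1 - h)^n, hence by w^n. Here A_k = C(2n+1, n-k) (n+k)! / k!, and the Bell polynomial
B_(n+k,k)(1! c₁, 2! c₂, …) is (n+k)! / k! times the coefficient of w^n in (c₁ + c₂ w + …)^k.
-}

open import Defs
open import Algebra.Bundles using (CommutativeRing; CommutativeSemiring)
open import Algebra.Structures using (IsCommutativeRing)
open import Data.Bool.Base using (Bool; true; false; if_then_else_; _∧_)
open import Data.Bool.Properties using (∧-zeroʳ)
import Data.Fin.Base as Fin
import Data.Fin.Properties as Finₚ
open import Data.Integer.Base as ℤ using (ℤ; +_; -[1+_])
open import Data.Integer.Divisibility using (_∣_)
import Data.Integer.Divisibility.Signed as Signed
import Data.Integer.Properties as ℤₚ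
open import Data.Integer.Tactic.RingSolver using () renaming (solve-∀ to solve-ℤ)
open import Data.List.Base using (List; []; _∷_; _++_; applyUpTo; concat; drop; map; upTo)
open import Data.List.Relation.Binary.Pointwise.Base using (Pointwise; []; _∷_)
open import Data.List.Relation.Unary.All using (All; []; _∷_)
open import Data.Nat.Base as ℕ using (ℕ; zero; suc; z≤n; s≤s; _!; _≡ᵇ_)
open import Data.Nat.Combinatorics using (_C_; nCn≡1; nCk+nC[k+1]≡[n+1]C[k+1])
open import Data.Nat.Combinatorics.Specification using (k>n⇒nCk≡0)
open import Data.Nat.Coprimality using (Coprime; coprime-Bézout)
import Data.Nat.Divisibility as ℕᵈ
open import Data.Nat.GCD using (module Bézout)
open import Data.Nat.Induction using (<-rec)
open import Data.Nat.Primality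
  using (Prime; euclidsLemma; prime⇒irreducible; prime⇒nonTrivial; prime⇒nonZero)
import Data.Nat.Properties as ℕₚ
open import Data.Nat.Tactic.RingSolver using () renaming (solve-∀ to solve-ℕ)
open import Data.Product using (Σ; ∃; _×_; _,_; proj₁; proj₂)
open import Data.Sum using (inj₁; inj₂)
open import Data.Unit.Polymorphic using (⊤; tt)
open import Data.Vec.Base using (Vec; []; _∷_)
open import Function using (_∘_; id)
open import Level using (0ℓ; _⊔_)
open import Relation.Binary.PropositionalEquality as ≡ using (_≡_)
open import Relation.Nullary using (¬_; yes; no; contradiction)

-- Formal power series

-- The weights A_k are dictated by one identity: l times the coefficient of w^l in h^m (h + θ h) is
-- m + 1 + l times the coefficient of w^l in h^m θ h. Applied to the exponent m + k with m + l = n,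
-- the factor is n + 1 + k, so that A_k has to be proportional to C(n,k) / (n + 1 + k) if an n-th
-- difference is to remain. The scaling (2n+1)! / n! makes the weights integers, with alternating
-- sum n!. The identity is usable only after multiplication by l and by factorials, hence the need
-- for Z_p to be torsion free. In `Qp` a fraction is any pair of sequences. Since 0/0 is equal to
-- everything, equality by cross multiplication is not transitive, and the terms of the series
-- cannot be computed by rewriting fractions. Instead each expression is shown to represent some y /
-- D with y and D in Z_p, and D is removed when it is a nonzero integer or a unit. The same wish to
-- avoid division explains why the evaluation of a series is expressed by successive remainders and
-- why Taylor coefficients come from Horner's scheme.

module Sums {c ℓ} (S : CommutativeSemiring c ℓ) where
  open CommutativeSemiring S hiding (zero)
  open import Algebra.Properties.Semiring.Exp semiring using (_^_)
  open import Algebra.Properties.Semiring.Mult semiring using () renaming (_×_ to _·_)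
  open import Algebra.Properties.Semiring.Sum semiring using (sum; sum-init-last; sum-cong-≋)
  open import Algebra.Properties.CommutativeSemigroup +-commutativeSemigroup using (interchange)
  import Algebra.Properties.CommutativeSemiring.Binomial S as Binomial
  open import Relation.Binary.Reasoning.Setoid setoid

  ∑ : ℕ → (ℕ → Carrier) → Carrier
  ∑ zero    f = 0#
  ∑ (suc N) f = ∑ N f + f N

  ∑-cong : ∀ N {f g} → (∀ k → k ℕ.< N → f k ≈ g k) → ∑ N f ≈ ∑ N g
  ∑-cong zero    f≈g = refl
  ∑-cong (suc N) f≈g = +-cong (∑-cong N λ k k<N → f≈g k (ℕₚ.m<n⇒m<1+n k<N)) (f≈g N ℕₚ.≤-refl)

  ∑-zero : ∀ N {f} → (∀ k → k ℕ.< N → f k ≈ 0#) → ∑ N f ≈ 0#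
  ∑-zero zero    f≈0 = refl
  ∑-zero (suc N) f≈0 =
    trans (+-cong (∑-zero N λ k k<N → f≈0 k (ℕₚ.m<n⇒m<1+n k<N)) (f≈0 N ℕₚ.≤-refl)) (+-identityˡ 0#)

  ∑-+ : ∀ N f g → ∑ N (λ k → f k + g k) ≈ ∑ N f + ∑ N g
  ∑-+ zero    f g = sym (+-identityˡ 0#)
  ∑-+ (suc N) f g = trans (+-congʳ (∑-+ N f g)) (interchange _ _ _ _)

  *-∑ : ∀ x N f → x * ∑ N f ≈ ∑ N (λ k → x * f k)
  *-∑ x zero    f = zeroʳ x
  *-∑ x (suc N) f = trans (distribˡ x _ _) (+-congʳ (*-∑ x N f))

  ∑-* : ∀ x N f → ∑ N f * x ≈ ∑ N (λ k → f k * x)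
  ∑-* x N f = trans (*-comm _ x) (trans (*-∑ x N f) (∑-cong N λ k _ → *-comm x (f k)))

  ∑-head : ∀ N f → ∑ (suc N) f ≈ f 0 + ∑ N (f ∘ suc)
  ∑-head zero    f = +-comm 0# (f 0)
  ∑-head (suc N) f = trans (+-congʳ (∑-head N f)) (+-assoc _ _ _)

  sum≈∑ : ∀ N f → sum {N} (f ∘ Fin.toℕ) ≈ ∑ N f
  sum≈∑ zero    f = refl
  sum≈∑ (suc N) f = begin
    sum {suc N} (f ∘ Fin.toℕ)
      ≈⟨ sum-init-last {N} (f ∘ Fin.toℕ) ⟩
    sum {N} (f ∘ Fin.toℕ ∘ Fin.inject₁) + f (Fin.toℕ (Fin.fromℕ N))
      ≈⟨ +-cong (sum-cong-≋ {N} λ i → reflexive (≡.cong f (Finₚ.toℕ-inject₁ i)))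
                (reflexive (≡.cong f (Finₚ.toℕ-fromℕ N))) ⟩
    sum {N} (f ∘ Fin.toℕ) + f N
      ≈⟨ +-congʳ (sum≈∑ N f) ⟩
    ∑ (suc N) f ∎

  binomial : ∀ n x y → (x + y) ^ n ≈ ∑ (suc n) (λ k → (n C k) · (x ^ k * y ^ (n ℕ.∸ k)))
  binomial n x y = trans (Binomial.theorem n x y) (sum≈∑ (suc n) λ k → (n C k) · (x ^ k * y ^ (n ℕ.∸ k)))

module PowerSeries {c ℓ} (R : CommutativeSemiring c ℓ) where
  open CommutativeSemiring R hiding (zero)
  open Sums R
  open import Algebra.Properties.Semiring.Mult semiring using (×-homo-+; ×1-homo-*) renaming (_×_ to _·_)
  open import Algebra.Solver.Ring.NaturalCoefficients.Default R
    using (solve; _:+_; _:*_; _:=_) renaming (con to con′)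
  open import Relation.Binary.Reasoning.Setoid setoid

  Series : Set c
  Series = ℕ → Carrier

  infix 4 _≋_
  infixl 6 _⊞_
  infixl 7 _⋆_
  infixr 7.5 _∙_

  _≋_ : Series → Series → Set ℓ
  a ≋ b = ∀ n → a n ≈ b n

  nat : ℕ → Carrier
  nat n = n · 1#

  nat-+ : ∀ m n → nat (m ℕ.+ n) ≈ nat m + nat n
  nat-+ m n = ×-homo-+ 1# m n

  nat-* : ∀ m n → nat (m ℕ.* n) ≈ nat m * nat n
  nat-* = ×1-homo-*

  tl : Series → Series
  tl a n = a (suc n)

  𝟘 : Series
  𝟘 _ = 0#

  _⊞_ : Series → Series → Series
  (a ⊞ b) n = a n + b n

  _∙_ : Carrier → Series → Series
  (x ∙ a) n = x * a n

  -- The Cauchy product, with the head of the left factor split off at each step. No sums and no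
  -- truncated subtractions occur, so the ring laws are inductions over `tl`.
  _⋆_ : Series → Series → Series
  (a ⋆ b) zero    = a 0 * b 0
  (a ⋆ b) (suc n) = a 0 * b (suc n) + (tl a ⋆ b) n

  shift : ℕ → Series → Series
  shift zero    a n       = a n
  shift (suc m) a zero    = 0#
  shift (suc m) a (suc n) = shift m a n

  con : Carrier → Series
  con x zero    = x
  con x (suc _) = 0#

  𝟙 : Series
  𝟙 = con 1#

  -- Coefficient n of a product sees only the coefficients up to n of its factors. This matters
  -- because the partial sums of the inverse agree with w only up to a finite order.
  ⋆-cong-≤ : ∀ n {a a′ b b′} → (∀ i → i ℕ.≤ n → a i ≈ a′ i) → (∀ i → i ℕ.≤ n → b i ≈ b′ i) →
             (a ⋆ b) n ≈ (a′ ⋆ b′) n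
  ⋆-cong-≤ zero    p q = *-cong (p 0 z≤n) (q 0 z≤n)
  ⋆-cong-≤ (suc n) p q = +-cong (*-cong (p 0 z≤n) (q (suc n) ℕₚ.≤-refl))
    (⋆-cong-≤ n (λ i i≤n → p (suc i) (s≤s i≤n)) (λ i i≤n → q i (ℕₚ.m≤n⇒m≤1+n i≤n)))

  ⋆-cong : ∀ {a a′ b b′} → a ≋ a′ → b ≋ b′ → a ⋆ b ≋ a′ ⋆ b′
  ⋆-cong p q n = ⋆-cong-≤ n (λ i _ → p i) (λ i _ → q i)

  ⋆-zeroˡ : ∀ b → 𝟘 ⋆ b ≋ 𝟘
  ⋆-zeroˡ b zero    = zeroˡ _
  ⋆-zeroˡ b (suc n) = trans (+-cong (zeroˡ _) (⋆-zeroˡ b n)) (+-identityˡ 0#)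

  ⋆-distribʳ : ∀ c a b → (a ⊞ b) ⋆ c ≋ a ⋆ c ⊞ b ⋆ c
  ⋆-distribʳ c a b zero    = distribʳ _ _ _
  ⋆-distribʳ c a b (suc n) = trans (+-congˡ (⋆-distribʳ c (tl a) (tl b) n))
    (solve 5 (λ x y z u v → (x :+ y) :* z :+ (u :+ v) := (x :* z :+ u) :+ (y :* z :+ v))
      refl (a 0) (b 0) (c (suc n)) _ _)

  ∙-⋆ : ∀ x a b → (x ∙ a) ⋆ b ≋ x ∙ (a ⋆ b)
  ∙-⋆ x a b zero    = *-assoc _ _ _
  ∙-⋆ x a b (suc n) = trans (+-cong (*-assoc _ _ _) (∙-⋆ x (tl a) b n)) (sym (distribˡ x _ _))

  -- The mirror image of the defining recursion, from which commutativity follows by induction.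
  ⋆-sucʳ : ∀ a b n → (a ⋆ b) (suc n) ≈ a (suc n) * b 0 + (a ⋆ tl b) n
  ⋆-sucʳ a b zero    = +-comm _ _
  ⋆-sucʳ a b (suc n) = trans (+-congˡ (⋆-sucʳ (tl a) b n))
    (solve 3 (λ x y z → x :+ (y :+ z) := y :+ (x :+ z)) refl _ _ _)

  ⋆-comm : ∀ a b → a ⋆ b ≋ b ⋆ a
  ⋆-comm a b zero    = *-comm _ _
  ⋆-comm a b (suc n) = trans (+-cong (*-comm _ _) (⋆-comm (tl a) b n)) (sym (⋆-sucʳ b a n))

  ⋆-assoc : ∀ a b c → (a ⋆ b) ⋆ c ≋ a ⋆ (b ⋆ c)
  ⋆-assoc a b c zero    = *-assoc _ _ _
  ⋆-assoc a b c (suc n) = begin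
    a 0 * b 0 * c (suc n) + ((a 0 ∙ tl b ⊞ tl a ⋆ b) ⋆ c) n
      ≈⟨ +-congˡ (⋆-distribʳ c (a 0 ∙ tl b) (tl a ⋆ b) n) ⟩
    a 0 * b 0 * c (suc n) + (((a 0 ∙ tl b) ⋆ c) n + ((tl a ⋆ b) ⋆ c) n)
      ≈⟨ +-congˡ (+-cong (∙-⋆ (a 0) (tl b) c n) (⋆-assoc (tl a) b c n)) ⟩
    a 0 * b 0 * c (suc n) + (a 0 * (tl b ⋆ c) n + (tl a ⋆ (b ⋆ c)) n)
      ≈⟨ solve 5 (λ x y z u v → x :* y :* z :+ (x :* u :+ v) := x :* (y :* z :+ u) :+ v)
           refl _ _ _ _ _ ⟩
    a 0 * (b 0 * c (suc n) + (tl b ⋆ c) n) + (tl a ⋆ (b ⋆ c)) n ∎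

  con-⋆ : ∀ x b → con x ⋆ b ≋ x ∙ b
  con-⋆ x b zero    = refl
  con-⋆ x b (suc n) = trans (+-congˡ (⋆-zeroˡ b n)) (+-identityʳ _)

  ⋆-identityˡ : ∀ b → 𝟙 ⋆ b ≋ b
  ⋆-identityˡ b n = trans (con-⋆ 1# b n) (*-identityˡ _)

  -- With this bundle, powers of series come for free, and a second instance of `Sums` gives the
  -- binomial theorem for series.
  seriesSemiring : CommutativeSemiring c ℓ
  seriesSemiring = record
    { Carrier = Series ; _≈_ = _≋_ ; _+_ = _⊞_ ; _*_ = _⋆_ ; 0# = 𝟘 ; 1# = 𝟙
    ; isCommutativeSemiring = record
      { isSemiring = record
        { isSemiringWithoutAnnihilatingZero = record
          { +-isCommutativeMonoid = record
            { isMonoid = record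
              { isSemigroup = record
                { isMagma = record
                  { isEquivalence = record
                    { refl = λ _ → refl ; sym = λ p n → sym (p n) ; trans = λ p q n → trans (p n) (q n) }
                  ; ∙-cong = λ p q n → +-cong (p n) (q n) }
                ; assoc = λ a b c n → +-assoc _ _ _ }
              ; identity = (λ a n → +-identityˡ _) , (λ a n → +-identityʳ _) }
            ; comm = λ a b n → +-comm _ _ }
          ; *-cong = ⋆-cong
          ; *-assoc = ⋆-assoc
          ; *-identity = ⋆-identityˡ , (λ a n → trans (⋆-comm a 𝟙 n) (⋆-identityˡ a n))
          ; distrib = (λ c a b n → trans (⋆-comm c (a ⊞ b) n)
                        (trans (⋆-distribʳ c a b n) (+-cong (⋆-comm a c n) (⋆-comm b c n))))
                    , ⋆-distribʳ }
        ; zero = ⋆-zeroˡ , (λ a n → trans (⋆-comm a 𝟘 n) (⋆-zeroˡ a n)) }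
      ; *-comm = ⋆-comm } }

  private module S = CommutativeSemiring seriesSemiring

  open import Algebra.Properties.Semiring.Exp S.semiring public
    using () renaming (_^_ to _^^_; ^-homo-* to ^^-homo; ^-congˡ to ^^-cong)
  open import Algebra.Properties.Semiring.Mult S.semiring
    using () renaming (_×_ to _×ₛ_)
  private module ∑ₛ = Sums seriesSemiring

  ∑ₛ-at : ∀ N f n → ∑ₛ.∑ N f n ≡ ∑ N (λ k → f k n)
  ∑ₛ-at zero    f n = ≡.refl
  ∑ₛ-at (suc N) f n = ≡.cong (_+ f N n) (∑ₛ-at N f n)

  ∑-⋆ : ∀ N (f : ℕ → Series) b n → ((λ i → ∑ N (λ k → f k i)) ⋆ b) n ≈ ∑ N (λ k → (f k ⋆ b) n)
  ∑-⋆ zero    f b n = ⋆-zeroˡ b n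
  ∑-⋆ (suc N) f b n = trans (⋆-distribʳ b (λ i → ∑ N (λ k → f k i)) (f N) n) (+-congʳ (∑-⋆ N f b n))

  ⋆-∑ : ∀ N b (f : ℕ → Series) n → (b ⋆ (λ i → ∑ N (λ k → f k i))) n ≈ ∑ N (λ k → (b ⋆ f k) n)
  ⋆-∑ N b f n = trans (⋆-comm b _ n) (trans (∑-⋆ N f b n) (∑-cong N λ k _ → ⋆-comm (f k) b n))

  ⋆-∙ : ∀ x a b → a ⋆ (x ∙ b) ≋ x ∙ (a ⋆ b)
  ⋆-∙ x a b n = trans (⋆-comm a _ n) (trans (∙-⋆ x b a n) (*-congˡ (⋆-comm b a n)))

  ×ₛ-at : ∀ m a n → (m ×ₛ a) n ≈ nat m * a n
  ×ₛ-at zero    a n = sym (zeroˡ _)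
  ×ₛ-at (suc m) a n = trans (+-congˡ (×ₛ-at m a n))
    (solve 2 (λ x y → x :+ y :* x := (con′ 1 :+ y) :* x) refl (a n) (nat m))

  binomial-series : ∀ n a b i →
    ((a ⊞ b) ^^ n) i ≈ ∑ (suc n) (λ k → nat (n C k) * (a ^^ k ⋆ b ^^ (n ℕ.∸ k)) i)
  binomial-series n a b i = begin
    ((a ⊞ b) ^^ n) i
      ≈⟨ ∑ₛ.binomial n a b i ⟩
    ∑ₛ.∑ (suc n) (λ k → (n C k) ×ₛ (a ^^ k ⋆ b ^^ (n ℕ.∸ k))) i
      ≡⟨ ∑ₛ-at (suc n) _ i ⟩
    ∑ (suc n) (λ k → ((n C k) ×ₛ (a ^^ k ⋆ b ^^ (n ℕ.∸ k))) i)
      ≈⟨ ∑-cong (suc n) (λ k _ → ×ₛ-at (n C k) _ i) ⟩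
    ∑ (suc n) (λ k → nat (n C k) * (a ^^ k ⋆ b ^^ (n ℕ.∸ k)) i) ∎

  ^^-cong-≤ : ∀ k {a b} n → (∀ i → i ℕ.≤ n → a i ≈ b i) → (a ^^ k) n ≈ (b ^^ k) n
  ^^-cong-≤ zero    n p = refl
  ^^-cong-≤ (suc k) n p = ⋆-cong-≤ n p λ i i≤n → ^^-cong-≤ k i λ j j≤i → p j (ℕₚ.≤-trans j≤i i≤n)

  ^^-constant : ∀ k {a} → a 0 ≈ 1# → (a ^^ k) 0 ≈ 1#
  ^^-constant zero    p = refl
  ^^-constant (suc k) p = trans (*-cong p (^^-constant k p)) (*-identityˡ 1#)

  ⋆-as-∑ : ∀ a b n → (a ⋆ b) n ≈ ∑ (suc n) (λ k → a k * b (n ℕ.∸ k))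
  ⋆-as-∑ a b zero    = sym (+-identityˡ _)
  ⋆-as-∑ a b (suc n) = trans (+-congˡ (⋆-as-∑ (tl a) b n))
    (sym (∑-head (suc n) λ k → a k * b (suc n ℕ.∸ k)))

  shift-cong : ∀ m {a b} → a ≋ b → shift m a ≋ shift m b
  shift-cong zero    p n       = p n
  shift-cong (suc m) p zero    = refl
  shift-cong (suc m) p (suc n) = shift-cong m p n

  shift-< : ∀ m a n → n ℕ.< m → shift m a n ≡ 0#
  shift-< (suc m) a zero    _         = ≡.refl
  shift-< (suc m) a (suc n) (s≤s n<m) = shift-< m a n n<m

  shift-+ : ∀ m a n → shift m a (m ℕ.+ n) ≡ a n
  shift-+ zero    a n = ≡.refl
  shift-+ (suc m) a n = shift-+ m a n

  shift-shift : ∀ m k a → shift m (shift k a) ≋ shift (m ℕ.+ k) a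
  shift-shift zero    k a n       = refl
  shift-shift (suc m) k a zero    = refl
  shift-shift (suc m) k a (suc n) = shift-shift m k a n

  shift-∙ : ∀ m x a → shift m (x ∙ a) ≋ x ∙ shift m a
  shift-∙ zero    x a n       = refl
  shift-∙ (suc m) x a zero    = sym (zeroʳ x)
  shift-∙ (suc m) x a (suc n) = shift-∙ m x a n

  shift-⋆ : ∀ m a b → shift m a ⋆ b ≋ shift m (a ⋆ b)
  shift-⋆ zero    a b n       = refl
  shift-⋆ (suc m) a b zero    = zeroˡ _
  shift-⋆ (suc m) a b (suc n) = trans (+-congʳ (zeroˡ _)) (trans (+-identityˡ _) (shift-⋆ m a b n))

  shift-^^ : ∀ m k a → shift m a ^^ k ≋ shift (k ℕ.* m) (a ^^ k)
  shift-^^ m zero    a n = refl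
  shift-^^ m (suc k) a n = begin
    (shift m a ⋆ (shift m a ^^ k)) n             ≈⟨ shift-⋆ m a _ n ⟩
    shift m (a ⋆ (shift m a ^^ k)) n             ≈⟨ shift-cong m (⋆-cong {a} (λ _ → refl) (shift-^^ m k a)) n ⟩
    shift m (a ⋆ shift (k ℕ.* m) (a ^^ k)) n     ≈⟨ shift-cong m (⋆-comm a _) n ⟩
    shift m (shift (k ℕ.* m) (a ^^ k) ⋆ a) n     ≈⟨ shift-cong m (shift-⋆ (k ℕ.* m) _ a) n ⟩
    shift m (shift (k ℕ.* m) ((a ^^ k) ⋆ a)) n   ≈⟨ shift-shift m (k ℕ.* m) _ n ⟩
    shift (suc k ℕ.* m) ((a ^^ k) ⋆ a) n         ≈⟨ shift-cong (suc k ℕ.* m) (⋆-comm (a ^^ k) a) n ⟩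
    shift (suc k ℕ.* m) (a ⋆ (a ^^ k)) n         ∎

  Ord : ℕ → Series → Set ℓ
  Ord m a = ∀ i → i ℕ.< m → a i ≈ 0#

  Ord-⋆ : ∀ m k a b → Ord m a → Ord k b → Ord (m ℕ.+ k) (a ⋆ b)
  Ord-⋆ zero    k a b p q zero    0<k       = trans (*-congˡ (q 0 0<k)) (zeroʳ _)
  Ord-⋆ zero    k a b p q (suc i) i<k       = trans
    (+-cong (trans (*-congˡ (q (suc i) i<k)) (zeroʳ _))
            (Ord-⋆ zero k (tl a) b (λ _ ()) q i (ℕₚ.<-trans ℕₚ.≤-refl i<k)))
    (+-identityˡ 0#)
  Ord-⋆ (suc m) k a b p q zero    _         = trans (*-congʳ (p 0 (s≤s z≤n))) (zeroˡ _)
  Ord-⋆ (suc m) k a b p q (suc i) (s≤s i<m) = trans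
    (+-cong (trans (*-congʳ (p 0 (s≤s z≤n))) (zeroˡ _))
            (Ord-⋆ m k (tl a) b (λ j j<m → p (suc j) (s≤s j<m)) q i i<m))
    (+-identityˡ 0#)

  Ord-^^ : ∀ a → a 0 ≈ 0# → ∀ n → Ord n (a ^^ n)
  Ord-^^ a p zero    = λ _ ()
  Ord-^^ a p (suc n) = Ord-⋆ 1 n a (a ^^ n) (λ { zero _ → p ; (suc _) (s≤s ()) }) (Ord-^^ a p n)

  -- θ is the Euler operator w d/dw.
  θ : Series → Series
  θ a n = nat n * a n

  θ-tl : ∀ a → tl (θ a) ≋ tl a ⊞ θ (tl a)
  θ-tl a n = trans (distribʳ _ _ _) (+-congʳ (*-identityˡ _))

  θ-⋆ : ∀ a b → θ (a ⋆ b) ≋ θ a ⋆ b ⊞ a ⋆ θ b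
  θ-⋆ a b zero    = solve 2 (λ x y → con′ 0 :* (x :* y) := con′ 0 :* x :* y :+ x :* (con′ 0 :* y))
    refl (a 0) (b 0)
  θ-⋆ a b (suc n) = begin
    (1# + nat n) * (a 0 * b (suc n) + (tl a ⋆ b) n)
      ≈⟨ solve 4 (λ x y z m → (con′ 1 :+ m) :* (x :* y :+ z)
                    := x :* ((con′ 1 :+ m) :* y) :+ (z :+ m :* z)) refl _ _ _ _ ⟩
    a 0 * θ b (suc n) + ((tl a ⋆ b) n + nat n * (tl a ⋆ b) n)
      ≈⟨ +-congˡ (+-congˡ (θ-⋆ (tl a) b n)) ⟩
    a 0 * θ b (suc n) + ((tl a ⋆ b) n + ((θ (tl a) ⋆ b) n + (tl a ⋆ θ b) n))
      ≈⟨ solve 5 (λ x y z u v → x :+ (y :+ (z :+ u)) := con′ 0 :* v :+ (y :+ z) :+ (x :+ u))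
           refl _ _ _ _ (a 0 * b (suc n)) ⟩
    0# * (a 0 * b (suc n)) + ((tl a ⋆ b) n + (θ (tl a) ⋆ b) n) + (a 0 * θ b (suc n) + (tl a ⋆ θ b) n)
      ≈⟨ +-congʳ (+-cong (sym (*-assoc _ _ _)) (sym (trans (⋆-cong (θ-tl a) (λ _ → refl) n)
           (⋆-distribʳ b (tl a) (θ (tl a)) n)))) ⟩
    0# * a 0 * b (suc n) + (tl (θ a) ⋆ b) n + (a 0 * θ b (suc n) + (tl a ⋆ θ b) n) ∎

  θ-^^ : ∀ m a → θ (a ^^ suc m) ≋ nat (suc m) ∙ (a ^^ m ⋆ θ a)
  θ-^^ zero    a n = begin
    nat n * (a ⋆ 𝟙) n               ≈⟨ *-congˡ (trans (⋆-comm a 𝟙 n) (⋆-identityˡ a n)) ⟩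
    θ a n                           ≈⟨ ⋆-identityˡ (θ a) n ⟨
    (𝟙 ⋆ θ a) n                     ≈⟨ *-identityˡ _ ⟨
    1# * (𝟙 ⋆ θ a) n                ≈⟨ *-congʳ (+-identityʳ 1#) ⟨
    (1# + 0#) * (𝟙 ⋆ θ a) n         ∎
  θ-^^ (suc m) a n = begin
    θ (a ⋆ a ^^ suc m) n
      ≈⟨ θ-⋆ a (a ^^ suc m) n ⟩
    (θ a ⋆ a ^^ suc m) n + (a ⋆ θ (a ^^ suc m)) n
      ≈⟨ +-cong (⋆-comm (θ a) _ n) (⋆-cong {a} (λ _ → refl) (θ-^^ m a) n) ⟩
    (a ^^ suc m ⋆ θ a) n + (a ⋆ nat (suc m) ∙ (a ^^ m ⋆ θ a)) n
      ≈⟨ +-congˡ (trans (⋆-∙ _ a _ n) (*-congˡ (sym (⋆-assoc a (a ^^ m) (θ a) n)))) ⟩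
    (a ^^ suc m ⋆ θ a) n + nat (suc m) * (a ^^ suc m ⋆ θ a) n
      ≈⟨ trans (+-congʳ (sym (*-identityˡ _))) (sym (distribʳ _ _ _)) ⟩
    nat (suc (suc m)) * (a ^^ suc m ⋆ θ a) n ∎

  θ-shift : ∀ m a → θ (shift m a) ≋ shift m (nat m ∙ a ⊞ θ a)
  θ-shift zero    a n       = sym (trans (+-congʳ (zeroˡ _)) (+-identityˡ _))
  θ-shift (suc m) a zero    = zeroʳ _
  θ-shift (suc m) a (suc n) = begin
    (1# + nat n) * shift m a n
      ≈⟨ trans (distribʳ _ _ _) (+-cong (*-identityˡ _) (θ-shift m a n)) ⟩
    shift m a n + shift m (nat m ∙ a ⊞ θ a) n
      ≈⟨ sym (shift-⊞ m a (nat m ∙ a ⊞ θ a) n) ⟩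
    shift m (a ⊞ (nat m ∙ a ⊞ θ a)) n
      ≈⟨ shift-cong m (λ i → trans (sym (+-assoc _ _ _))
           (+-congʳ (sym (trans (distribʳ _ _ _) (+-congʳ (*-identityˡ _)))))) n ⟩
    shift m (nat (suc m) ∙ a ⊞ θ a) n ∎
    where
    shift-⊞ : ∀ m a b → shift m (a ⊞ b) ≋ shift m a ⊞ shift m b
    shift-⊞ zero    a b n       = refl
    shift-⊞ (suc m) a b zero    = sym (+-identityˡ 0#)
    shift-⊞ (suc m) a b (suc n) = shift-⊞ m a b n

-- Lagrange inversion

module _ where
  open import Data.Nat.Base
  open import Data.Nat.Properties
  open import Data.Nat.Combinatorics using (_C_; k![n∸k]!∣n!)
  open import Data.Nat.Combinatorics.Specification using (nCk≡n!/k![n-k]!)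
  open import Data.Nat.DivMod using (m/n*n≡m)
  open import Relation.Binary.PropositionalEquality
  open ≡-Reasoning

  -- (n + k) C k * n !  is  (n + k) ! / k !
  lagrangeCoeff : ℕ → ℕ → ℕ
  lagrangeCoeff n k = ((2 * n + 1) C (n ∸ k)) * (((n + k) C k) * n !)

  [m+k]Ck*k!*m!≡[m+k]! : ∀ m k → ((m + k) C k) * (k ! * m !) ≡ (m + k) !
  [m+k]Ck*k!*m!≡[m+k]! m k = begin
    ((m + k) C k) * (k ! * m !)
      ≡⟨ cong (λ d → ((m + k) C k) * (k ! * d !)) (sym (m+n∸n≡m m k)) ⟩
    ((m + k) C k) * (k ! * (m + k ∸ k) !)
      ≡⟨ cong (_* (k ! * (m + k ∸ k) !)) (nCk≡n!/k![n-k]! k≤m+k) ⟩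
    ((m + k) ! / (k ! * (m + k ∸ k) !)) * (k ! * (m + k ∸ k) !)
      ≡⟨ m/n*n≡m (k![n∸k]!∣n! k≤m+k) ⟩
    (m + k) ! ∎
    where
    k≤m+k = m≤n+m k m
    instance _ = k !* (m + k ∸ k) !≢0

  -- Multiplied by k! (n-k)!, both sides become (2n+1)! n!, because 2n + 1 = (n + 1 + k) + (n - k).
  -- The point is that a factor n + 1 + k turns the weight into a multiple, independent of k, of
  -- C(n,k).
  lagrangeCoeff-* : ∀ n k → k ≤ n →
    lagrangeCoeff n k * n ! * (suc n + k) ≡ (2 * n + 1) ! * (n C k)
  lagrangeCoeff-* n k k≤n = *-cancelʳ-≡ _ _ (k ! * d !) {{k !* d !≢0}} (begin
    a * (b * n !) * n ! * (suc n + k) * (k ! * d !)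
      ≡⟨ lhs a b (n !) (suc n + k) (k !) (d !) ⟩
    a * (d ! * ((suc n + k) * (b * (k ! * n !)))) * n !
      ≡⟨ cong (λ z → a * (d ! * ((suc n + k) * z)) * n !) ([m+k]Ck*k!*m!≡[m+k]! n k) ⟩
    a * (d ! * (suc n + k) !) * n !
      ≡⟨ cong (λ z → (z C d) * (d ! * (suc n + k) !) * n !) 2n+1≡ ⟩
    ((suc n + k + d) C d) * (d ! * (suc n + k) !) * n !
      ≡⟨ cong (_* n !) ([m+k]Ck*k!*m!≡[m+k]! (suc n + k) d) ⟩
    (suc n + k + d) ! * n !
      ≡⟨ cong₂ (λ z w → z ! * w) (sym 2n+1≡) (sym (nCk*k!*d!≡n!)) ⟩
    (2 * n + 1) ! * ((n C k) * (k ! * d !))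
      ≡⟨ sym (*-assoc ((2 * n + 1) !) (n C k) (k ! * d !)) ⟩
    (2 * n + 1) ! * (n C k) * (k ! * d !) ∎)
    where
    d = n ∸ k
    a = (2 * n + 1) C d
    b = (n + k) C k
    lhs : ∀ a b n s k d → a * (b * n) * n * s * (k * d) ≡ a * (d * (s * (b * (k * n)))) * n
    lhs = solve-ℕ
    2n+1≡ : 2 * n + 1 ≡ suc n + k + d
    2n+1≡ = begin
      2 * n + 1       ≡⟨ r₁ n ⟩
      suc n + n       ≡⟨ cong (λ z → suc n + z) (sym (m+[n∸m]≡n k≤n)) ⟩
      suc n + (k + d) ≡⟨ sym (+-assoc (suc n) k d) ⟩
      suc n + k + d   ∎
      where
      r₁ : ∀ n → 2 * n + 1 ≡ suc n + n
      r₁ = solve-ℕ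
    nCk*k!*d!≡n! : (n C k) * (k ! * d !) ≡ n !
    nCk*k!*d!≡n! = subst (λ z → (z C k) * (k ! * d !) ≡ z !) (m∸n+n≡m k≤n) ([m+k]Ck*k!*m!≡[m+k]! d k)

-- The alternating sum of the weights.

module AlternatingBinomials {c ℓ} (R : CommutativeSemiring c ℓ) where
  open CommutativeSemiring R hiding (zero)
  open PowerSeries R
  open Sums R
  open import Algebra.Properties.Semiring.Exp semiring using (_^_)
  open import Algebra.Solver.Ring.NaturalCoefficients.Default R
    using (solve; _:+_; _:*_; _:=_) renaming (con to con′)
  open import Relation.Binary.Reasoning.Setoid setoid
  private module S = CommutativeSemiring seriesSemiring

  module _ (ε : Carrier) (1+ε≈0 : 1# + ε ≈ 0#) where

    -- The coefficients of (1 + w) ^ a and of (1 + w) ^ -(b + 1).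
    pos neg : ℕ → Series
    pos a i = nat (a C i)
    neg b k = ε ^ k * nat ((b ℕ.+ k) C k)

    1+w : Series
    1+w = 𝟙 ⊞ shift 1 𝟙

    1+w-⋆ : ∀ a → 1+w ⋆ a ≋ a ⊞ shift 1 a
    1+w-⋆ a n = trans (⋆-distribʳ a 𝟙 (shift 1 𝟙) n)
      (+-cong (⋆-identityˡ a n) (trans (shift-⋆ 1 𝟙 a n) (shift-cong 1 (⋆-identityˡ a) n)))

    pos-suc : ∀ a → 1+w ⋆ pos a ≋ pos (suc a)
    pos-suc a zero    = trans (1+w-⋆ (pos a) 0) (+-identityʳ _)
    pos-suc a (suc n) = begin
      (1+w ⋆ pos a) (suc n)             ≈⟨ 1+w-⋆ (pos a) (suc n) ⟩
      nat (a C suc n) + nat (a C n)     ≈⟨ +-comm _ _ ⟩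
      nat (a C n) + nat (a C suc n)     ≈⟨ nat-+ (a C n) (a C suc n) ⟨
      nat (a C n ℕ.+ a C suc n)         ≡⟨ ≡.cong nat (nCk+nC[k+1]≡[n+1]C[k+1] a n) ⟩
      nat (suc a C suc n) ∎

    pos-≋ : ∀ a → pos a ≋ 1+w ^^ a
    pos-≋ zero    zero    = +-identityʳ 1#
    pos-≋ zero    (suc n) = refl
    pos-≋ (suc a) n       = trans (sym (pos-suc a n)) (⋆-cong {1+w} (λ _ → refl) (pos-≋ a) n)

    1+w-neg-zero : 1+w ⋆ neg 0 ≋ 𝟙
    1+w-neg-zero zero    = trans (1+w-⋆ (neg 0) 0)
      (trans (+-identityʳ _) (trans (*-identityˡ _) (+-identityʳ 1#)))
    1+w-neg-zero (suc n) = begin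
      (1+w ⋆ neg 0) (suc n)
        ≈⟨ 1+w-⋆ (neg 0) (suc n) ⟩
      ε * ε ^ n * nat (suc n C suc n) + ε ^ n * nat (n C n)
        ≡⟨ ≡.cong₂ (λ x y → ε * ε ^ n * nat x + ε ^ n * nat y) (nCn≡1 (suc n)) (nCn≡1 n) ⟩
      ε * ε ^ n * nat 1 + ε ^ n * nat 1
        ≈⟨ solve 3 (λ e x y → e :* x :* y :+ x :* y := (con′ 1 :+ e) :* (x :* y)) refl ε (ε ^ n) (nat 1) ⟩
      (1# + ε) * (ε ^ n * nat 1)
        ≈⟨ trans (*-congʳ 1+ε≈0) (zeroˡ _) ⟩
      0# ∎

    -- Pascal's rule splits the binomial coefficient of the higher index in two; one part cancels
    -- against the shifted term because 1 + ε = 0, the other is the claim.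
    1+w-neg-suc : ∀ b → 1+w ⋆ neg (suc b) ≋ neg b
    1+w-neg-suc b zero    = trans (1+w-⋆ (neg (suc b)) 0) (+-identityʳ _)
    1+w-neg-suc b (suc n) = begin
      (1+w ⋆ neg (suc b)) (suc n)
        ≈⟨ 1+w-⋆ (neg (suc b)) (suc n) ⟩
      ε * ε ^ n * nat (suc (b ℕ.+ suc n) C suc n) + ε ^ n * nat ((suc b ℕ.+ n) C n)
        ≡⟨ ≡.cong₂ (λ x y → ε * ε ^ n * nat x + ε ^ n * nat (y C n))
             (≡.sym (nCk+nC[k+1]≡[n+1]C[k+1] (b ℕ.+ suc n) n)) (≡.sym (ℕₚ.+-suc b n)) ⟩
      ε * ε ^ n * nat (c₀ ℕ.+ c₁) + ε ^ n * nat c₀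
        ≈⟨ +-congʳ (*-congˡ (nat-+ c₀ c₁)) ⟩
      ε * ε ^ n * (nat c₀ + nat c₁) + ε ^ n * nat c₀
        ≈⟨ solve 4 (λ e x y z → e :* x :* (y :+ z) :+ x :* y := (con′ 1 :+ e) :* (x :* y) :+ e :* x :* z)
             refl ε (ε ^ n) (nat c₀) (nat c₁) ⟩
      (1# + ε) * (ε ^ n * nat c₀) + ε * ε ^ n * nat c₁
        ≈⟨ trans (+-congʳ (trans (*-congʳ 1+ε≈0) (zeroˡ _))) (+-identityˡ _) ⟩
      ε * ε ^ n * nat c₁ ∎
      where
      c₀ = (b ℕ.+ suc n) C n
      c₁ = (b ℕ.+ suc n) C suc n

    1+w^-neg : ∀ b → 1+w ^^ suc b ⋆ neg b ≋ 𝟙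
    1+w^-neg zero    n = trans (⋆-cong {1+w ^^ 1} (S.*-identityʳ 1+w) (λ _ → refl) n) (1+w-neg-zero n)
    1+w^-neg (suc b) n = begin
      ((1+w ⋆ 1+w ^^ suc b) ⋆ neg (suc b)) n  ≈⟨ ⋆-cong (⋆-comm 1+w (1+w ^^ suc b)) (λ _ → refl) n ⟩
      ((1+w ^^ suc b ⋆ 1+w) ⋆ neg (suc b)) n  ≈⟨ ⋆-assoc (1+w ^^ suc b) 1+w (neg (suc b)) n ⟩
      (1+w ^^ suc b ⋆ (1+w ⋆ neg (suc b))) n  ≈⟨ ⋆-cong {1+w ^^ suc b} (λ _ → refl) (1+w-neg-suc b) n ⟩
      (1+w ^^ suc b ⋆ neg b) n                ≈⟨ 1+w^-neg b n ⟩
      𝟙 n ∎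

    pos-neg : ∀ a b → pos (a ℕ.+ suc b) ⋆ neg b ≋ pos a
    pos-neg a b n = begin
      (pos (a ℕ.+ suc b) ⋆ neg b) n
        ≈⟨ ⋆-cong (λ i → trans (pos-≋ (a ℕ.+ suc b) i) (^^-homo 1+w a (suc b) i)) (λ _ → refl) n ⟩
      ((1+w ^^ a ⋆ 1+w ^^ suc b) ⋆ neg b) n
        ≈⟨ ⋆-assoc (1+w ^^ a) (1+w ^^ suc b) (neg b) n ⟩
      (1+w ^^ a ⋆ (1+w ^^ suc b ⋆ neg b)) n
        ≈⟨ ⋆-cong {1+w ^^ a} (λ _ → refl) (1+w^-neg b) n ⟩
      (1+w ^^ a ⋆ 𝟙) n
        ≈⟨ S.*-identityʳ (1+w ^^ a) n ⟩
      (1+w ^^ a) n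
        ≈⟨ pos-≋ a n ⟨
      pos a n ∎

    -- Up to the factor n! the sum is a convolution, namely the coefficient of w^n in (1+w)^(2n+1)
    -- (1+w)^-(n+1) = (1+w)^n, which is 1.
    ∑-lagrangeCoeff : ∀ n → ∑ (suc n) (λ k → ε ^ k * nat (lagrangeCoeff n k)) ≈ nat (n !)
    ∑-lagrangeCoeff n = begin
      ∑ (suc n) (λ k → ε ^ k * nat (lagrangeCoeff n k))
        ≈⟨ ∑-cong (suc n) (λ k _ → trans (*-congˡ (trans (nat-* ((2 ℕ.* n ℕ.+ 1) C (n ℕ.∸ k)) _) (*-congˡ (nat-* ((n ℕ.+ k) C k) (n !)))))
             (solve 4 (λ e x y z → e :* (x :* (y :* z)) := z :* (e :* y :* x)) refl _ _ _ _)) ⟩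
      ∑ (suc n) (λ k → nat (n !) * (neg n k * nat ((2 ℕ.* n ℕ.+ 1) C (n ℕ.∸ k))))
        ≈⟨ *-∑ (nat (n !)) (suc n) _ ⟨
      nat (n !) * ∑ (suc n) (λ k → neg n k * pos (2 ℕ.* n ℕ.+ 1) (n ℕ.∸ k))
        ≈⟨ *-congˡ (⋆-as-∑ (neg n) (pos (2 ℕ.* n ℕ.+ 1)) n) ⟨
      nat (n !) * (neg n ⋆ pos (2 ℕ.* n ℕ.+ 1)) n
        ≈⟨ *-congˡ (⋆-comm (neg n) (pos (2 ℕ.* n ℕ.+ 1)) n) ⟩
      nat (n !) * (pos (2 ℕ.* n ℕ.+ 1) ⋆ neg n) n
        ≡⟨ ≡.cong (λ m → nat (n !) * (pos m ⋆ neg n) n) 2n+1≡ ⟩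
      nat (n !) * (pos (n ℕ.+ suc n) ⋆ neg n) n
        ≈⟨ *-congˡ (trans (pos-neg n n n) (trans (reflexive (≡.cong nat (nCn≡1 n))) (+-identityʳ 1#))) ⟩
      nat (n !) * 1#
        ≈⟨ *-identityʳ _ ⟩
      nat (n !) ∎
      where
      2n+1≡ : 2 ℕ.* n ℕ.+ 1 ≡ n ℕ.+ suc n
      2n+1≡ = ≡.trans (ℕₚ.+-comm (2 ℕ.* n) 1)
        (≡.trans (≡.cong (λ z → suc (n ℕ.+ z)) (ℕₚ.+-identityʳ n)) (≡.sym (ℕₚ.+-suc n n)))

-- Coefficients of the compositional inverse.

module LagrangeInversion {c ℓ} (R : CommutativeRing c ℓ) where
  open CommutativeRing R hiding (zero)
  open PowerSeries commutativeSemiring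
  open Sums commutativeSemiring
  open import Algebra.Properties.Semiring.Exp semiring using (_^_)
  open import Algebra.Properties.AbelianGroup +-abelianGroup using (xyx⁻¹≈y)
  open import Algebra.Solver.Ring.NaturalCoefficients.Default commutativeSemiring
    using (solve; _:+_; _:*_; _:=_)
  open import Relation.Binary.Reasoning.Setoid setoid
  private module S = CommutativeSemiring seriesSemiring
  open AlternatingBinomials commutativeSemiring using (∑-lagrangeCoeff)

  ε : Carrier
  ε = - 1#

  -- The substitute for division by integers: an identity that holds after multiplication by a
  -- nonzero integer may be cancelled.
  TorsionFree : Set _
  TorsionFree = ∀ n → .{{ℕ.NonZero n}} → ∀ x → nat n * x ≈ 0# → x ≈ 0#

  module Inverse (torsionFree : TorsionFree) (h : Series) (h₀≈1 : h 0 ≈ 1#) where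

    W : Series
    W = shift 1 𝟙

    -- F m is the m-th power of w h(w).
    F : ℕ → Series
    F m = shift m (h ^^ m)

    -- The coefficients of the compositional inverse of w h(w).
    mutual
      inverse : ℕ → Carrier
      inverse m = W m + - partial m m

      partial : ℕ → Series
      partial zero    i = 0#
      partial (suc M) i = partial M i + inverse M * F M i

    partial-∑ : ∀ M i → partial M i ≡ ∑ M (λ m → inverse m * F m i)
    partial-∑ zero    i = ≡.refl
    partial-∑ (suc M) i = ≡.cong (_+ inverse M * F M i) (partial-∑ M i)

    F-diagonal : ∀ m → F m m ≈ 1#
    F-diagonal m = begin
      F m m           ≡⟨ ≡.cong (F m) (≡.sym (ℕₚ.+-identityʳ m)) ⟩
      F m (m ℕ.+ 0)   ≡⟨ shift-+ m (h ^^ m) 0 ⟩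
      (h ^^ m) 0      ≈⟨ ^^-constant m h₀≈1 ⟩
      1#              ∎

    -- `F M` is divisible by w^M, so adding a multiple of it keeps the earlier coefficients; its own
    -- coefficient at M is 1, so `inverse M` can be chosen without division to make coefficient M
    -- right.
    partial-≈ : ∀ M i → i ℕ.< M → partial M i ≈ W i
    partial-≈ (suc M) i (s≤s i≤M) with ℕₚ.m≤n⇒m<n∨m≡n i≤M
    ... | inj₁ i<M = begin
      partial M i + inverse M * F M i   ≡⟨ ≡.cong (λ x → partial M i + inverse M * x) (shift-< M (h ^^ M) i i<M) ⟩
      partial M i + inverse M * 0#      ≈⟨ trans (+-congˡ (zeroʳ _)) (+-identityʳ _) ⟩
      partial M i                       ≈⟨ partial-≈ M i i<M ⟩
      W i                               ∎
    ... | inj₂ ≡.refl = begin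
      partial M M + inverse M * F M M   ≈⟨ +-congˡ (trans (*-congˡ (F-diagonal M)) (*-identityʳ _)) ⟩
      partial M M + (W M + - partial M M) ≈⟨ sym (+-assoc _ _ _) ⟩
      partial M M + W M + - partial M M ≈⟨ xyx⁻¹≈y _ _ ⟩
      W M                               ∎

    -- Since θ (w h) = w (h + θ h), this is θ of the (m+1)-st power of w h, stripped of the factors
    -- m + 1 and w^(m+1).
    K : ℕ → Series
    K m = h ^^ m ⋆ (h ⊞ θ h)

    θ-F : ∀ m → θ (F (suc m)) ≋ nat (suc m) ∙ shift (suc m) (K m)
    θ-F m n = begin
      θ (F (suc m)) n
        ≈⟨ θ-shift (suc m) (h ^^ suc m) n ⟩
      shift (suc m) (nat (suc m) ∙ h ^^ suc m ⊞ θ (h ^^ suc m)) n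
        ≈⟨ shift-cong (suc m) (λ i → begin
             nat (suc m) * (h ^^ suc m) i + θ (h ^^ suc m) i
               ≈⟨ +-cong (*-congˡ (⋆-comm h (h ^^ m) i)) (θ-^^ m h i) ⟩
             nat (suc m) * (h ^^ m ⋆ h) i + nat (suc m) * (h ^^ m ⋆ θ h) i
               ≈⟨ distribˡ _ _ _ ⟨
             nat (suc m) * ((h ^^ m ⋆ h) i + (h ^^ m ⋆ θ h) i)
               ≈⟨ *-congˡ (S.distribˡ (h ^^ m) h (θ h) i) ⟨
             nat (suc m) * K m i ∎) n ⟩
      shift (suc m) (nat (suc m) ∙ K m) n
        ≈⟨ shift-∙ (suc m) _ (K m) n ⟩
      nat (suc m) * shift (suc m) (K m) n ∎

    -- θ acts on each coefficient separately, so it preserves agreement up to the order M, and it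
    -- fixes w.
    θ-partial : ∀ M i → i ℕ.< M → ∑ M (λ m → inverse m * θ (F m) i) ≈ W i
    θ-partial M i i<M = begin
      ∑ M (λ m → inverse m * (nat i * F m i))
        ≈⟨ ∑-cong M (λ m _ → solve 3 (λ x y z → x :* (y :* z) := y :* (x :* z)) refl _ _ _) ⟩
      ∑ M (λ m → nat i * (inverse m * F m i))
        ≈⟨ *-∑ (nat i) M _ ⟨
      nat i * ∑ M (λ m → inverse m * F m i)
        ≡⟨ ≡.cong (nat i *_) (≡.sym (partial-∑ M i)) ⟩
      nat i * partial M i
        ≈⟨ *-congˡ (partial-≈ M i i<M) ⟩
      θ W i
        ≈⟨ θ-W i ⟩
      W i ∎
      where
      θ-W : θ W ≋ W
      θ-W zero          = zeroˡ _
      θ-W (suc zero)    = trans (*-identityʳ _) (+-identityʳ 1#)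
      θ-W (suc (suc i)) = zeroʳ _

    -- The differentiated identity is multiplied by an arbitrary P and read off at w^(n+1). The
    -- factor w on the left lowers the index to n. A partial sum of length n + 2 is exact up to this
    -- coefficient, and its summand 0 drops out because θ kills constants.
    θ-partial-⋆ : ∀ n P →
      P n ≈ ∑ (suc n) (λ m → inverse (suc m) * (nat (suc m) * shift m (K m ⋆ P) n))
    θ-partial-⋆ n P = begin
      P n
        ≈⟨ ⋆-identityˡ P n ⟨
      (𝟙 ⋆ P) n
        ≈⟨ shift-⋆ 1 𝟙 P (suc n) ⟨
      (W ⋆ P) (suc n)
        ≈⟨ ⋆-cong-≤ (suc n) {b = P} (λ i i≤n → θ-partial (suc (suc n)) i (s≤s i≤n)) (λ _ _ → refl) ⟨
      ((λ i → ∑ (suc (suc n)) (λ m → inverse m * θ (F m) i)) ⋆ P) (suc n)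
        ≈⟨ ∑-⋆ (suc (suc n)) (λ m → inverse m ∙ θ (F m)) P (suc n) ⟩
      ∑ (suc (suc n)) (λ m → ((inverse m ∙ θ (F m)) ⋆ P) (suc n))
        ≈⟨ ∑-cong (suc (suc n)) (λ m _ → ∙-⋆ (inverse m) (θ (F m)) P (suc n)) ⟩
      ∑ (suc (suc n)) (λ m → inverse m * (θ (F m) ⋆ P) (suc n))
        ≈⟨ ∑-head (suc n) _ ⟩
      inverse 0 * (θ 𝟙 ⋆ P) (suc n) + ∑ (suc n) (λ m → inverse (suc m) * (θ (F (suc m)) ⋆ P) (suc n))
        ≈⟨ +-cong
             (trans (*-congˡ (trans (⋆-cong θ-𝟙 (λ _ → refl) (suc n)) (⋆-zeroˡ P (suc n)))) (zeroʳ _))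
             (∑-cong (suc n) λ m _ → *-congˡ (term m)) ⟩
      0# + ∑ (suc n) (λ m → inverse (suc m) * (nat (suc m) * shift m (K m ⋆ P) n))
        ≈⟨ +-identityˡ _ ⟩
      ∑ (suc n) (λ m → inverse (suc m) * (nat (suc m) * shift m (K m ⋆ P) n)) ∎
      where
      θ-𝟙 : θ 𝟙 ≋ 𝟘
      θ-𝟙 zero    = zeroˡ _
      θ-𝟙 (suc i) = zeroʳ _
      term : ∀ m → (θ (F (suc m)) ⋆ P) (suc n) ≈ nat (suc m) * shift m (K m ⋆ P) n
      term m = begin
        (θ (F (suc m)) ⋆ P) (suc n)
          ≈⟨ ⋆-cong (θ-F m) (λ _ → refl) (suc n) ⟩
        ((nat (suc m) ∙ shift (suc m) (K m)) ⋆ P) (suc n)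
          ≈⟨ ∙-⋆ _ (shift (suc m) (K m)) P (suc n) ⟩
        nat (suc m) * (shift (suc m) (K m) ⋆ P) (suc n)
          ≈⟨ *-congˡ (shift-⋆ (suc m) (K m) P (suc n)) ⟩
        nat (suc m) * shift m (K m ⋆ P) n ∎

    ∙-^^ : ∀ x a k → (x ∙ a) ^^ k ≋ x ^ k ∙ a ^^ k
    ∙-^^ x a zero    n = sym (*-identityˡ _)
    ∙-^^ x a (suc k) n = begin
      ((x ∙ a) ⋆ (x ∙ a) ^^ k) n          ≈⟨ ∙-⋆ x a _ n ⟩
      x * (a ⋆ (x ∙ a) ^^ k) n            ≈⟨ *-congˡ (⋆-cong {a} (λ _ → refl) (∙-^^ x a k) n) ⟩
      x * (a ⋆ (x ^ k ∙ a ^^ k)) n        ≈⟨ *-congˡ (⋆-∙ (x ^ k) a _ n) ⟩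
      x * (x ^ k * (a ⋆ a ^^ k) n)        ≈⟨ *-assoc _ _ _ ⟨
      x * x ^ k * (a ⋆ a ^^ k) n          ∎

    1-h : Series
    1-h = ε ∙ h ⊞ 𝟙

    1-h^ : ∀ n → 1-h ^^ n ≋ (λ i → ∑ (suc n) (λ k → ε ^ k * nat (n C k) * (h ^^ k) i))
    1-h^ n i = begin
      (1-h ^^ n) i
        ≈⟨ binomial-series n (ε ∙ h) 𝟙 i ⟩
      ∑ (suc n) (λ k → nat (n C k) * ((ε ∙ h) ^^ k ⋆ 𝟙 ^^ (n ℕ.∸ k)) i)
        ≈⟨ ∑-cong (suc n) (λ k _ → begin
             nat (n C k) * ((ε ∙ h) ^^ k ⋆ 𝟙 ^^ (n ℕ.∸ k)) i
               ≈⟨ *-congˡ (⋆-cong {(ε ∙ h) ^^ k} (λ _ → refl) (𝟙-^^ (n ℕ.∸ k)) i) ⟩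
             nat (n C k) * ((ε ∙ h) ^^ k ⋆ 𝟙) i
               ≈⟨ *-congˡ (trans (S.*-identityʳ ((ε ∙ h) ^^ k) i) (∙-^^ ε h k i)) ⟩
             nat (n C k) * (ε ^ k * (h ^^ k) i)
               ≈⟨ solve 3 (λ x y z → x :* (y :* z) := y :* x :* z) refl _ _ _ ⟩
             ε ^ k * nat (n C k) * (h ^^ k) i ∎) ⟩
      ∑ (suc n) (λ k → ε ^ k * nat (n C k) * (h ^^ k) i) ∎
      where
      𝟙-^^ : ∀ m → 𝟙 ^^ m ≋ 𝟙
      𝟙-^^ zero    i = refl
      𝟙-^^ (suc m) i = trans (⋆-identityˡ _ i) (𝟙-^^ m i)

    -- As 1 - h has no constant term, the n-th differences of h ^ (m + k) in k vanish to order n.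
    differences-vanish : ∀ n m l → l ℕ.≤ n →
      ∑ (suc n) (λ k → ε ^ k * nat (n C k) * (h ^^ (m ℕ.+ k) ⋆ θ h) l) ≈ 0#
    differences-vanish n m l l≤n = begin
      ∑ (suc n) (λ k → ε ^ k * nat (n C k) * (h ^^ (m ℕ.+ k) ⋆ θ h) l)
        ≈⟨ ∑-cong (suc n) (λ k _ → begin
             ε ^ k * nat (n C k) * (h ^^ (m ℕ.+ k) ⋆ θ h) l
               ≈⟨ *-congˡ (trans (⋆-cong (^^-homo h m k) (λ _ → refl) l)
                    (trans (S.*-assoc (h ^^ m) (h ^^ k) (θ h) l)
                    (trans (⋆-cong {h ^^ m} (λ _ → refl) (⋆-comm (h ^^ k) (θ h)) l)
                           (sym (⋆-assoc (h ^^ m) (θ h) (h ^^ k) l))))) ⟩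
             ε ^ k * nat (n C k) * ((h ^^ m ⋆ θ h) ⋆ h ^^ k) l
               ≈⟨ ⋆-∙ _ (h ^^ m ⋆ θ h) (h ^^ k) l ⟨
             ((h ^^ m ⋆ θ h) ⋆ ((ε ^ k * nat (n C k)) ∙ h ^^ k)) l ∎) ⟩
      ∑ (suc n) (λ k → ((h ^^ m ⋆ θ h) ⋆ ((ε ^ k * nat (n C k)) ∙ h ^^ k)) l)
        ≈⟨ ⋆-∑ (suc n) (h ^^ m ⋆ θ h) (λ k → (ε ^ k * nat (n C k)) ∙ h ^^ k) l ⟨
      ((h ^^ m ⋆ θ h) ⋆ (λ i → ∑ (suc n) (λ k → ε ^ k * nat (n C k) * (h ^^ k) i))) l
        ≈⟨ ⋆-cong {h ^^ m ⋆ θ h} (λ _ → refl) (1-h^ n) l ⟨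
      ((h ^^ m ⋆ θ h) ⋆ 1-h ^^ n) l
        -- θ h has no constant term, which gives one order beyond the n orders of (1 - h)^n; this is
        -- what covers the case l = n.
        ≈⟨ Ord-⋆ 1 n (h ^^ m ⋆ θ h) (1-h ^^ n) (λ { zero _ → θh₀ ; (suc _) (s≤s ()) })
             (Ord-^^ 1-h 1-h₀ n) l (s≤s l≤n) ⟩
      0# ∎
      where
      θh₀ : (h ^^ m ⋆ θ h) 0 ≈ 0#
      θh₀ = trans (*-congˡ (zeroˡ _)) (zeroʳ _)
      1-h₀ : 1-h 0 ≈ 0#
      1-h₀ = trans (+-congʳ (trans (*-congˡ h₀≈1) (*-identityʳ ε))) (-‿inverseˡ 1#)

    -- A multiple of the interpolation of h ^ -(n + 1) by the powers h ^ 0, ..., h ^ n.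
    P : ℕ → Series
    P n i = ∑ (suc n) (λ k → ε ^ k * nat (lagrangeCoeff n k) * (h ^^ k) i)

    K-⋆-P : ∀ n m l → (K m ⋆ P n) l ≈
      ∑ (suc n) (λ k → ε ^ k * nat (lagrangeCoeff n k) * K (m ℕ.+ k) l)
    K-⋆-P n m l = trans (⋆-∑ (suc n) (K m) (λ k → (ε ^ k * nat (lagrangeCoeff n k)) ∙ h ^^ k) l)
      (∑-cong (suc n) λ k _ → trans (⋆-∙ _ (K m) (h ^^ k) l) (*-congˡ (begin
        ((h ^^ m ⋆ (h ⊞ θ h)) ⋆ h ^^ k) l  ≈⟨ ⋆-assoc (h ^^ m) (h ⊞ θ h) (h ^^ k) l ⟩
        (h ^^ m ⋆ ((h ⊞ θ h) ⋆ h ^^ k)) l  ≈⟨ ⋆-cong {h ^^ m} (λ _ → refl) (⋆-comm (h ⊞ θ h) (h ^^ k)) l ⟩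
        (h ^^ m ⋆ (h ^^ k ⋆ (h ⊞ θ h))) l  ≈⟨ ⋆-assoc (h ^^ m) (h ^^ k) (h ⊞ θ h) l ⟨
        ((h ^^ m ⋆ h ^^ k) ⋆ (h ⊞ θ h)) l  ≈⟨ ⋆-cong (^^-homo h m k) (λ _ → refl) l ⟨
        K (m ℕ.+ k) l                      ∎)))

    -- At index l, multiplication by l is θ, and θ (h^(m+1)) = (m+1) h^m θ h. So the part h^(m+1) of
    -- `K m` contributes m + 1 and the part h^m θ h contributes l.
    nat-*-K : ∀ l m → nat l * K m l ≈ nat (suc m ℕ.+ l) * (h ^^ m ⋆ θ h) l
    nat-*-K l m = begin
      nat l * (h ^^ m ⋆ (h ⊞ θ h)) l
        ≈⟨ *-congˡ (S.distribˡ (h ^^ m) h (θ h) l) ⟩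
      nat l * ((h ^^ m ⋆ h) l + (h ^^ m ⋆ θ h) l)
        ≈⟨ distribˡ _ _ _ ⟩
      nat l * (h ^^ m ⋆ h) l + nat l * (h ^^ m ⋆ θ h) l
        ≈⟨ +-congʳ (trans (*-congˡ (⋆-comm (h ^^ m) h l)) (θ-^^ m h l)) ⟩
      nat (suc m) * (h ^^ m ⋆ θ h) l + nat l * (h ^^ m ⋆ θ h) l
        ≈⟨ distribʳ _ _ _ ⟨
      (nat (suc m) + nat l) * (h ^^ m ⋆ θ h) l
        ≈⟨ *-congʳ (nat-+ (suc m) l) ⟨
      nat (suc m ℕ.+ l) * (h ^^ m ⋆ θ h) l ∎

    -- After multiplication by n! (l+1), `nat-*-K` supplies the factor n + 1 + k to summand k, and
    -- `lagrangeCoeff-*` leaves (2n+1)! times an n-th difference, which is zero. Torsion-freeness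
    -- removes the multiplier.
    K-⋆-P-vanishes : ∀ m l → (K m ⋆ P (m ℕ.+ suc l)) (suc l) ≈ 0#
    K-⋆-P-vanishes m l = torsionFree (n ! ℕ.* suc l) {{ℕₚ.m*n≢0 (n !) (suc l) {{n ℕₚ.!≢0}}}} _ (begin
      nat (n ! ℕ.* suc l) * (K m ⋆ P n) (suc l)
        ≈⟨ *-cong (nat-* (n !) (suc l)) (K-⋆-P n m (suc l)) ⟩
      nat (n !) * nat (suc l) * ∑ (suc n) (λ k → ε ^ k * nat (lagrangeCoeff n k) * K (m ℕ.+ k) (suc l))
        ≈⟨ *-∑ _ (suc n) _ ⟩
      ∑ (suc n) (λ k → nat (n !) * nat (suc l) * (ε ^ k * nat (lagrangeCoeff n k) * K (m ℕ.+ k) (suc l)))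
        ≈⟨ ∑-cong (suc n) (λ { k (s≤s k≤n) → begin
             nat (n !) * nat (suc l) * (ε ^ k * nat (lagrangeCoeff n k) * K (m ℕ.+ k) (suc l))
               ≈⟨ solve 5 (λ x y e a z → x :* y :* (e :* a :* z) := e :* (a :* x) :* (y :* z)) refl _ _ _ _ _ ⟩
             ε ^ k * (nat (lagrangeCoeff n k) * nat (n !)) * (nat (suc l) * K (m ℕ.+ k) (suc l))
               ≈⟨ *-cong (*-congˡ (sym (nat-* (lagrangeCoeff n k) (n !)))) (nat-*-K (suc l) (m ℕ.+ k)) ⟩
             ε ^ k * nat (lagrangeCoeff n k ℕ.* n !) * (nat (suc (m ℕ.+ k) ℕ.+ suc l) * E k)
               ≡⟨ ≡.cong (λ z → ε ^ k * nat (lagrangeCoeff n k ℕ.* n !) * (nat z * E k)) (index k) ⟩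
             ε ^ k * nat (lagrangeCoeff n k ℕ.* n !) * (nat (suc n ℕ.+ k) * E k)
               ≈⟨ solve 4 (λ e a b z → e :* a :* (b :* z) := e :* (a :* b) :* z) refl _ _ _ _ ⟩
             ε ^ k * (nat (lagrangeCoeff n k ℕ.* n !) * nat (suc n ℕ.+ k)) * E k
               ≈⟨ *-congʳ (*-congˡ (trans (sym (nat-* (lagrangeCoeff n k ℕ.* n !) (suc n ℕ.+ k)))
                    (trans (reflexive (≡.cong nat (lagrangeCoeff-* n k k≤n)))
                           (nat-* ((2 ℕ.* n ℕ.+ 1) !) (n C k))))) ⟩
             ε ^ k * (nat ((2 ℕ.* n ℕ.+ 1) !) * nat (n C k)) * E k
               ≈⟨ solve 4 (λ e a b z → e :* (a :* b) :* z := a :* (e :* b :* z)) refl _ _ _ _ ⟩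
             nat ((2 ℕ.* n ℕ.+ 1) !) * (ε ^ k * nat (n C k) * E k) ∎ }) ⟩
      ∑ (suc n) (λ k → nat ((2 ℕ.* n ℕ.+ 1) !) * (ε ^ k * nat (n C k) * E k))
        ≈⟨ *-∑ _ (suc n) _ ⟨
      nat ((2 ℕ.* n ℕ.+ 1) !) * ∑ (suc n) (λ k → ε ^ k * nat (n C k) * E k)
        ≈⟨ *-congˡ (differences-vanish n m (suc l) (ℕₚ.m≤n+m (suc l) m)) ⟩
      nat ((2 ℕ.* n ℕ.+ 1) !) * 0#
        ≈⟨ zeroʳ _ ⟩
      0# ∎)
      where
      n = m ℕ.+ suc l
      E : ℕ → Carrier
      E k = (h ^^ (m ℕ.+ k) ⋆ θ h) (suc l)
      index : ∀ k → suc (m ℕ.+ k) ℕ.+ suc l ≡ suc n ℕ.+ k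
      index k = ≡.cong suc (≡.trans (ℕₚ.+-assoc m k (suc l))
        (≡.trans (≡.cong (m ℕ.+_) (ℕₚ.+-comm k (suc l))) (≡.sym (ℕₚ.+-assoc m (suc l) k))))

    -- All powers of h have constant term 1, so only the alternating sum of the weights is left.
    K-⋆-P-constant : ∀ n m → (K m ⋆ P n) 0 ≈ nat (n !)
    K-⋆-P-constant n m = begin
      K m 0 * P n 0
        ≈⟨ *-congʳ (*-cong (^^-constant m h₀≈1) (+-cong h₀≈1 (zeroˡ _))) ⟩
      1# * (1# + 0#) * P n 0
        ≈⟨ trans (*-congʳ (trans (*-identityˡ _) (+-identityʳ 1#))) (*-identityˡ _) ⟩
      P n 0
        ≈⟨ ∑-cong (suc n) (λ k _ → trans (*-congˡ (^^-constant k h₀≈1)) (*-identityʳ _)) ⟩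
      ∑ (suc n) (λ k → ε ^ k * nat (lagrangeCoeff n k))
        ≈⟨ ∑-lagrangeCoeff ε (-‿inverseʳ 1#) n ⟩
      nat (n !) ∎

    -- In `θ-partial-⋆` with the polynomial `P n`, a summand m < n involves the coefficient of
    -- w^(n-m), of positive index, and vanishes. The summand m = n involves a constant term n!, and
    -- (n+1) n! = (n+1)!.
    inverse-formula : ∀ n → nat (suc n !) * inverse (suc n) ≈ P n n
    inverse-formula n = sym (begin
      P n n
        ≈⟨ θ-partial-⋆ n (P n) ⟩
      ∑ n (λ m → inverse (suc m) * (nat (suc m) * shift m (K m ⋆ P n) n))
        + inverse (suc n) * (nat (suc n) * shift n (K n ⋆ P n) n)
        ≈⟨ +-cong
             (∑-zero n λ m m<n → trans (*-congˡ (trans (*-congˡ (vanish m m<n)) (zeroʳ _))) (zeroʳ _))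
             (*-congˡ (*-congˡ last)) ⟩
      0# + inverse (suc n) * (nat (suc n) * nat (n !))
        ≈⟨ trans (+-identityˡ _) (trans (*-comm _ _) (*-congʳ (sym (nat-* (suc n) (n !))))) ⟩
      nat (suc n !) * inverse (suc n) ∎)
      where
      last : shift n (K n ⋆ P n) n ≈ nat (n !)
      last = begin
        shift n (K n ⋆ P n) n          ≡⟨ ≡.cong (shift n (K n ⋆ P n)) (≡.sym (ℕₚ.+-identityʳ n)) ⟩
        shift n (K n ⋆ P n) (n ℕ.+ 0)  ≡⟨ shift-+ n (K n ⋆ P n) 0 ⟩
        (K n ⋆ P n) 0                  ≈⟨ K-⋆-P-constant n n ⟩
        nat (n !)                      ∎
      vanish : ∀ m → m ℕ.< n → shift m (K m ⋆ P n) n ≈ 0#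
      vanish m m<n with ℕₚ.m≤n⇒∃[o]m+o≡n m<n
      ... | l , 1+m+l≡n with ≡.trans (ℕₚ.+-suc m l) 1+m+l≡n
      ... | ≡.refl = trans (reflexive (shift-+ m (K m ⋆ P n) (suc l))) (K-⋆-P-vanishes m l)

-- Evaluation and Taylor expansion

module Evaluation {c ℓ} (R : CommutativeSemiring c ℓ) where
  open CommutativeSemiring R hiding (zero)
  open PowerSeries R
  open Sums R
  open import Algebra.Properties.Semiring.Exp semiring using (_^_)
  open import Algebra.Solver.Ring.NaturalCoefficients.Default R
    using (solve; _:+_; _:*_; _:=_) renaming (con to con′)
  open import Relation.Binary.Reasoning.Setoid setoid

  -- v is a value of the series a at s modulo s ^ M.
  EvalsTo : Carrier → ℕ → Series → Carrier → Set (c ⊔ ℓ)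
  EvalsTo s zero    a v = ⊤
  EvalsTo s (suc M) a v = ∃ λ v′ → v ≈ a 0 + s * v′ × EvalsTo s M (tl a) v′

  module _ {s : Carrier} where

    evals-resp-< : ∀ M {a b v} → (∀ i → i ℕ.< M → a i ≈ b i) → EvalsTo s M a v → EvalsTo s M b v
    evals-resp-< zero    a≈b _            = tt
    evals-resp-< (suc M) a≈b (v′ , e , p) =
      v′ , trans e (+-congʳ (a≈b 0 (s≤s z≤n))) , evals-resp-< M (λ i i<M → a≈b (suc i) (s≤s i<M)) p

    evals-resp : ∀ M {a b v} → a ≋ b → EvalsTo s M a v → EvalsTo s M b v
    evals-resp M a≋b = evals-resp-< M (λ i _ → a≋b i)

    evals-≈ : ∀ M {a v w} → v ≈ w → EvalsTo s M a v → EvalsTo s M a w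
    evals-≈ zero    v≈w _            = tt
    evals-≈ (suc M) v≈w (v′ , e , p) = v′ , trans (sym v≈w) e , p

    evals-weaken : ∀ M {a v} → EvalsTo s (suc M) a v → EvalsTo s M a v
    evals-weaken zero    _            = tt
    evals-weaken (suc M) (v′ , e , p) = v′ , e , evals-weaken M p

    evals-𝟘 : ∀ M → EvalsTo s M 𝟘 0#
    evals-𝟘 zero    = tt
    evals-𝟘 (suc M) = 0# , sym (trans (+-identityˡ _) (zeroʳ s)) , evals-𝟘 M

    evals-𝟙 : ∀ M → EvalsTo s M 𝟙 1#
    evals-𝟙 zero    = tt
    evals-𝟙 (suc M) = 0# , sym (trans (+-congˡ (zeroʳ s)) (+-identityʳ _)) , evals-𝟘 M

    evals-⊞ : ∀ M {a b v w} → EvalsTo s M a v → EvalsTo s M b w → EvalsTo s M (a ⊞ b) (v + w)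
    evals-⊞ zero    _            _            = tt
    evals-⊞ (suc M) (v′ , e , p) (w′ , f , q) = v′ + w′
      , trans (+-cong e f)
          (solve 5 (λ a b s x y → a :+ s :* x :+ (b :+ s :* y) := a :+ b :+ s :* (x :+ y)) refl _ _ _ _ _)
      , evals-⊞ M p q

    evals-∙ : ∀ M {a v} x → EvalsTo s M a v → EvalsTo s M (x ∙ a) (x * v)
    evals-∙ zero    x _            = tt
    evals-∙ (suc M) x (v′ , e , p) = x * v′
      , trans (*-congˡ e)
          (solve 4 (λ x a s v → x :* (a :+ s :* v) := x :* a :+ s :* (x :* v)) refl _ _ _ _)
      , evals-∙ M x p

    -- The witness follows the recursion of `⋆`: the tail of a product is a 0 times the tail of b,
    -- plus the tail of a times b.
    evals-⋆ : ∀ M {a b v w} → EvalsTo s M a v → EvalsTo s M b w → EvalsTo s M (a ⋆ b) (v * w)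
    evals-⋆ zero    _            _              = tt
    evals-⋆ (suc M) {a} {b} {w = w} (v′ , e , p) q@(w′ , f , q′) = a 0 * w′ + v′ * w
      , trans (*-congʳ e) (trans (distribʳ _ _ _) (trans (+-congʳ (*-congˡ f))
          (solve 6 (λ a b s v′ w′ w → a :* (b :+ s :* w′) :+ s :* v′ :* w := a :* b :+ s :* (a :* w′ :+ v′ :* w))
             refl _ _ _ _ _ _)))
      , evals-⊞ M (evals-∙ M (a 0) q′) (evals-⋆ M p (evals-weaken M q))

    evals-^^ : ∀ M {a v} → EvalsTo s M a v → ∀ k → EvalsTo s M (a ^^ k) (v ^ k)
    evals-^^ M p zero    = evals-𝟙 M
    evals-^^ M p (suc k) = evals-⋆ M p (evals-^^ M p k)

    evals-shift : ∀ m M {a v} → EvalsTo s M a v → EvalsTo s M (shift m a) (s ^ m * v)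
    evals-shift zero    M       p = evals-≈ M (sym (*-identityˡ _)) (evals-resp M (λ _ → refl) p)
    evals-shift (suc m) zero    p = tt
    evals-shift (suc m) (suc M) p =
      _ , trans (*-assoc _ _ _) (sym (+-identityˡ _)) , evals-shift m M (evals-weaken M p)

    -- Here the chain of remainders is turned back into a congruence modulo s^M.
    evals-𝟘⇒ : ∀ M {v} → EvalsTo s M 𝟘 v → ∃ λ q → v ≈ s ^ M * q
    evals-𝟘⇒ zero    {v} _        = v , sym (*-identityˡ v)
    evals-𝟘⇒ (suc M) (v′ , e , p) with evals-𝟘⇒ M p
    ... | q , v′≈ = q , trans e (trans (+-identityˡ _) (trans (*-congˡ v′≈) (sym (*-assoc _ _ _))))

    evals-w⇒ : ∀ M {v} → EvalsTo s (2 ℕ.+ M) (shift 1 𝟙) v → ∃ λ q → v ≈ s + s ^ (2 ℕ.+ M) * q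
    evals-w⇒ M (v′ , e , v″ , f , p) with evals-𝟘⇒ M p
    ... | q , v″≈ = q , trans e (trans (+-identityˡ _) (trans (*-congˡ (trans f (+-congˡ (*-congˡ v″≈))))
      (solve 3 (λ s x q → s :* (con′ 1 :+ s :* (x :* q)) := s :+ s :* (s :* x) :* q) refl s (s ^ M) q)))

  evalP : List Carrier → Carrier → Carrier
  evalP []       x = 0#
  evalP (a ∷ as) x = a + x * evalP as x

  coef : List Carrier → Series
  coef []       n       = 0#
  coef (a ∷ as) zero    = a
  coef (a ∷ as) (suc n) = coef as n

  evals-coef : ∀ {s} M as → EvalsTo s M (coef as) (evalP as s)
  evals-coef M       []       = evals-𝟘 M
  evals-coef zero    (a ∷ as) = tt
  evals-coef (suc M) (a ∷ as) = _ , refl , evals-coef M as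

  -- Polynomials respect congruences for every modulus d; this makes the iteration for the root a
  -- contraction.
  evalP-mod : ∀ as {x y} d z → x ≈ y + d * z → ∃ λ z′ → evalP as x ≈ evalP as y + d * z′
  evalP-mod []       d z p = 0# , sym (trans (+-identityˡ _) (zeroʳ d))
  evalP-mod (a ∷ as) {x} {y} d z p with evalP-mod as d z p
  ... | z′ , q = z * evalP as y + y * z′ + d * (z * z′)
    , trans (+-congˡ (*-cong p q))
        (solve 6 (λ a y d z e z′ → a :+ (y :+ d :* z) :* (e :+ d :* z′)
                    := a :+ y :* e :+ d :* (z :* e :+ y :* z′ :+ d :* (z :* z′)))
          refl _ _ _ _ _ _)

  scale : Carrier → Carrier → List Carrier → List Carrier
  scale c q []       = []
  scale c q (a ∷ as) = c * a ∷ scale (c * q) q as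

  evalP-scale : ∀ c q as x → evalP (scale c q as) x ≈ c * evalP as (q * x)
  evalP-scale c q []       x = sym (zeroʳ c)
  evalP-scale c q (a ∷ as) x = trans (+-congˡ (*-congˡ (evalP-scale (c * q) q as x)))
    (solve 5 (λ c a x q e → c :* a :+ x :* (c :* q :* e) := c :* (a :+ q :* x :* e)) refl _ _ _ _ _)

  coef-scale : ∀ c q as j → coef (scale c q as) j ≈ c * q ^ j * coef as j
  coef-scale c q []       j       = sym (zeroʳ _)
  coef-scale c q (a ∷ as) zero    = *-congʳ (sym (*-identityʳ c))
  coef-scale c q (a ∷ as) (suc j) = trans (coef-scale (c * q) q as j) (*-congʳ (*-assoc _ _ _))

  evalP-drop : ∀ as x → evalP as x ≈ coef as 0 + x * evalP (drop 1 as) x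
  evalP-drop []       x = sym (trans (+-identityˡ _) (zeroʳ x))
  evalP-drop (a ∷ as) x = refl

  coef-drop : ∀ k as j → coef (drop k as) j ≡ coef as (k ℕ.+ j)
  coef-drop zero    as       j = ≡.refl
  coef-drop (suc k) []       j = ≡.refl
  coef-drop (suc k) (a ∷ as) j = coef-drop k as j

  -- For i ≥ 1 this is the derivative of x^i b(x) divided by x^(i-1), that is i b(x) + x b'(x).
  derivFrom : ℕ → List Carrier → List Carrier
  derivFrom i []       = []
  derivFrom i (b ∷ bs) = nat i * b ∷ derivFrom (suc i) bs

  derivP : List Carrier → List Carrier
  derivP as = derivFrom 1 (drop 1 as)

  derivNP : ℕ → List Carrier → List Carrier
  derivNP zero    as = as
  derivNP (suc j) as = derivP (derivNP j as)

  module _ (r : Carrier) where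

    -- c + (r + X) t(X), as a polynomial in X.
    horner : Carrier → List Carrier → List Carrier
    horner c []       = c ∷ []
    horner c (t ∷ ts) = c + r * t ∷ horner t ts

    -- Repeated Horner steps yield the coefficients f^(j)(r) / j! without any division by j!.
    taylor : List Carrier → List Carrier
    taylor []       = []
    taylor (a ∷ as) = horner a (taylor as)

    coef-horner-zero : ∀ c ts → coef (horner c ts) 0 ≈ c + r * coef ts 0
    coef-horner-zero c []       = sym (trans (+-congˡ (zeroʳ r)) (+-identityʳ c))
    coef-horner-zero c (t ∷ ts) = refl

    coef-horner-suc : ∀ c ts j → coef (horner c ts) (suc j) ≈ coef ts j + r * coef ts (suc j)
    coef-horner-suc c []       j       = sym (trans (+-congˡ (zeroʳ r)) (+-identityʳ 0#))
    coef-horner-suc c (t ∷ ts) zero    = coef-horner-zero t ts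
    coef-horner-suc c (t ∷ ts) (suc j) = coef-horner-suc t ts j

    evalP-horner : ∀ c ts x → evalP (horner c ts) x ≈ c + (r + x) * evalP ts x
    evalP-horner c []       x = +-congˡ (trans (zeroʳ _) (sym (zeroʳ _)))
    evalP-horner c (t ∷ ts) x = trans (+-congˡ (*-congˡ (evalP-horner t ts x)))
      (solve 5 (λ c r t x e → c :+ r :* t :+ x :* (t :+ (r :+ x) :* e) := c :+ (r :+ x) :* (t :+ x :* e))
        refl _ _ _ _ _)

    evalP-taylor : ∀ as x → evalP (taylor as) x ≈ evalP as (r + x)
    evalP-taylor []       x = refl
    evalP-taylor (a ∷ as) x = trans (evalP-horner a (taylor as) x) (+-congˡ (*-congˡ (evalP-taylor as x)))

    taylor-0 : ∀ as → coef (taylor as) 0 ≈ evalP as r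
    taylor-0 []       = refl
    taylor-0 (a ∷ as) = trans (coef-horner-zero a (taylor as)) (+-congˡ (*-congˡ (taylor-0 as)))

    -- This is i b + x b' at x = r + X: the summand X b' gives j times coefficient j, and the
    -- summand r b' gives r (j+1) times coefficient j + 1.
    taylor-derivFrom : ∀ i bs j → coef (taylor (derivFrom i bs)) j ≈
      nat i * coef (taylor bs) j + (nat j * coef (taylor bs) j + r * (nat (suc j) * coef (taylor bs) (suc j)))
    taylor-derivFrom i []       j = solve 4 (λ i j s r → con′ 0 := i :* con′ 0 :+ (j :* con′ 0 :+ r :* (s :* con′ 0)))
      refl (nat i) (nat j) (nat (suc j)) r
    taylor-derivFrom i (b ∷ bs) zero = begin
      coef (horner (nat i * b) (taylor (derivFrom (suc i) bs))) 0
        ≈⟨ coef-horner-zero _ (taylor (derivFrom (suc i) bs)) ⟩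
      nat i * b + r * coef (taylor (derivFrom (suc i) bs)) 0
        ≈⟨ +-congˡ (*-congˡ (taylor-derivFrom (suc i) bs 0)) ⟩
      nat i * b + r * (nat (suc i) * T 0 + (nat 0 * T 0 + r * (nat 1 * T 1)))
        ≈⟨ solve 5 (λ i b r t u → i :* b :+ r :* ((con′ 1 :+ i) :* t :+ (con′ 0 :* t :+ r :* ((con′ 1 :+ con′ 0) :* u)))
             := i :* (b :+ r :* t) :+ (con′ 0 :* (b :+ r :* t) :+ r :* ((con′ 1 :+ con′ 0) :* (t :+ r :* u))))
             refl (nat i) b r (T 0) (T 1) ⟩
      nat i * (b + r * T 0) + (nat 0 * (b + r * T 0) + r * (nat 1 * (T 0 + r * T 1)))
        ≈⟨ +-cong (*-congˡ (coef-horner-zero b (taylor bs)))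
             (+-cong (*-congˡ (coef-horner-zero b (taylor bs)))
                     (*-congˡ (*-congˡ (coef-horner-suc b (taylor bs) 0)))) ⟨
      nat i * T′ 0 + (nat 0 * T′ 0 + r * (nat 1 * T′ 1)) ∎
      where
      T = coef (taylor bs)
      T′ = coef (taylor (b ∷ bs))
    taylor-derivFrom i (b ∷ bs) (suc j) = begin
      coef (horner (nat i * b) (taylor (derivFrom (suc i) bs))) (suc j)
        ≈⟨ coef-horner-suc _ (taylor (derivFrom (suc i) bs)) j ⟩
      coef (taylor (derivFrom (suc i) bs)) j + r * coef (taylor (derivFrom (suc i) bs)) (suc j)
        ≈⟨ +-cong (taylor-derivFrom (suc i) bs j) (*-congˡ (taylor-derivFrom (suc i) bs (suc j))) ⟩
      nat (suc i) * T j + (nat j * T j + r * (nat (suc j) * T (suc j)))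
        + r * (nat (suc i) * T (suc j) + (nat (suc j) * T (suc j) + r * (nat (2 ℕ.+ j) * T (2 ℕ.+ j))))
        ≈⟨ solve 6 (λ i j r t u v →
             (con′ 1 :+ i) :* t :+ (j :* t :+ r :* ((con′ 1 :+ j) :* u))
               :+ r :* ((con′ 1 :+ i) :* u :+ ((con′ 1 :+ j) :* u :+ r :* ((con′ 1 :+ (con′ 1 :+ j)) :* v)))
             := i :* (t :+ r :* u) :+ ((con′ 1 :+ j) :* (t :+ r :* u)
                  :+ r :* ((con′ 1 :+ (con′ 1 :+ j)) :* (u :+ r :* v))))
             refl (nat i) (nat j) r (T j) (T (suc j)) (T (2 ℕ.+ j)) ⟩
      nat i * (T j + r * T (suc j)) + (nat (suc j) * (T j + r * T (suc j))
        + r * (nat (2 ℕ.+ j) * (T (suc j) + r * T (2 ℕ.+ j))))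
        ≈⟨ +-cong (*-congˡ (coef-horner-suc b (taylor bs) j))
             (+-cong (*-congˡ (coef-horner-suc b (taylor bs) j))
                     (*-congˡ (*-congˡ (coef-horner-suc b (taylor bs) (suc j))))) ⟨
      nat i * T′ (suc j) + (nat (suc j) * T′ (suc j) + r * (nat (2 ℕ.+ j) * T′ (2 ℕ.+ j))) ∎
      where
      T = coef (taylor bs)
      T′ = coef (taylor (b ∷ bs))

    taylor-derivP : ∀ as j → coef (taylor (derivP as)) j ≈ nat (suc j) * coef (taylor as) (suc j)
    taylor-derivP []       j = sym (zeroʳ _)
    taylor-derivP (a ∷ as) j = begin
      coef (taylor (derivFrom 1 as)) j
        ≈⟨ taylor-derivFrom 1 as j ⟩
      nat 1 * T j + (nat j * T j + r * (nat (suc j) * T (suc j)))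
        ≈⟨ solve 4 (λ j r t u → (con′ 1 :+ con′ 0) :* t :+ (j :* t :+ r :* ((con′ 1 :+ j) :* u))
             := (con′ 1 :+ j) :* (t :+ r :* u)) refl (nat j) r (T j) (T (suc j)) ⟩
      nat (suc j) * (T j + r * T (suc j))
        ≈⟨ *-congˡ (coef-horner-suc a (taylor as) j) ⟨
      nat (suc j) * coef (taylor (a ∷ as)) (suc j) ∎
      where T = coef (taylor as)

    -- The index i is kept general because each derivative moves it up by one; only i = 0 is wanted
    -- in the end.
    taylor-derivNP : ∀ j as i →
      nat (i !) * coef (taylor (derivNP j as)) i ≈ nat ((i ℕ.+ j) !) * coef (taylor as) (i ℕ.+ j)
    taylor-derivNP zero    as i = reflexive (≡.cong (λ m → nat (m !) * coef (taylor as) m) (≡.sym (ℕₚ.+-identityʳ i)))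
    taylor-derivNP (suc j) as i = begin
      nat (i !) * coef (taylor (derivP (derivNP j as))) i
        ≈⟨ *-congˡ (taylor-derivP (derivNP j as) i) ⟩
      nat (i !) * (nat (suc i) * coef (taylor (derivNP j as)) (suc i))
        ≈⟨ solve 3 (λ x y z → x :* (y :* z) := y :* x :* z) refl _ _ _ ⟩
      nat (suc i) * nat (i !) * coef (taylor (derivNP j as)) (suc i)
        ≈⟨ *-congʳ (nat-* (suc i) (i !)) ⟨
      nat (suc i !) * coef (taylor (derivNP j as)) (suc i)
        ≈⟨ taylor-derivNP j as (suc i) ⟩
      nat ((suc i ℕ.+ j) !) * coef (taylor as) (suc i ℕ.+ j)
        ≡⟨ ≡.cong (λ m → nat (m !) * coef (taylor as) m) (≡.sym (ℕₚ.+-suc i j)) ⟩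
      nat ((i ℕ.+ suc j) !) * coef (taylor as) (i ℕ.+ suc j) ∎

    evalP-derivNP : ∀ j as → evalP (derivNP j as) r ≈ nat (j !) * coef (taylor as) j
    evalP-derivNP j as = begin
      evalP (derivNP j as) r                    ≈⟨ taylor-0 (derivNP j as) ⟨
      coef (taylor (derivNP j as)) 0            ≈⟨ trans (*-congʳ (+-identityʳ 1#)) (*-identityˡ _) ⟨
      nat 1 * coef (taylor (derivNP j as)) 0    ≈⟨ taylor-derivNP j as 0 ⟩
      nat (j !) * coef (taylor as) j            ∎

-- The inverse series evaluated at a point.

module InverseSeries {c ℓ} (R : CommutativeRing c ℓ) where
  open CommutativeRing R hiding (zero)
  open PowerSeries commutativeSemiring
  open LagrangeInversion R
  open Sums commutativeSemiring
  open Evaluation commutativeSemiring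
  open import Algebra.Properties.Semiring.Exp semiring using (_^_; ^-homo-*; ^-congˡ)
  open import Algebra.Properties.CommutativeSemiring.Exp commutativeSemiring using (^-distrib-*)
  open import Algebra.Properties.Ring ring using (-1*x≈-x; -‿involutive)
  open import Algebra.Solver.Ring.NaturalCoefficients.Default commutativeSemiring
    using (solve; _:+_; _:*_; _:=_)
  open import Relation.Binary.Reasoning.Setoid setoid

  1^ : ∀ n → 1# ^ n ≈ 1#
  1^ zero    = refl
  1^ (suc n) = trans (*-identityˡ _) (1^ n)

  ε^-involutive : ∀ k → ε ^ k * ε ^ k ≈ 1#
  ε^-involutive k = begin
    ε ^ k * ε ^ k  ≈⟨ ^-distrib-* ε ε k ⟨
    (ε * ε) ^ k    ≈⟨ ^-congˡ k (trans (-1*x≈-x ε) (-‿involutive 1#)) ⟩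
    1# ^ k         ≈⟨ 1^ k ⟩
    1#             ∎

  ε^-∸ : ∀ n k → k ℕ.≤ n → ε ^ k * ε ^ suc n ≈ ε ^ (n ℕ.∸ k ℕ.+ 1)
  ε^-∸ n k k≤n = begin
    ε ^ k * ε ^ suc n
      ≡⟨ ≡.cong (λ m → ε ^ k * ε ^ suc m) (≡.sym (ℕₚ.m∸n+n≡m k≤n)) ⟩
    ε ^ k * (ε * ε ^ (n ℕ.∸ k ℕ.+ k))
      ≈⟨ *-congˡ (*-congˡ (^-homo-* ε (n ℕ.∸ k) k)) ⟩
    ε ^ k * (ε * (ε ^ (n ℕ.∸ k) * ε ^ k))
      ≈⟨ solve 3 (λ e x y → x :* (e :* (y :* x)) := e :* y :* (x :* x)) refl ε (ε ^ k) (ε ^ (n ℕ.∸ k)) ⟩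
    ε * ε ^ (n ℕ.∸ k) * (ε ^ k * ε ^ k)
      ≈⟨ trans (*-congˡ (ε^-involutive k)) (*-identityʳ _) ⟩
    ε ^ suc (n ℕ.∸ k)
      ≡⟨ ≡.cong (ε ^_) (ℕₚ.+-comm 1 (n ℕ.∸ k)) ⟩
    ε ^ (n ℕ.∸ k ℕ.+ 1) ∎

  module _ (torsionFree : TorsionFree) (a : Series) (u : Carrier) (ua₀≈1 : u * a 0 ≈ 1#) where
    open Inverse torsionFree (u ∙ a) ua₀≈1

    -- `inverse-formula` for h = u a, in the shape of the term of the theorem. The factor u^k of h^k
    -- plays the role of 1 / c₁^k, and the sign ε^k of the weight joins ε^(n+1) from the power of -
    -- y to give the exponent n - k + 1.
    inverse-term : ∀ n y →
      ∑ (suc n) (λ k → ε ^ (n ℕ.∸ k ℕ.+ 1) * nat ((2 ℕ.* n ℕ.+ 1) C (n ℕ.∸ k))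
                         * (nat (((n ℕ.+ k) C k) ℕ.* n !) * (a ^^ k) n) * u ^ k) * y ^ suc n
        ≈ nat (suc n !) * (inverse (suc n) * (ε * y) ^ suc n)
    inverse-term n y = sym (begin
      nat (suc n !) * (inverse (suc n) * (ε * y) ^ suc n)
        ≈⟨ *-assoc _ _ _ ⟨
      nat (suc n !) * inverse (suc n) * (ε * y) ^ suc n
        ≈⟨ *-cong (inverse-formula n) (^-distrib-* ε y (suc n)) ⟩
      P n n * (ε ^ suc n * y ^ suc n)
        ≈⟨ *-assoc _ _ _ ⟨
      P n n * ε ^ suc n * y ^ suc n
        ≈⟨ *-congʳ (∑-* (ε ^ suc n) (suc n) _) ⟩
      ∑ (suc n) (λ k → ε ^ k * nat (lagrangeCoeff n k) * ((u ∙ a) ^^ k) n * ε ^ suc n) * y ^ suc n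
        ≈⟨ *-congʳ (∑-cong (suc n) λ { k (s≤s k≤n) → begin
             ε ^ k * nat (lagrangeCoeff n k) * ((u ∙ a) ^^ k) n * ε ^ suc n
               ≈⟨ *-congʳ (*-cong (*-congˡ (nat-* ((2 ℕ.* n ℕ.+ 1) C (n ℕ.∸ k)) (((n ℕ.+ k) C k) ℕ.* n !))) (∙-^^ u a k n)) ⟩
             ε ^ k * (nat ((2 ℕ.* n ℕ.+ 1) C (n ℕ.∸ k)) * nat (((n ℕ.+ k) C k) ℕ.* n !)) * (u ^ k * (a ^^ k) n) * ε ^ suc n
               ≈⟨ solve 6 (λ e x z w b f → e :* (x :* z) :* (w :* b) :* f := e :* f :* x :* (z :* b) :* w)
                    refl (ε ^ k) _ _ _ _ (ε ^ suc n) ⟩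
             ε ^ k * ε ^ suc n * nat ((2 ℕ.* n ℕ.+ 1) C (n ℕ.∸ k)) * (nat (((n ℕ.+ k) C k) ℕ.* n !) * (a ^^ k) n) * u ^ k
               ≈⟨ *-congʳ (*-congʳ (*-congʳ (ε^-∸ n k k≤n))) ⟩
             ε ^ (n ℕ.∸ k ℕ.+ 1) * nat ((2 ℕ.* n ℕ.+ 1) C (n ℕ.∸ k)) * (nat (((n ℕ.+ k) C k) ℕ.* n !) * (a ^^ k) n) * u ^ k ∎ }) ⟩
      ∑ (suc n) (λ k → ε ^ (n ℕ.∸ k ℕ.+ 1) * nat ((2 ℕ.* n ℕ.+ 1) C (n ℕ.∸ k))
                         * (nat (((n ℕ.+ k) C k) ℕ.* n !) * (a ^^ k) n) * u ^ k) * y ^ suc n ∎)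

    -- `partial (2 + k)` is evaluated at s in two ways: termwise, where `F m` has the value s^m v^m,
    -- and as a series that agrees with w below the index 2 + k.
    inverse-sum : ∀ {s v} → (∀ M → EvalsTo s M (u ∙ a) v) →
      ∀ k → ∃ λ q → ∑ (suc k) (λ n → inverse (suc n) * (s * v) ^ suc n) ≈ s + s ^ (2 ℕ.+ k) * q
    inverse-sum {s} {v} h⇓v k =
      let q , e = evals-w⇒ k (evals-resp-< (2 ℕ.+ k) (partial-≈ (2 ℕ.+ k)) (evals-partial (2 ℕ.+ k) (2 ℕ.+ k)))
      in q , (begin
        ∑ (suc k) (λ n → inverse (suc n) * (s * v) ^ suc n)
          ≈⟨ +-identityˡ _ ⟨
        0# + ∑ (suc k) (λ n → inverse (suc n) * (s * v) ^ suc n)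
          -- `inverse 0` unfolds to `0# + - 0#`, so the sum may start at index 0.
          ≈⟨ +-congʳ (trans (*-congʳ (-‿inverseʳ 0#)) (zeroˡ _)) ⟨
        inverse 0 * (s * v) ^ 0 + ∑ (suc k) (λ n → inverse (suc n) * (s * v) ^ suc n)
          ≈⟨ ∑-head (suc k) (λ m → inverse m * (s * v) ^ m) ⟨
        ∑ (2 ℕ.+ k) (λ m → inverse m * (s * v) ^ m)
          ≈⟨ ∑-cong (2 ℕ.+ k) (λ m _ → *-congˡ (^-distrib-* s v m)) ⟩
        ∑ (2 ℕ.+ k) (λ m → inverse m * (s ^ m * v ^ m))
          ≈⟨ e ⟩
        s + s ^ (2 ℕ.+ k) * q ∎)
      where
      evals-partial : ∀ M N → EvalsTo s M (partial N) (∑ N (λ m → inverse m * (s ^ m * v ^ m)))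
      evals-partial M zero    = evals-𝟘 M
      evals-partial M (suc N) = evals-⊞ M (evals-partial M N)
        (evals-∙ M (inverse N) (evals-shift N M (evals-^^ M (h⇓v M) N)))

-- The ring of p-adic integers

abstract
  -- Together with its converse this turns congruences into equations with an explicit quotient,
  -- which the ring solver can handle.
  ∣-⇒≡ : ∀ m x y → + m ∣ (x ℤ.- y) → ∃ λ q → x ≡ y ℤ.+ + m ℤ.* q
  ∣-⇒≡ m x y m∣ with Signed.∣ᵤ⇒∣ m∣
  ... | Signed.divides q e = q , ≡.trans (lemma x y) (≡.cong (λ z → y ℤ.+ z) (≡.trans e (ℤₚ.*-comm q (+ m))))
    where
    lemma : ∀ x y → x ≡ y ℤ.+ (x ℤ.- y)
    lemma = solve-ℤ

  ≡⇒∣- : ∀ m x y q → x ≡ y ℤ.+ + m ℤ.* q → + m ∣ (x ℤ.- y)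
  ≡⇒∣- m x y q e = Signed.∣⇒∣ᵤ (Signed.divides q (≡.trans (≡.cong (ℤ._- y) e) (lemma y (+ m) q)))
    where
    lemma : ∀ y m q → y ℤ.+ m ℤ.* q ℤ.- y ≡ q ℤ.* m
    lemma = solve-ℤ

  ∣-sym : ∀ m x y → + m ∣ (x ℤ.- y) → + m ∣ (y ℤ.- x)
  ∣-sym m x y d =
    let q , e = ∣-⇒≡ m x y d
    in ≡⇒∣- m y x (ℤ.- q) (≡.trans (lemma y (+ m) q) (≡.cong (ℤ._+ + m ℤ.* ℤ.- q) (≡.sym e)))
    where
    lemma : ∀ y m q → y ≡ y ℤ.+ m ℤ.* q ℤ.+ m ℤ.* ℤ.- q
    lemma = solve-ℤ

  ∣-trans : ∀ m x y z → + m ∣ (x ℤ.- y) → + m ∣ (y ℤ.- z) → + m ∣ (x ℤ.- z)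
  ∣-trans m x y z d d′ =
    let q , e = ∣-⇒≡ m x y d
        r , f = ∣-⇒≡ m y z d′
    in ≡⇒∣- m x z (r ℤ.+ q)
      (≡.trans e (≡.trans (≡.cong (ℤ._+ + m ℤ.* q) f) (lemma z (+ m) r q)))
    where
    lemma : ∀ z m r q → z ℤ.+ m ℤ.* r ℤ.+ m ℤ.* q ≡ z ℤ.+ m ℤ.* (r ℤ.+ q)
    lemma = solve-ℤ

prime-power-∣ : ∀ {p} → Prime p → ∀ N → ¬ (p ℕᵈ.∣ N) → ∀ n y → p ℕ.^ n ℕᵈ.∣ N ℕ.* y → p ℕ.^ n ℕᵈ.∣ y
prime-power-∣ pr N p∤N zero    y _ = ℕᵈ.1∣ y
prime-power-∣ {p} pr N p∤N (suc n) y d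
  with euclidsLemma N y pr (ℕᵈ.∣-trans (ℕᵈ.m∣m*n (p ℕ.^ n)) d)
... | inj₁ p∣N = contradiction p∣N p∤N
... | inj₂ (ℕᵈ.divides q ≡.refl) =
  ≡.subst (p ℕ.^ suc n ℕᵈ.∣_) (ℕₚ.*-comm p q) (ℕᵈ.*-monoʳ-∣ p
    (prime-power-∣ pr N p∤N n q (ℕᵈ.*-cancelˡ-∣ p
      (≡.subst (p ℕ.^ suc n ℕᵈ.∣_) lemma d))))
  where
  instance _ = prime⇒nonZero pr
  lemma : N ℕ.* (q ℕ.* p) ≡ p ℕ.* (N ℕ.* q)
  lemma = ≡.trans (≡.sym (ℕₚ.*-assoc N q p)) (ℕₚ.*-comm (N ℕ.* q) p)

-- The witness is the exponent of p in N, found by dividing out p for as long as possible.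
-- Multiplication by N therefore costs only a bounded number of p-adic digits.
bounded-valuation : ∀ {p} → Prime p → ∀ N → .{{ℕ.NonZero N}} →
  ∃ λ k → ∀ n y → p ℕ.^ (n ℕ.+ k) ℕᵈ.∣ N ℕ.* y → p ℕ.^ n ℕᵈ.∣ y
bounded-valuation {p} pr N = <-rec P step N
  where
  P : ℕ → Set
  P N = .{{ℕ.NonZero N}} → ∃ λ k → ∀ n y → p ℕ.^ (n ℕ.+ k) ℕᵈ.∣ N ℕ.* y → p ℕ.^ n ℕᵈ.∣ y
  instance
    _ = prime⇒nonZero pr
    _ = prime⇒nonTrivial pr
  step : ∀ N → (∀ {M} → M ℕ.< N → P M) → P N
  step N rec with p ℕᵈ.∣? N
  ... | no p∤N = 0 , λ n y d → prime-power-∣ pr N p∤N n y (≡.subst (λ m → p ℕ.^ m ℕᵈ.∣ N ℕ.* y) (ℕₚ.+-identityʳ n) d)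
  ... | yes (ℕᵈ.divides q ≡.refl) = let instance _ = ℕₚ.m*n≢0⇒m≢0 q {p} in
    let k , f = rec (ℕₚ.m<m*n q p (ℕ.nonTrivial⇒n>1 p)) in
    suc k , λ n y d → f n y (ℕᵈ.*-cancelˡ-∣ p
      (≡.subst₂ ℕᵈ._∣_ (≡.cong (p ℕ.^_) (ℕₚ.+-suc n k)) (lemma q y) d))
    where
    lemma : ∀ q y → q ℕ.* p ℕ.* y ≡ p ℕ.* (q ℕ.* y)
    lemma q y = ≡.trans (≡.cong (ℕ._* y) (ℕₚ.*-comm q p)) (ℕₚ.*-assoc p q y)

module PAdic (p : ℕ) where

  infix 4 _≈ₚ_
  _≈ₚ_ : Seq → Seq → Set
  x ≈ₚ y = x ≈[ p ] y

  ≗⇒≈ₚ : ∀ {x y} → (∀ n → x n ≡ y n) → x ≈ₚ y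
  ≗⇒≈ₚ {x} {y} x≗y n = ≡⇒∣- (p ℕ.^ n) (x n) (y n) ℤ.0ℤ (≡.trans (x≗y n) (lemma (y n) (+ (p ℕ.^ n))))
    where
    lemma : ∀ y m → y ≡ y ℤ.+ m ℤ.* ℤ.0ℤ
    lemma = solve-ℤ

  ≈ₚ-sym : ∀ {x y} → x ≈ₚ y → y ≈ₚ x
  ≈ₚ-sym {x} {y} x≈y n = ∣-sym (p ℕ.^ n) (x n) (y n) (x≈y n)

  ≈ₚ-trans : ∀ {x y z} → x ≈ₚ y → y ≈ₚ z → x ≈ₚ z
  ≈ₚ-trans {x} {y} {z} x≈y y≈z n = ∣-trans (p ℕ.^ n) (x n) (y n) (z n) (x≈y n) (y≈z n)

  ⊕-cong : ∀ {x x′ y y′} → x ≈ₚ x′ → y ≈ₚ y′ → (x ⊕ y) ≈ₚ (x′ ⊕ y′)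
  ⊕-cong {x} {x′} {y} {y′} x≈ y≈ n =
    let q , e = ∣-⇒≡ (p ℕ.^ n) (x n) (x′ n) (x≈ n)
        r , f = ∣-⇒≡ (p ℕ.^ n) (y n) (y′ n) (y≈ n)
    in ≡⇒∣- (p ℕ.^ n) _ _ (q ℤ.+ r)
      (≡.trans (≡.cong₂ ℤ._+_ e f) (lemma (x′ n) (y′ n) (+ (p ℕ.^ n)) q r))
    where
    lemma : ∀ x y m q r → x ℤ.+ m ℤ.* q ℤ.+ (y ℤ.+ m ℤ.* r) ≡ x ℤ.+ y ℤ.+ m ℤ.* (q ℤ.+ r)
    lemma = solve-ℤ

  ⊗-cong : ∀ {x x′ y y′} → x ≈ₚ x′ → y ≈ₚ y′ → (x ⊗ y) ≈ₚ (x′ ⊗ y′)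
  ⊗-cong {x} {x′} {y} {y′} x≈ y≈ n =
    let q , e = ∣-⇒≡ (p ℕ.^ n) (x n) (x′ n) (x≈ n)
        r , f = ∣-⇒≡ (p ℕ.^ n) (y n) (y′ n) (y≈ n)
    in ≡⇒∣- (p ℕ.^ n) _ _ (q ℤ.* y′ n ℤ.+ (x′ n ℤ.+ + (p ℕ.^ n) ℤ.* q) ℤ.* r)
      (≡.trans (≡.cong₂ ℤ._*_ e f) (lemma (x′ n) (y′ n) (+ (p ℕ.^ n)) q r))
    where
    lemma : ∀ x y m q r → (x ℤ.+ m ℤ.* q) ℤ.* (y ℤ.+ m ℤ.* r) ≡ x ℤ.* y ℤ.+ m ℤ.* (q ℤ.* y ℤ.+ (x ℤ.+ m ℤ.* q) ℤ.* r)
    lemma = solve-ℤ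

  neg : Seq → Seq
  neg x n = ℤ.- x n

  neg-cong : ∀ {x y} → x ≈ₚ y → neg x ≈ₚ neg y
  neg-cong {x} {y} x≈y n =
    let q , e = ∣-⇒≡ (p ℕ.^ n) (x n) (y n) (x≈y n)
    in ≡⇒∣- (p ℕ.^ n) _ _ (ℤ.- q) (≡.trans (≡.cong ℤ.-_ e) (lemma (y n) (+ (p ℕ.^ n)) q))
    where
    lemma : ∀ y m q → ℤ.- (y ℤ.+ m ℤ.* q) ≡ ℤ.- y ℤ.+ m ℤ.* ℤ.- q
    lemma = solve-ℤ

  abstract
    const-coherent : ∀ a → Coherent p (const a)
    const-coherent a = ≗⇒≈ₚ {const a} {const a} λ _ → ≡.refl

  Zp : Set
  Zp = Σ Seq (Coherent p)

  cst : ℤ → Zp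
  cst a = const a , const-coherent a

  -- A record, so that both sides can be inferred from the type of an equation.
  record _≈ᶻ_ (x y : Zp) : Set where
    constructor wrap
    field unwrap : proj₁ x ≈ₚ proj₁ y
  open _≈ᶻ_ public

  ≗⇒≈ᶻ : ∀ {x y : Zp} → (∀ n → proj₁ x n ≡ proj₁ y n) → x ≈ᶻ y
  ≗⇒≈ᶻ {x} {y} x≗y = wrap (≗⇒≈ₚ {proj₁ x} {proj₁ y} x≗y)

  infixl 6 _+ᶻ_
  infixl 7 _*ᶻ_

  -- Opaque, so that type checking does not unfold and compare the coherence proofs.
  abstract
    _+ᶻ_ _*ᶻ_ : Zp → Zp → Zp
    (x , cx) +ᶻ (y , cy) = x ⊕ y , ⊕-cong {λ n → x (suc n)} {x} {λ n → y (suc n)} {y} cx cy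
    (x , cx) *ᶻ (y , cy) = x ⊗ y , ⊗-cong {λ n → x (suc n)} {x} {λ n → y (suc n)} {y} cx cy

    -ᶻ_ : Zp → Zp
    -ᶻ (x , cx) = neg x , neg-cong {λ n → x (suc n)} {x} cx

    seq-+ : ∀ x y → proj₁ (x +ᶻ y) ≡ proj₁ x ⊕ proj₁ y
    seq-+ x y = ≡.refl

    seq-* : ∀ x y → proj₁ (x *ᶻ y) ≡ proj₁ x ⊗ proj₁ y
    seq-* x y = ≡.refl

    seq-neg : ∀ x → proj₁ (-ᶻ x) ≡ neg (proj₁ x)
    seq-neg x = ≡.refl

    isCommutativeRing : IsCommutativeRing _≈ᶻ_ _+ᶻ_ _*ᶻ_ -ᶻ_ (cst ℤ.0ℤ) (cst ℤ.1ℤ)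
    isCommutativeRing = record
      { isRing = record
        { +-isAbelianGroup = record
          { isGroup = record
            { isMonoid = record
              { isSemigroup = record
                { isMagma = record
                  { isEquivalence = record
                    { refl = λ {x} → wrap (≗⇒≈ₚ {proj₁ x} {proj₁ x} λ _ → ≡.refl)
                    ; sym = λ {x} {y} e → wrap (≈ₚ-sym {proj₁ x} {proj₁ y} (unwrap e))
                    ; trans = λ {x} {y} {z} e f → wrap (≈ₚ-trans {proj₁ x} {proj₁ y} {proj₁ z} (unwrap e) (unwrap f)) }
                  ; ∙-cong = λ {x} {y} {u} {v} e f → wrap (⊕-cong {proj₁ x} {proj₁ y} {proj₁ u} {proj₁ v} (unwrap e) (unwrap f)) }
                ; assoc = λ x y z → ≗⇒≈ᶻ λ n → ℤₚ.+-assoc (proj₁ x n) (proj₁ y n) (proj₁ z n) }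
              ; identity = (λ x → ≗⇒≈ᶻ λ n → ℤₚ.+-identityˡ (proj₁ x n))
                         , (λ x → ≗⇒≈ᶻ λ n → ℤₚ.+-identityʳ (proj₁ x n)) }
            ; inverse = (λ x → ≗⇒≈ᶻ λ n → ℤₚ.+-inverseˡ (proj₁ x n))
                      , (λ x → ≗⇒≈ᶻ λ n → ℤₚ.+-inverseʳ (proj₁ x n))
            ; ⁻¹-cong = λ {x} {y} e → wrap (neg-cong {proj₁ x} {proj₁ y} (unwrap e)) }
          ; comm = λ x y → ≗⇒≈ᶻ λ n → ℤₚ.+-comm (proj₁ x n) (proj₁ y n) }
        ; *-cong = λ {x} {y} {u} {v} e f → wrap (⊗-cong {proj₁ x} {proj₁ y} {proj₁ u} {proj₁ v} (unwrap e) (unwrap f))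
        ; *-assoc = λ x y z → ≗⇒≈ᶻ λ n → ℤₚ.*-assoc (proj₁ x n) (proj₁ y n) (proj₁ z n)
        ; *-identity = (λ x → ≗⇒≈ᶻ λ n → ℤₚ.*-identityˡ (proj₁ x n))
                     , (λ x → ≗⇒≈ᶻ λ n → ℤₚ.*-identityʳ (proj₁ x n))
        ; distrib = (λ x y z → ≗⇒≈ᶻ λ n → ℤₚ.*-distribˡ-+ (proj₁ x n) (proj₁ y n) (proj₁ z n))
                  , (λ x y z → ≗⇒≈ᶻ λ n → ℤₚ.*-distribʳ-+ (proj₁ x n) (proj₁ y n) (proj₁ z n)) }
      ; *-comm = λ x y → ≗⇒≈ᶻ λ n → ℤₚ.*-comm (proj₁ x n) (proj₁ y n) }

  Zp-commutativeRing : CommutativeRing 0ℓ 0ℓ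
  Zp-commutativeRing = record { isCommutativeRing = isCommutativeRing }

abstract
  inverse-mod-prime : ∀ {p} → Prime p → ∀ z → ¬ (+ p ∣ z) → ∃ λ a → ∃ λ q → z ℤ.* a ≡ ℤ.1ℤ ℤ.+ + p ℤ.* q
  inverse-mod-prime {p} pr z p∤z = signed (natural (coprime-Bézout coprime))
    where
    coprime : Coprime p ℤ.∣ z ∣
    coprime (d∣p , d∣z) with prime⇒irreducible pr d∣p
    ... | inj₁ d≡1    = d≡1
    ... | inj₂ ≡.refl = contradiction d∣z p∤z
    natural : ∀ {n} → Bézout.Identity 1 p n → ∃ λ a → ∃ λ q → + n ℤ.* a ≡ ℤ.1ℤ ℤ.+ + p ℤ.* q
    natural {n} (Bézout.+- x y eq) = ℤ.- + y , ℤ.- + x ,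
      ≡.trans (lemma₁ (+ n) (+ y)) (≡.trans
        (≡.cong (λ w → ℤ.1ℤ ℤ.+ ℤ.- w) (≡.trans (≡.cong (λ w → ℤ.1ℤ ℤ.+ w) (≡.sym (ℤₚ.pos-* y n)))
          (≡.trans (≡.cong +_ eq) (ℤₚ.pos-* x p))))
        (lemma₂ (+ x) (+ p)))
      where
      lemma₁ : ∀ n y → n ℤ.* ℤ.- y ≡ ℤ.1ℤ ℤ.+ ℤ.- (ℤ.1ℤ ℤ.+ y ℤ.* n)
      lemma₁ = solve-ℤ
      lemma₂ : ∀ x p → ℤ.1ℤ ℤ.+ ℤ.- (x ℤ.* p) ≡ ℤ.1ℤ ℤ.+ p ℤ.* ℤ.- x
      lemma₂ = solve-ℤ
    natural {n} (Bézout.-+ x y eq) = + y , + x ,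
      ≡.trans (≡.trans (ℤₚ.*-comm (+ n) (+ y)) (≡.sym (ℤₚ.pos-* y n))) (≡.trans (≡.cong +_ (≡.sym eq))
        (≡.cong (λ w → ℤ.1ℤ ℤ.+ w) (≡.trans (ℤₚ.pos-* x p) (ℤₚ.*-comm (+ x) (+ p)))))
    signed : (∃ λ a → ∃ λ q → + ℤ.∣ z ∣ ℤ.* a ≡ ℤ.1ℤ ℤ.+ + p ℤ.* q) →
             ∃ λ a → ∃ λ q → z ℤ.* a ≡ ℤ.1ℤ ℤ.+ + p ℤ.* q
    signed (a , q , e) with ℤₚ.+∣i∣≡i⊎+∣i∣≡-i z
    ... | inj₁ f = a , q , ≡.trans (≡.cong (ℤ._* a) (≡.sym f)) e
    ... | inj₂ f = ℤ.- a , q , ≡.trans (lemma z a) (≡.trans (≡.cong (ℤ._* a) (≡.sym f)) e)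
      where
      lemma : ∀ z a → z ℤ.* ℤ.- a ≡ ℤ.- z ℤ.* a
      lemma = solve-ℤ

module PAdicPrime {p : ℕ} (pr : Prime p) where
  open PAdic p public
  open CommutativeRing Zp-commutativeRing hiding (zero; _-_)
  open PowerSeries commutativeSemiring using (nat)
  private instance
    _ = prime⇒nonZero pr

  p^ : ℕ → Zp
  p^ n = cst (+ (p ℕ.^ n))

  cst-* : ∀ a b → cst (a ℤ.* b) ≈ cst a * cst b
  cst-* a b = ≗⇒≈ᶻ λ n → ≡.sym (≡.cong-app (seq-* (cst a) (cst b)) n)

  p^-+ : ∀ m n → p^ (m ℕ.+ n) ≈ p^ m * p^ n
  p^-+ m n = trans
    (≗⇒≈ᶻ λ _ → ≡.trans (≡.cong +_ (ℕₚ.^-distribˡ-+-* p m n)) (ℤₚ.pos-* (p ℕ.^ m) (p ℕ.^ n)))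
    (cst-* (+ (p ℕ.^ m)) (+ (p ℕ.^ n)))

  abstract
    nat≡ : ∀ n k → proj₁ (nat n) k ≡ + n
    nat≡ zero    k = ≡.refl
    nat≡ (suc n) k = ≡.trans (≡.cong-app (seq-+ 1# (nat n)) k) (≡.cong (λ w → ℤ.1ℤ ℤ.+ w) (nat≡ n k))

    cst-nat : ∀ n → cst (+ n) ≈ nat n
    cst-nat n = ≗⇒≈ᶻ λ k → ≡.sym (nat≡ n k)

    coherent-+ : ∀ (x : Zp) n k → + (p ℕ.^ n) ∣ (proj₁ x (n ℕ.+ k) ℤ.- proj₁ x n)
    coherent-+ (x , cx) n zero = ≡⇒∣- (p ℕ.^ n) _ _ ℤ.0ℤ
      (≡.trans (≡.cong x (ℕₚ.+-identityʳ n))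
        (≡.sym (≡.trans (≡.cong (λ w → x n ℤ.+ w) (ℤₚ.*-zeroʳ (+ (p ℕ.^ n)))) (ℤₚ.+-identityʳ (x n)))))
    coherent-+ (x , cx) n (suc k) =
      let q , e = ∣-⇒≡ (p ℕ.^ (n ℕ.+ k)) (x (suc (n ℕ.+ k))) (x (n ℕ.+ k)) (cx (n ℕ.+ k))
          r , f = ∣-⇒≡ (p ℕ.^ n) (x (n ℕ.+ k)) (x n) (coherent-+ (x , cx) n k)
      in ≡⇒∣- (p ℕ.^ n) _ _ (r ℤ.+ + (p ℕ.^ k) ℤ.* q)
        (≡.trans (≡.cong x (ℕₚ.+-suc n k)) (≡.trans e (≡.trans
          (≡.cong₂ (λ a b → a ℤ.+ b ℤ.* q) f (≡.trans (≡.cong +_ (ℕₚ.^-distribˡ-+-* p n k)) (ℤₚ.pos-* (p ℕ.^ n) (p ℕ.^ k))))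
          (lemma (x n) (+ (p ℕ.^ n)) r (+ (p ℕ.^ k)) q))))
      where
      lemma : ∀ x m r l q → x ℤ.+ m ℤ.* r ℤ.+ m ℤ.* l ℤ.* q ≡ x ℤ.+ m ℤ.* (r ℤ.+ l ℤ.* q)
      lemma = solve-ℤ

    -- With v the exponent of p in N, the hypothesis at index n + v makes the approximation there
    -- divisible by p^n, and coherence carries this back to index n.
    cst-torsionFree : ∀ N → .{{ℕ.NonZero N}} → ∀ x → cst (+ N) * x ≈ 0# → x ≈ 0#
    cst-torsionFree N x@(xs , _) Nx≈0 = conclude (bounded-valuation pr N)
      where
      ∣Nx : ∀ n → p ℕ.^ n ℕᵈ.∣ N ℕ.* ℤ.∣ xs n ∣
      ∣Nx n = ≡.subst (p ℕ.^ n ℕᵈ.∣_)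
        (≡.trans (≡.cong ℤ.∣_∣ (ℤₚ.+-identityʳ (+ N ℤ.* xs n))) (ℤₚ.abs-* (+ N) (xs n)))
        (≡.subst (λ w → + (p ℕ.^ n) ∣ (w ℤ.- ℤ.0ℤ)) (≡.cong-app (seq-* (cst (+ N)) x) n) (unwrap Nx≈0 n))
      ∣x⇒ : ∀ v n → p ℕ.^ n ℕᵈ.∣ ℤ.∣ xs (n ℕ.+ v) ∣ → + (p ℕ.^ n) ∣ (xs n ℤ.- ℤ.0ℤ)
      ∣x⇒ v n d =
        let q , e = ∣-⇒≡ (p ℕ.^ n) (xs (n ℕ.+ v)) (xs n) (coherent-+ x n v)
            r , f = ∣-⇒≡ (p ℕ.^ n) (xs (n ℕ.+ v)) ℤ.0ℤ (≡.subst (λ w → p ℕ.^ n ℕᵈ.∣ ℤ.∣ w ∣) (≡.sym (ℤₚ.+-identityʳ (xs (n ℕ.+ v)))) d)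
        in ≡⇒∣- (p ℕ.^ n) (xs n) ℤ.0ℤ (r ℤ.- q)
          (≡.trans (lemma₁ (xs n) (+ (p ℕ.^ n)) q) (≡.trans (≡.cong (ℤ._- (+ (p ℕ.^ n) ℤ.* q)) (≡.trans (≡.sym e) f))
            (lemma₂ (+ (p ℕ.^ n)) q r)))
        where
        lemma₁ : ∀ x m q → x ≡ x ℤ.+ m ℤ.* q ℤ.- m ℤ.* q
        lemma₁ = solve-ℤ
        lemma₂ : ∀ m q r → ℤ.0ℤ ℤ.+ m ℤ.* r ℤ.- m ℤ.* q ≡ ℤ.0ℤ ℤ.+ m ℤ.* (r ℤ.- q)
        lemma₂ = solve-ℤ
      conclude : (∃ λ k → ∀ n y → p ℕ.^ (n ℕ.+ k) ℕᵈ.∣ N ℕ.* y → p ℕ.^ n ℕᵈ.∣ y) → x ≈ 0#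
      conclude (v , v-spec) = wrap λ n → ∣x⇒ v n (v-spec n ℤ.∣ xs (n ℕ.+ v) ∣ (∣Nx (n ℕ.+ v)))

    torsionFree : ∀ N → .{{ℕ.NonZero N}} → ∀ x → nat N * x ≈ 0# → x ≈ 0#
    torsionFree N x Nx≈0 = cst-torsionFree N x (trans (*-congʳ (cst-nat N)) Nx≈0)

    -- Approximation n alone decides divisibility by p^n. The quotient at index k is read from x at
    -- index n + k, since dividing by p^n loses n digits of precision.
    p^-divides : ∀ n (x : Zp) → + (p ℕ.^ n) ∣ proj₁ x n → ∃ λ z → x ≈ p^ n * z
    p^-divides n x@(xs , cx) p^n∣xₙ = (z , z-coherent) , wrap (≡.subst (xs ≈ₚ_) (≡.sym (seq-* (p^ n) (z , z-coherent))) x≈)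
      where
      quotient : ∀ k → ∃ λ q → xs (n ℕ.+ k) ≡ + (p ℕ.^ n) ℤ.* q
      quotient k =
        let q , e = ∣-⇒≡ (p ℕ.^ n) (xs (n ℕ.+ k)) (xs n) (coherent-+ x n k)
            r , f = ∣-⇒≡ (p ℕ.^ n) (xs n) ℤ.0ℤ (≡.subst (+ (p ℕ.^ n) ∣_) (≡.sym (ℤₚ.+-identityʳ (xs n))) p^n∣xₙ)
        in r ℤ.+ q , ≡.trans e (≡.trans (≡.cong (ℤ._+ + (p ℕ.^ n) ℤ.* q) f) (lemma (+ (p ℕ.^ n)) r q))
        where
        lemma : ∀ m r q → ℤ.0ℤ ℤ.+ m ℤ.* r ℤ.+ m ℤ.* q ≡ m ℤ.* (r ℤ.+ q)
        lemma = solve-ℤ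
      z : Seq
      z k = proj₁ (quotient k)
      z-spec : ∀ k → xs (n ℕ.+ k) ≡ + (p ℕ.^ n) ℤ.* z k
      z-spec k = proj₂ (quotient k)
      z-coherent : Coherent p z
      z-coherent k =
        let q , e = ∣-⇒≡ (p ℕ.^ (n ℕ.+ k)) (xs (suc (n ℕ.+ k))) (xs (n ℕ.+ k)) (cx (n ℕ.+ k))
        in ≡⇒∣- (p ℕ.^ k) (z (suc k)) (z k) q (ℤₚ.*-cancelˡ-≡ (+ (p ℕ.^ n)) (z (suc k)) (z k ℤ.+ + (p ℕ.^ k) ℤ.* q) {{ℕₚ.m^n≢0 p n}}
          (≡.trans (≡.sym (z-spec (suc k))) (≡.trans (≡.cong xs (ℕₚ.+-suc n k)) (≡.trans e (≡.trans
            (≡.cong₂ (λ a b → a ℤ.+ b ℤ.* q) (z-spec k)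
              (≡.trans (≡.cong +_ (ℕₚ.^-distribˡ-+-* p n k)) (ℤₚ.pos-* (p ℕ.^ n) (p ℕ.^ k))))
            (lemma (+ (p ℕ.^ n)) (z k) (+ (p ℕ.^ k)) q))))))
        where
        lemma : ∀ m z l q → m ℤ.* z ℤ.+ m ℤ.* l ℤ.* q ≡ m ℤ.* (z ℤ.+ l ℤ.* q)
        lemma = solve-ℤ
      x≈ : xs ≈ₚ (const (+ (p ℕ.^ n)) ⊗ z)
      x≈ k = ≡.subst (λ w → + (p ℕ.^ k) ∣ (xs k ℤ.- w))
        (≡.trans (≡.cong xs (ℕₚ.+-comm k n)) (z-spec k))
        (≈ₚ-sym {λ k → xs (k ℕ.+ n)} {xs} (λ k → coherent-+ x k n) k)

-- Contractions and units in the p-adic integers.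

module Hensel {p : ℕ} (pr : Prime p) where
  open PAdicPrime pr
  open CommutativeRing Zp-commutativeRing hiding (zero)
  open import Algebra.Properties.AbelianGroup +-abelianGroup using (xyx⁻¹≈y)
  open import Algebra.Solver.Ring.NaturalCoefficients.Default commutativeSemiring
    using (solve; _:+_; _:*_; _:=_)
  open import Relation.Binary.Reasoning.Setoid setoid

  abstract
    mod-at : ∀ n {x y : Zp} z → x ≈ y + p^ n * z → + (p ℕ.^ n) ∣ (proj₁ x n ℤ.- proj₁ y n)
    mod-at n {x} {y} z e = ∣-trans (p ℕ.^ n) (proj₁ x n) (proj₁ (y + p^ n * z) n) (proj₁ y n) (unwrap e n)
      (≡⇒∣- (p ℕ.^ n) (proj₁ (y + p^ n * z) n) (proj₁ y n) (proj₁ z n)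
        (≡.trans (≡.cong-app (seq-+ y (p^ n * z)) n)
                 (≡.cong (λ w → proj₁ y n ℤ.+ w) (≡.cong-app (seq-* (p^ n) z) n))))

    -- Together with `mod-at`: congruence modulo p^n in the ring is the same as congruence of the
    -- n-th approximations.
    at-mod : ∀ n (x y : Zp) → + (p ℕ.^ n) ∣ (proj₁ x n ℤ.- proj₁ y n) → ∃ λ z → x ≈ y + p^ n * z
    at-mod n x y d =
      let z , e = p^-divides n (x - y) (≡.subst (+ (p ℕ.^ n) ∣_) (≡.sym seq-diff) d)
      in z , trans (sym (xyx⁻¹≈y y x)) (trans (+-assoc y x (- y)) (+-congˡ e))
      where
      seq-diff : proj₁ (x - y) n ≡ proj₁ x n ℤ.- proj₁ y n
      seq-diff = ≡.trans (≡.cong-app (seq-+ x (- y)) n)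
        (≡.cong (λ w → proj₁ x n ℤ.+ w) (≡.cong-app (seq-neg y) n))

  -- The Lipschitz condition, expressed by congruences instead of a metric; the extra factor p in
  -- `step` then makes a contraction of it.
  Nonexpansive : (Zp → Zp) → Set
  Nonexpansive ψ = ∀ x y d z → x ≈ y + d * z → ∃ λ z′ → ψ x ≈ ψ y + d * z′

  module _ (ψ : Zp → Zp) (ψ-mod : Nonexpansive ψ) (b : Zp) where

    step : Zp → Zp
    step x = b + p^ 1 * ψ x

    iterate : ℕ → Zp
    iterate zero    = 0#
    iterate (suc n) = step (iterate n)

    step-mod : ∀ n {x y z} → x ≈ y + p^ n * z → ∃ λ z′ → step x ≈ step y + p^ (suc n) * z′
    step-mod n {x} {y} {z} e = let z′ , f = ψ-mod x y (p^ n) z e in z′ , (begin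
      b + p^ 1 * ψ x                            ≈⟨ +-congˡ (*-congˡ f) ⟩
      b + p^ 1 * (ψ y + p^ n * z′)              ≈⟨ lemma b (p^ 1) (ψ y) (p^ n) z′ ⟩
      b + p^ 1 * ψ y + p^ 1 * p^ n * z′         ≈⟨ +-congˡ (*-congʳ (p^-+ 1 n)) ⟨
      b + p^ 1 * ψ y + p^ (suc n) * z′          ∎)
      where
      lemma : ∀ b q y r z → b + q * (y + r * z) ≈ b + q * y + q * r * z
      lemma = solve 5 (λ b q y r z → b :+ q :* (y :+ r :* z) := b :+ q :* y :+ q :* r :* z) refl

    iterate-mod : ∀ n → ∃ λ z → iterate (suc n) ≈ iterate n + p^ n * z
    iterate-mod zero    = iterate 1 , sym (trans (+-identityˡ _) (*-identityˡ _))
    iterate-mod (suc n) = step-mod n (proj₂ (iterate-mod n))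

    iterate-at : ∀ n → + (p ℕ.^ n) ∣ (proj₁ (iterate (suc n)) n ℤ.- proj₁ (iterate n) n)
    iterate-at n = mod-at n {iterate (suc n)} {iterate n} (proj₁ (iterate-mod n)) (proj₂ (iterate-mod n))

    -- The diagonal suffices, as the iterates from the n-th on agree modulo p^n.
    limit : Zp
    limit = (λ n → proj₁ (iterate n) n)
          , λ n → ∣-trans (p ℕ.^ n) (proj₁ (iterate (suc n)) (suc n)) (proj₁ (iterate (suc n)) n) (proj₁ (iterate n) n)
                    (proj₂ (iterate (suc n)) n) (iterate-at n)

    -- At index n the limit is `iterate n` by definition. Applying `step` gives a congruence with
    -- `iterate (suc n)`, even modulo p^(n+1), and that iterate is congruent to `iterate n` modulo
    -- p^n.
    fixedPoint : ∃ λ x → x ≈ b + p^ 1 * ψ x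
    fixedPoint = limit , wrap λ n →
      let z , e = at-mod n limit (iterate n) (refl-at n)
          z′ , f = step-mod n {limit} {iterate n} {z} e
      in ∣-sym (p ℕ.^ n) (proj₁ (step limit) n) (proj₁ limit n)
           (∣-trans (p ℕ.^ n) (proj₁ (step limit) n) (proj₁ (iterate (suc n)) n) (proj₁ limit n)
             (mod-at n {step limit} {iterate (suc n)} (p^ 1 * z′)
               (trans f (+-congˡ (trans (*-congʳ (trans (p^-+ 1 n) (*-comm _ _))) (*-assoc _ _ _)))))
             (iterate-at n))
      where
      refl-at : ∀ n → + (p ℕ.^ n) ∣ (proj₁ limit n ℤ.- proj₁ (iterate n) n)
      refl-at n = unwrap (refl {iterate n}) n

  -- The inverse is the fixed point of v ↦ 1 - p w v, the geometric series in disguise.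
  1+p-unit : ∀ w → ∃ λ v → (1# + p^ 1 * w) * v ≈ 1#
  1+p-unit w =
    let v , v≈ = fixedPoint (- w *_) ψ-mod 1# in v , (begin
      (1# + p^ 1 * w) * v                             ≈⟨ distribʳ _ _ _ ⟩
      1# * v + p^ 1 * w * v                           ≈⟨ +-cong (trans (*-identityˡ v) v≈) (*-assoc _ _ _) ⟩
      1# + p^ 1 * (- w * v) + p^ 1 * (w * v)          ≈⟨ +-assoc _ _ _ ⟩
      1# + (p^ 1 * (- w * v) + p^ 1 * (w * v))        ≈⟨ +-congˡ (distribˡ _ _ _) ⟨
      1# + p^ 1 * (- w * v + w * v)                   ≈⟨ +-congˡ (*-congˡ (distribʳ _ _ _)) ⟨
      1# + p^ 1 * ((- w + w) * v)                     ≈⟨ +-congˡ (*-congˡ (trans (*-congʳ (-‿inverseˡ w)) (zeroˡ v))) ⟩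
      1# + p^ 1 * 0#                                  ≈⟨ trans (+-congˡ (zeroʳ _)) (+-identityʳ 1#) ⟩
      1#                                              ∎)
    where
    ψ-mod : Nonexpansive (- w *_)
    ψ-mod x y d z e = - w * z , trans (*-congˡ e)
      (solve 4 (λ w y d z → w :* (y :+ d :* z) := w :* y :+ d :* (w :* z)) refl _ _ _ _)

  -- An inverse of the residue modulo p brings z to the form 1 + p w.
  unit : ∀ (z : Zp) → ¬ (+ p ∣ proj₁ z 1) → ∃ λ u → z * u ≈ 1#
  unit z p∤z =
    let a , q , za≡   = inverse-mod-prime pr (proj₁ z 1) p∤z
        w , za≈       = at-mod 1 (z * cst a) 1# (≡⇒∣- (p ℕ.^ 1) (proj₁ (z * cst a) 1) ℤ.1ℤ q
                          (≡.trans (≡.cong-app (seq-* z (cst a)) 1) (≡.trans za≡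
                            (≡.cong (λ m → ℤ.1ℤ ℤ.+ + m ℤ.* q) (≡.sym (ℕₚ.*-identityʳ p))))))
        v , [1+pw]v≈1 = 1+p-unit w
    in cst a * v , trans (sym (*-assoc z (cst a) v)) (trans (*-congʳ za≈) [1+pw]v≈1)

-- Bell polynomials

-- The coefficient (i₁ + i₂ + ...)! / (i₁! i₂! ...), as a product of binomial coefficients so that
-- it is a natural number by construction.
multinomial : ∀ {l} → Vec ℕ l → ℕ
multinomial []      = 1
multinomial (i ∷ v) = ((sumV v ℕ.+ i) C i) ℕ.* multinomial v

multinomial-factProd : ∀ {l} (v : Vec ℕ l) → multinomial v ℕ.* factProd v ≡ sumV v !
multinomial-factProd []      = ≡.refl
multinomial-factProd (i ∷ v) = begin
  (((sumV v ℕ.+ i) C i) ℕ.* multinomial v) ℕ.* (i ! ℕ.* factProd v)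
    ≡⟨ rearrange ((sumV v ℕ.+ i) C i) (multinomial v) (i !) (factProd v) ⟩
  ((sumV v ℕ.+ i) C i) ℕ.* (i ! ℕ.* (multinomial v ℕ.* factProd v))
    ≡⟨ ≡.cong (λ z → ((sumV v ℕ.+ i) C i) ℕ.* (i ! ℕ.* z)) (multinomial-factProd v) ⟩
  ((sumV v ℕ.+ i) C i) ℕ.* (i ! ℕ.* sumV v !)
    ≡⟨ [m+k]Ck*k!*m!≡[m+k]! (sumV v) i ⟩
  (sumV v ℕ.+ i) !
    ≡⟨ ≡.cong _! (ℕₚ.+-comm (sumV v) i) ⟩
  (i ℕ.+ sumV v) ! ∎
  where
  open ≡.≡-Reasoning
  rearrange : ∀ a b c d → (a ℕ.* b) ℕ.* (c ℕ.* d) ≡ a ℕ.* (c ℕ.* (b ℕ.* d))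
  rearrange = solve-ℕ

-- It shows that the ratio of factorials in a Bell term is an integer, and it separates the factor
-- (n+k)! / k!, which depends on the vector only through its sum.
factProd-∣-! : ∀ n {l} (v : Vec ℕ l) → let k = sumV v in
  (n ℕ.+ k) ! ≡ factProd v ℕ.* (((n ℕ.+ k) C k) ℕ.* n ! ℕ.* multinomial v)
factProd-∣-! n v = begin
  (n ℕ.+ k) !
    ≡⟨ ≡.sym ([m+k]Ck*k!*m!≡[m+k]! n k) ⟩
  ((n ℕ.+ k) C k) ℕ.* (k ! ℕ.* n !)
    ≡⟨ ≡.cong (λ z → ((n ℕ.+ k) C k) ℕ.* (z ℕ.* n !)) (≡.sym (multinomial-factProd v)) ⟩
  ((n ℕ.+ k) C k) ℕ.* (multinomial v ℕ.* factProd v ℕ.* n !)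
    ≡⟨ rearrange ((n ℕ.+ k) C k) (multinomial v) (factProd v) (n !) ⟩
  factProd v ℕ.* (((n ℕ.+ k) C k) ℕ.* n ! ℕ.* multinomial v) ∎
  where
  open ≡.≡-Reasoning
  k = sumV v
  rearrange : ∀ c m f n → c ℕ.* (m ℕ.* f ℕ.* n) ≡ f ℕ.* (c ℕ.* n ℕ.* m)
  rearrange = solve-ℕ

factProd≢0 : ∀ {l} (v : Vec ℕ l) → ℕ.NonZero (factProd v)
factProd≢0 []      = _
factProd≢0 (i ∷ v) = ℕₚ.m*n≢0 (i !) (factProd v) {{i ℕₚ.!≢0}} {{factProd≢0 v}}

≡ᵇ-+ : ∀ i m n → (i ℕ.+ m ≡ᵇ i ℕ.+ n) ≡ (m ≡ᵇ n)
≡ᵇ-+ zero    m n = ≡.refl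
≡ᵇ-+ (suc i) m n = ≡ᵇ-+ i m n

≡ᵇ-> : ∀ i m n → n ℕ.< i → (i ℕ.+ m ≡ᵇ n) ≡ false
≡ᵇ-> (suc i) m zero    _         = ≡.refl
≡ᵇ-> (suc i) m (suc n) (s≤s n<i) = ≡ᵇ-> i m n n<i

≡ᵇ-true : ∀ m n → (m ≡ᵇ n) ≡ true → m ≡ n
≡ᵇ-true m n e = ℕₚ.≡ᵇ⇒≡ m n (≡.subst T (≡.sym e) _)
  where open import Data.Bool.Base using (T)

module BellSum {c ℓ} (R : CommutativeSemiring c ℓ) where
  open CommutativeSemiring R hiding (zero)
  open PowerSeries R
  open Sums R
  open import Algebra.Properties.Semiring.Exp semiring using (_^_)
  open import Algebra.Properties.CommutativeSemigroup +-commutativeSemigroup using (interchange)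
  open import Algebra.Solver.Ring.NaturalCoefficients.Default R
    using (solve; _:+_; _:*_; _:=_)
  open import Relation.Binary.Reasoning.Setoid setoid
  private module S = CommutativeSemiring seriesSemiring

  ∑ₗ : ∀ {a} {A : Set a} → List A → (A → Carrier) → Carrier
  ∑ₗ []       f = 0#
  ∑ₗ (x ∷ xs) f = f x + ∑ₗ xs f

  module _ {a} {A : Set a} where
    ∑ₗ-cong : ∀ (xs : List A) {f g} → (∀ x → f x ≈ g x) → ∑ₗ xs f ≈ ∑ₗ xs g
    ∑ₗ-cong []       e = refl
    ∑ₗ-cong (x ∷ xs) e = +-cong (e x) (∑ₗ-cong xs e)

    *-∑ₗ : ∀ y (xs : List A) f → y * ∑ₗ xs f ≈ ∑ₗ xs (λ x → y * f x)
    *-∑ₗ y []       f = zeroʳ y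
    *-∑ₗ y (x ∷ xs) f = trans (distribˡ _ _ _) (+-congˡ (*-∑ₗ y xs f))

    ∑ₗ-zero : ∀ (xs : List A) {f} → (∀ x → f x ≈ 0#) → ∑ₗ xs f ≈ 0#
    ∑ₗ-zero []       e = refl
    ∑ₗ-zero (x ∷ xs) e = trans (+-cong (e x) (∑ₗ-zero xs e)) (+-identityˡ 0#)

    ∑ₗ-+ : ∀ (xs : List A) f g → ∑ₗ xs (λ x → f x + g x) ≈ ∑ₗ xs f + ∑ₗ xs g
    ∑ₗ-+ []       f g = sym (+-identityˡ 0#)
    ∑ₗ-+ (x ∷ xs) f g = trans (+-congˡ (∑ₗ-+ xs f g)) (interchange _ _ _ _)

    ∑ₗ-∑ : ∀ (xs : List A) N (f : A → ℕ → Carrier) →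
           ∑ₗ xs (λ x → ∑ N (f x)) ≈ ∑ N (λ i → ∑ₗ xs (λ x → f x i))
    ∑ₗ-∑ xs zero    f = ∑ₗ-zero xs λ _ → refl
    ∑ₗ-∑ xs (suc N) f = trans (∑ₗ-+ xs _ _) (+-congʳ (∑ₗ-∑ xs N f))

    ∑ₗ-++ : ∀ (xs ys : List A) f → ∑ₗ (xs ++ ys) f ≈ ∑ₗ xs f + ∑ₗ ys f
    ∑ₗ-++ []       ys f = sym (+-identityˡ _)
    ∑ₗ-++ (x ∷ xs) ys f = trans (+-congˡ (∑ₗ-++ xs ys f)) (sym (+-assoc _ _ _))

    ∑ₗ-applyUpTo : ∀ (g : ℕ → A) h N f → ∑ₗ (map g (applyUpTo h N)) f ≈ ∑ N (f ∘ g ∘ h)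
    ∑ₗ-applyUpTo g h zero    f = refl
    ∑ₗ-applyUpTo g h (suc N) f =
      trans (+-congˡ (∑ₗ-applyUpTo g (h ∘ suc) N f)) (sym (∑-head N (f ∘ g ∘ h)))

  ∑ₗ-vecs : ∀ l b (f : Vec ℕ (suc l) → Carrier) →
    ∑ₗ (vecs (suc l) b) f ≈ ∑ (suc b) (λ i → ∑ₗ (vecs l b) (λ v → f (i ∷ v)))
  ∑ₗ-vecs l b f = trans (nested (vecs l b)) (∑ₗ-∑ (vecs l b) (suc b) (λ v i → f (i ∷ v)))
    where
    nested : ∀ vs → ∑ₗ (concat (map (λ v → map (λ i → i ∷ v) (upTo (suc b))) vs)) f
                  ≈ ∑ₗ vs (λ v → ∑ (suc b) (λ i → f (i ∷ v)))
    nested []       = refl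
    nested (v ∷ vs) = trans (∑ₗ-++ (map (λ i → i ∷ v) (upTo (suc b))) _ f)
      (+-cong (∑ₗ-applyUpTo (λ i → i ∷ v) id (suc b) f) (nested vs))

  ∑-extend : ∀ N d f → (∀ i → N ℕ.≤ i → f i ≈ 0#) → ∑ (d ℕ.+ N) f ≈ ∑ N f
  ∑-extend N zero    f z = refl
  ∑-extend N (suc d) f z = trans (+-cong (∑-extend N d f z) (z (d ℕ.+ N) (ℕₚ.m≤n+m N d))) (+-identityʳ _)

  module Generating (γ : ℕ → Carrier) where

    monomial : ∀ {l} → ℕ → Vec ℕ l → Carrier
    monomial s []      = 1#
    monomial s (i ∷ v) = γ s ^ i * monomial (suc s) v

    -- The starting weight s is a parameter because removing the first entry of a vector leaves one
    -- whose weights begin at s + 1.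
    bellSummand : ∀ {l} → ℕ → ℕ → ℕ → Vec ℕ l → Carrier
    bellSummand s k n v =
      if (sumV v ≡ᵇ k) ∧ (wsumFrom s v ≡ᵇ n) then nat (multinomial v) * monomial s v else 0#

    -- γ s w ^ s + γ (1 + s) w ^ (1 + s) + ..., with l terms
    generating : ℕ → ℕ → Series
    generating zero    s = 𝟘
    generating (suc l) s = shift s (con (γ s)) ⊞ generating l (suc s)

    con-^^ : ∀ x i → con x ^^ i ≋ con (x ^ i)
    con-^^ x zero    n       = refl
    con-^^ x (suc i) zero    = trans (con-⋆ x (con x ^^ i) 0) (*-congˡ (con-^^ x i 0))
    con-^^ x (suc i) (suc n) = trans (con-⋆ x (con x ^^ i) (suc n)) (trans (*-congˡ (con-^^ x i (suc n))) (zeroʳ x))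

    generating-^^-⋆ : ∀ s i a → shift s (con (γ s)) ^^ i ⋆ a ≋ shift (s ℕ.* i) (γ s ^ i ∙ a)
    generating-^^-⋆ s i a n = begin
      (shift s (con (γ s)) ^^ i ⋆ a) n
        ≈⟨ ⋆-cong (shift-^^ s i (con (γ s))) (λ _ → refl) n ⟩
      (shift (i ℕ.* s) (con (γ s) ^^ i) ⋆ a) n
        ≈⟨ shift-⋆ (i ℕ.* s) (con (γ s) ^^ i) a n ⟩
      shift (i ℕ.* s) (con (γ s) ^^ i ⋆ a) n
        ≈⟨ shift-cong (i ℕ.* s) (λ j → trans (⋆-cong (con-^^ (γ s) i) (λ _ → refl) j) (con-⋆ (γ s ^ i) a j)) n ⟩
      shift (i ℕ.* s) (γ s ^ i ∙ a) n
        ≡⟨ ≡.cong (λ m → shift m (γ s ^ i ∙ a) n) (ℕₚ.*-comm i s) ⟩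
      shift (s ℕ.* i) (γ s ^ i ∙ a) n ∎

    bellSummand-∷ : ∀ {l} s i k n (v : Vec ℕ l) →
      bellSummand s (i ℕ.+ k) (s ℕ.* i ℕ.+ n) (i ∷ v) ≈ nat ((k ℕ.+ i) C i) * γ s ^ i * bellSummand (suc s) k n v
    bellSummand-∷ s i k n v
      rewrite ≡ᵇ-+ i (sumV v) k | ≡ᵇ-+ (s ℕ.* i) (wsumFrom (suc s) v) n
      with sumV v ≡ᵇ k in sum≡ | wsumFrom (suc s) v ≡ᵇ n
    ... | false | _     = sym (zeroʳ _)
    ... | true  | false = sym (zeroʳ _)
    ... | true  | true  = begin
      nat (((sumV v ℕ.+ i) C i) ℕ.* multinomial v) * (γ s ^ i * monomial (suc s) v)
        ≡⟨ ≡.cong (λ z → nat (((z ℕ.+ i) C i) ℕ.* multinomial v) * (γ s ^ i * monomial (suc s) v)) (≡ᵇ-true (sumV v) k sum≡) ⟩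
      nat (((k ℕ.+ i) C i) ℕ.* multinomial v) * (γ s ^ i * monomial (suc s) v)
        ≈⟨ *-congʳ (nat-* ((k ℕ.+ i) C i) (multinomial v)) ⟩
      nat ((k ℕ.+ i) C i) * nat (multinomial v) * (γ s ^ i * monomial (suc s) v)
        ≈⟨ solve 4 (λ a b x y → a :* b :* (x :* y) := a :* x :* (b :* y)) refl _ _ _ _ ⟩
      nat ((k ℕ.+ i) C i) * γ s ^ i * (nat (multinomial v) * monomial (suc s) v) ∎

    -- The multinomial theorem, by induction on the number of variables: the first entry i is the
    -- exponent of the leading monomial X in the binomial expansion of (X + Y)^k. Entries run up to
    -- b ≥ k, so none is missed, and those above k contribute nothing.
    bell-sum : ∀ l s b k n → k ℕ.≤ b → ∑ₗ (vecs l b) (bellSummand s k n) ≈ (generating l s ^^ k) n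
    bell-sum zero s b zero    zero    _ = trans (+-identityʳ _) (trans (*-identityʳ _) (+-identityʳ 1#))
    bell-sum zero s b zero    (suc n) _ = +-identityʳ 0#
    bell-sum zero s b (suc k) n       _ = trans (+-identityʳ 0#) (sym (⋆-zeroˡ (𝟘 ^^ k) n))
    bell-sum (suc l) s b k n k≤b = begin
      ∑ₗ (vecs (suc l) b) (bellSummand s k n)
        ≈⟨ ∑ₗ-vecs l b (bellSummand s k n) ⟩
      ∑ (suc b) (λ i → ∑ₗ (vecs l b) (λ v → bellSummand s k n (i ∷ v)))
        ≈⟨ ∑-cong (suc b) (λ i _ → term i) ⟩
      ∑ (suc b) (λ i → nat (k C i) * (X ^^ i ⋆ Y ^^ (k ℕ.∸ i)) n)
        ≡⟨ ≡.cong (λ m → ∑ m (λ i → nat (k C i) * (X ^^ i ⋆ Y ^^ (k ℕ.∸ i)) n))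
             (≡.sym (ℕₚ.m∸n+n≡m (s≤s k≤b))) ⟩
      ∑ (suc b ℕ.∸ suc k ℕ.+ suc k) (λ i → nat (k C i) * (X ^^ i ⋆ Y ^^ (k ℕ.∸ i)) n)
        ≈⟨ ∑-extend (suc k) (suc b ℕ.∸ suc k) _ (λ i k<i →
             trans (*-congʳ (reflexive (≡.cong nat (k>n⇒nCk≡0 k<i)))) (zeroˡ _)) ⟩
      ∑ (suc k) (λ i → nat (k C i) * (X ^^ i ⋆ Y ^^ (k ℕ.∸ i)) n)
        ≈⟨ binomial-series k X Y n ⟨
      ((X ⊞ Y) ^^ k) n ∎
      where
      X = shift s (con (γ s))
      Y = generating l (suc s)
      term-≤ : ∀ i k n → k ℕ.≤ b →
        ∑ₗ (vecs l b) (λ v → bellSummand s (i ℕ.+ k) (s ℕ.* i ℕ.+ n) (i ∷ v))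
          ≈ nat ((k ℕ.+ i) C i) * (X ^^ i ⋆ Y ^^ k) (s ℕ.* i ℕ.+ n)
      term-≤ i k n k≤b = begin
        ∑ₗ (vecs l b) (λ v → bellSummand s (i ℕ.+ k) (s ℕ.* i ℕ.+ n) (i ∷ v))
          ≈⟨ ∑ₗ-cong (vecs l b) (bellSummand-∷ s i k n) ⟩
        ∑ₗ (vecs l b) (λ v → nat ((k ℕ.+ i) C i) * γ s ^ i * bellSummand (suc s) k n v)
          ≈⟨ *-∑ₗ _ (vecs l b) _ ⟨
        nat ((k ℕ.+ i) C i) * γ s ^ i * ∑ₗ (vecs l b) (bellSummand (suc s) k n)
          ≈⟨ *-congˡ (bell-sum l (suc s) b k n k≤b) ⟩
        nat ((k ℕ.+ i) C i) * γ s ^ i * (Y ^^ k) n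
          ≈⟨ *-assoc _ _ _ ⟩
        nat ((k ℕ.+ i) C i) * (γ s ^ i ∙ Y ^^ k) n
          ≡⟨ ≡.cong (nat ((k ℕ.+ i) C i) *_) (≡.sym (shift-+ (s ℕ.* i) (γ s ^ i ∙ Y ^^ k) n)) ⟩
        nat ((k ℕ.+ i) C i) * shift (s ℕ.* i) (γ s ^ i ∙ Y ^^ k) (s ℕ.* i ℕ.+ n)
          ≈⟨ *-congˡ (generating-^^-⋆ s i (Y ^^ k) (s ℕ.* i ℕ.+ n)) ⟨
        nat ((k ℕ.+ i) C i) * (X ^^ i ⋆ Y ^^ k) (s ℕ.* i ℕ.+ n) ∎
      term : ∀ i → ∑ₗ (vecs l b) (λ v → bellSummand s k n (i ∷ v)) ≈ nat (k C i) * (X ^^ i ⋆ Y ^^ (k ℕ.∸ i)) n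
      -- If i exceeds k or s i exceeds n, no vector passes the test, and on the other side the
      -- binomial coefficient or the shifted series is zero. Otherwise k and n are i and s i plus a
      -- remainder.
      term i with i ℕₚ.≤? k | s ℕ.* i ℕₚ.≤? n
      ... | no i≰k | _ = trans
        (∑ₗ-zero (vecs l b) λ v → reflexive (≡.cong
          (λ c → if c ∧ (wsumFrom s (i ∷ v) ≡ᵇ n) then nat (multinomial (i ∷ v)) * monomial s (i ∷ v) else 0#)
          (≡ᵇ-> i (sumV v) k (ℕₚ.≰⇒> i≰k))))
        (sym (trans (*-congʳ (reflexive (≡.cong nat (k>n⇒nCk≡0 (ℕₚ.≰⇒> i≰k))))) (zeroˡ _)))
      ... | yes _ | no si≰n = trans
        (∑ₗ-zero (vecs l b) λ v → reflexive (≡.cong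
          (λ c → if c then nat (multinomial (i ∷ v)) * monomial s (i ∷ v) else 0#)
          (≡.trans (≡.cong ((i ℕ.+ sumV v ≡ᵇ k) ∧_) (≡ᵇ-> (s ℕ.* i) (wsumFrom (suc s) v) n (ℕₚ.≰⇒> si≰n)))
            (∧-zeroʳ (i ℕ.+ sumV v ≡ᵇ k)))))
        (sym (trans (*-congˡ (trans (generating-^^-⋆ s i (Y ^^ (k ℕ.∸ i)) n)
          (reflexive (shift-< (s ℕ.* i) (γ s ^ i ∙ Y ^^ (k ℕ.∸ i)) n (ℕₚ.≰⇒> si≰n))))) (zeroʳ _)))
      ... | yes i≤k | yes si≤n = ≡.subst₂
        (λ k′ n′ → ∑ₗ (vecs l b) (λ v → bellSummand s k′ n′ (i ∷ v)) ≈ nat (k′ C i) * (X ^^ i ⋆ Y ^^ (k ℕ.∸ i)) n′)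
        (ℕₚ.m+[n∸m]≡n i≤k) (ℕₚ.m+[n∸m]≡n si≤n)
        (≡.subst (λ k′ → ∑ₗ (vecs l b) (λ v → bellSummand s (i ℕ.+ (k ℕ.∸ i)) (s ℕ.* i ℕ.+ (n ℕ.∸ s ℕ.* i)) (i ∷ v))
                       ≈ nat (k′ C i) * (X ^^ i ⋆ Y ^^ (k ℕ.∸ i)) (s ℕ.* i ℕ.+ (n ℕ.∸ s ℕ.* i)))
          (ℕₚ.+-comm (k ℕ.∸ i) i)
          (term-≤ i (k ℕ.∸ i) (n ℕ.∸ s ℕ.* i) (ℕₚ.≤-trans (ℕₚ.m∸n≤m k i) k≤b)))

    generating-< : ∀ l s i → i ℕ.< s → generating l s i ≈ 0#
    generating-< zero    s i i<s = refl
    generating-< (suc l) s i i<s = trans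
      (+-cong (reflexive (shift-< s (con (γ s)) i i<s)) (generating-< l (suc s) i (ℕₚ.m<n⇒m<1+n i<s)))
      (+-identityˡ 0#)

    generating-coef : ∀ l s j → j ℕ.< l → generating l s (s ℕ.+ j) ≈ γ (s ℕ.+ j)
    generating-coef (suc l) s zero    _         = trans
      (+-cong (reflexive (≡.trans (shift-+ s (con (γ s)) 0) (≡.cong γ (≡.sym (ℕₚ.+-identityʳ s)))))
              (generating-< l (suc s) (s ℕ.+ 0) (s≤s (ℕₚ.≤-reflexive (ℕₚ.+-identityʳ s)))))
      (+-identityʳ _)
    generating-coef (suc l) s (suc j) (s≤s j<l) = trans
      (+-cong (reflexive (shift-+ s (con (γ s)) (suc j)))
        (≡.subst (λ i → generating l (suc s) i ≈ γ i) (≡.sym (ℕₚ.+-suc s j)) (generating-coef l (suc s) j j<l)))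
      (+-identityˡ _)

    -- Each term of the generating polynomial has a factor w; taking w^k out of the power lowers the
    -- index from n + k to n. Then only its n + 1 lowest coefficients matter, and the n + k
    -- available ones are enough when k is positive, hence the separate case k = 0.
    bell-generating : ∀ n k → (generating (n ℕ.+ k) 1 ^^ k) (n ℕ.+ k) ≈ ((γ ∘ suc) ^^ k) n
    bell-generating n zero    = reflexive (≡.cong 𝟙 (ℕₚ.+-identityʳ n))
    bell-generating n k@(suc k-1) = begin
      (G ^^ k) (n ℕ.+ k)
        ≈⟨ ^^-cong k G≋ (n ℕ.+ k) ⟩
      (shift 1 (tl G) ^^ k) (n ℕ.+ k)
        ≈⟨ shift-^^ 1 k (tl G) (n ℕ.+ k) ⟩
      shift (k ℕ.* 1) (tl G ^^ k) (n ℕ.+ k)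
        ≡⟨ ≡.cong₂ (λ i j → shift i (tl G ^^ k) j) (ℕₚ.*-identityʳ k) (ℕₚ.+-comm n k) ⟩
      shift k (tl G ^^ k) (k ℕ.+ n)
        ≡⟨ shift-+ k (tl G ^^ k) n ⟩
      (tl G ^^ k) n
        ≈⟨ ^^-cong-≤ k n (λ j j≤n → generating-coef (n ℕ.+ k) 1 j
             (ℕₚ.≤-<-trans j≤n (ℕₚ.m<m+n n (s≤s z≤n)))) ⟩
      ((γ ∘ suc) ^^ k) n ∎
      where
      G = generating (n ℕ.+ k) 1
      G≋ : G ≋ shift 1 (tl G)
      G≋ zero    = generating-< (n ℕ.+ k) 1 0 (s≤s z≤n)
      G≋ (suc i) = refl

-- Fractions and the values they represent.

module Values {p : ℕ} (pr : Prime p) where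
  open PAdicPrime pr
  open CommutativeRing Zp-commutativeRing hiding (zero)
  open PowerSeries commutativeSemiring using (nat; nat-*; _^^_)
  open Sums commutativeSemiring using (∑)
  open import Algebra.Properties.Semiring.Exp semiring using (_^_)
  open import Algebra.Properties.Group +-group using (x∙y⁻¹≈ε⇒x≈y)
  open import Algebra.Properties.Ring ring using (-‿distribʳ-*)
  open import Algebra.Properties.CommutativeSemigroup *-commutativeSemigroup using (interchange)
  open import Algebra.Solver.Ring.NaturalCoefficients.Default commutativeSemiring
    using (solve; _:+_; _:*_; _:=_)
  open import Relation.Binary.Reasoning.Setoid setoid

  -- The fraction q represents y / D.
  record Val (q : Qp) (y D : Zp) : Set where
    constructor val
    field
      {num den} : Zp
      num≗      : ∀ n → proj₁ q n ≡ proj₁ num n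
      den≗      : ∀ n → proj₂ q n ≡ proj₁ den n
      cross     : num * D ≈ den * y

  Regular : Zp → Set
  Regular D = ∀ x → D * x ≈ 0# → x ≈ 0#

  abstract
    seq-*-≗ : ∀ {a b : Seq} (x y : Zp) → (∀ n → a n ≡ proj₁ x n) → (∀ n → b n ≡ proj₁ y n) →
      ∀ n → (a ⊗ b) n ≡ proj₁ (x * y) n
    seq-*-≗ x y e f n = ≡.trans (≡.cong₂ ℤ._*_ (e n) (f n)) (≡.sym (≡.cong-app (seq-* x y) n))

    seq-+-≗ : ∀ {a b : Seq} (x y : Zp) → (∀ n → a n ≡ proj₁ x n) → (∀ n → b n ≡ proj₁ y n) →
      ∀ n → (a ⊕ b) n ≡ proj₁ (x + y) n
    seq-+-≗ x y e f n = ≡.trans (≡.cong₂ ℤ._+_ (e n) (f n)) (≡.sym (≡.cong-app (seq-+ x y) n))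

    val-≈ : ∀ {q y y′ D D′} → y ≈ y′ → D ≈ D′ → Val q y D → Val q y′ D′
    val-≈ y≈y′ D≈D′ (val e f c) = val e f (trans (*-congˡ (sym D≈D′)) (trans c (*-congˡ y≈y′)))

    -- The reference denominator D stays fixed while the actual denominators multiply, so long sums
    -- keep one common denominator.
    val-+ : ∀ {q q′ y y′ D} → Val q y D → Val q′ y′ D → Val (q +q q′) (y + y′) D
    val-+ {y = y} {y′} {D} (val {a} {d} e f c) (val {b} {d′} e′ f′ c′) =
      val (seq-+-≗ (a * d′) (b * d) (seq-*-≗ a d′ e f′) (seq-*-≗ b d e′ f)) (seq-*-≗ d d′ f f′) (begin
        (a * d′ + b * d) * D         ≈⟨ lemma₁ a d′ b d D ⟩
        d′ * (a * D) + d * (b * D)   ≈⟨ +-cong (*-congˡ c) (*-congˡ c′) ⟩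
        d′ * (d * y) + d * (d′ * y′) ≈⟨ lemma₂ d′ d y y′ ⟩
        d * d′ * (y + y′)            ∎)
      where
      lemma₁ : ∀ a d′ b d D → (a * d′ + b * d) * D ≈ d′ * (a * D) + d * (b * D)
      lemma₁ = solve 5 (λ a d′ b d D → (a :* d′ :+ b :* d) :* D := d′ :* (a :* D) :+ d :* (b :* D)) refl
      lemma₂ : ∀ d′ d y y′ → d′ * (d * y) + d * (d′ * y′) ≈ d * d′ * (y + y′)
      lemma₂ = solve 4 (λ d′ d y y′ → d′ :* (d :* y) :+ d :* (d′ :* y′) := d :* d′ :* (y :+ y′)) refl

    val-* : ∀ {q q′ y y′ D D′} → Val q y D → Val q′ y′ D′ → Val (q *q q′) (y * y′) (D * D′)
    val-* (val {a} {d} e f c) (val {b} {d′} e′ f′ c′) =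
      val (seq-*-≗ a b e e′) (seq-*-≗ d d′ f f′)
        (trans (interchange _ _ _ _) (trans (*-cong c c′) (interchange _ _ _ _)))

    val-*₁ : ∀ {q q′ y y′ D} → Val q y D → Val q′ y′ 1# → Val (q *q q′) (y * y′) D
    val-*₁ v v′ = val-≈ refl (*-identityʳ _) (val-* v v′)

    val-/ : ∀ {q q′ y y′ D D′} → Val q y D → Val q′ y′ D′ → Val (q /q q′) (y * D′) (D * y′)
    val-/ v (val e f c) = val-* v (val f e (sym c))

    val-/₁ : ∀ {q q′ y y′} → Val q y 1# → Val q′ y′ 1# → Val (q /q q′) y y′
    val-/₁ v v′ = val-≈ (*-identityʳ _) (*-identityˡ _) (val-/ v v′)

    val-const : ∀ a → Val (ιℤ a) (cst a) 1#
    val-const a = val {num = cst a} {den = 1#} (λ _ → ≡.refl) (λ _ → ≡.refl) (*-comm _ _)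

    val-nat : ∀ n → Val (ιℕ n) (nat n) 1#
    val-nat n = val-≈ (cst-nat n) refl (val-const (+ n))

    val-^ : ∀ {q y} → Val q y 1# → ∀ n → Val (q ^q n) (y ^ n) 1#
    val-^ v zero    = val-const ℤ.1ℤ
    val-^ v (suc n) = val-*₁ v (val-^ v n)

    -- This is how factorials leave the denominators: the cross-multiplied equation holds after
    -- multiplication by D, and D is no zero divisor.
    val-cancel : ∀ {q y E} D → Regular D → Val q (D * y) (D * E) → Val q y E
    val-cancel {y = y} {E} D regular (val {a} {d} e f c) = val e f
      (x∙y⁻¹≈ε⇒x≈y _ _ (regular _ (begin
        D * (a * E + - (d * y))          ≈⟨ distribˡ _ _ _ ⟩
        D * (a * E) + D * - (d * y)      ≈⟨ +-cong (swap a D E) (trans (sym (-‿distribʳ-* D (d * y))) (-‿cong (swap d D y))) ⟩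
        a * (D * E) + - (d * (D * y))    ≈⟨ +-congʳ c ⟩
        d * (D * y) + - (d * (D * y))    ≈⟨ -‿inverseʳ _ ⟩
        0#                               ∎)))
      where
      swap : ∀ a D E → D * (a * E) ≈ a * (D * E)
      swap = solve 3 (λ a D E → D :* (a :* E) := a :* (D :* E)) refl

    -- A unit in the denominator is traded for its inverse in the numerator; this is applied to the
    -- powers of c₁.
    val-unit : ∀ {q y D} e u → e * u ≈ 1# → Val q y (D * e) → Val q (y * u) D
    val-unit {y = y} {D} e u eu≈1 (val {a} {d} e₁ e₂ c) = val e₁ e₂ (begin
      a * D              ≈⟨ *-identityʳ _ ⟨
      a * D * 1#         ≈⟨ *-congˡ eu≈1 ⟨
      a * D * (e * u)    ≈⟨ lemma a D e u ⟩
      a * (D * e) * u    ≈⟨ *-congʳ c ⟩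
      d * y * u          ≈⟨ *-assoc _ _ _ ⟩
      d * (y * u)        ∎)
      where
      lemma : ∀ a D e u → a * D * (e * u) ≈ a * (D * e) * u
      lemma = solve 4 (λ a D e u → a :* D :* (e :* u) := a :* (D :* e) :* u) refl

    val-0 : ∀ D → Val 0q 0# D
    val-0 D = val {num = 0#} {den = 1#} (λ _ → ≡.refl) (λ _ → ≡.refl) (trans (zeroˡ D) (sym (zeroʳ 1#)))

    val-Σ : ∀ N {f y D} → (∀ k → k ℕ.< N → Val (f k) (y k) D) → Val (Σq N f) (∑ N y) D
    val-Σ zero    v = val-0 _
    val-Σ (suc N) v = val-+ (val-Σ N λ k k<N → v k (ℕₚ.m<n⇒m<1+n k<N)) (v N ℕₚ.≤-refl)

    nat-regular : ∀ N → .{{ℕ.NonZero N}} → Regular (nat N)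
    nat-regular N = torsionFree N

    val-ratio : ∀ {a b c} → .{{ℕ.NonZero b}} → a ≡ b ℕ.* c → Val (ιℕ a /q ιℕ b) (nat c) 1#
    val-ratio {a} {b} {c} a≡bc = val-cancel (nat b) (nat-regular b)
      (val-≈ (trans (reflexive (≡.cong nat a≡bc)) (nat-* b c)) (sym (*-identityʳ _))
        (val-/₁ (val-nat a) (val-nat b)))

  module Bell (x : ℕ → Qp) (γ : ℕ → Zp)
    (x-val : ∀ j → Val (x j) (nat (j !) * γ j) 1#) where
    open BellSum commutativeSemiring
    open Generating γ

    abstract
      val-powProd : ∀ {l} s (v : Vec ℕ l) → Val (powProdFrom s x v) (monomial s v) 1#
      val-powProd s []      = val-const ℤ.1ℤ
      val-powProd s (i ∷ v) = val-*₁ (val-^ x/s!-val i) (val-powProd (suc s) v)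
        where
        x/s!-val : Val (x s /q ιℕ (s !)) (γ s) 1#
        x/s!-val = val-cancel (nat (s !)) (nat-regular (s !) {{s ℕₚ.!≢0}})
          (val-≈ refl (sym (*-identityʳ _)) (val-/₁ (x-val s) (val-nat (s !))))

      val-bellTerm : ∀ n k (v : Vec ℕ (n ℕ.+ k)) → sumV v ≡ k →
        Val (bellTerm (n ℕ.+ k) x v) (nat (((n ℕ.+ k) C k) ℕ.* n !) * (nat (multinomial v) * monomial 1 v)) 1#
      val-bellTerm n k v sum≡k = val-≈ (*-assoc _ _ _) refl
        (val-*₁ (val-≈ (nat-* (((n ℕ.+ k) C k) ℕ.* n !) (multinomial v)) refl
          (val-ratio {b = factProd v} {{factProd≢0 v}}
            (≡.subst (λ k → (n ℕ.+ k) ! ≡ factProd v ℕ.* (((n ℕ.+ k) C k) ℕ.* n ! ℕ.* multinomial v))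
              sum≡k (factProd-∣-! n v))))
          (val-powProd 1 v))

      val-B : ∀ n k → Val (B (n ℕ.+ k) k x) (nat (((n ℕ.+ k) C k) ℕ.* n !) * ((λ j → γ (suc j)) ^^ k) n) 1#
      val-B n k = val-≈
        (trans (sym (*-∑ₗ _ (vecs (n ℕ.+ k) (n ℕ.+ k)) (bellSummand 1 k (n ℕ.+ k)))) (*-congˡ
          (trans (bell-sum (n ℕ.+ k) 1 (n ℕ.+ k) k (n ℕ.+ k) (ℕₚ.m≤n+m k n)) (bell-generating n k))))
        refl (val-sum (vecs (n ℕ.+ k) (n ℕ.+ k)))
        where
        val-if : ∀ v → Val (if (sumV v ≡ᵇ k) ∧ (wsumFrom 1 v ≡ᵇ n ℕ.+ k) then bellTerm (n ℕ.+ k) x v else 0q)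
                           (nat (((n ℕ.+ k) C k) ℕ.* n !) * bellSummand 1 k (n ℕ.+ k) v) 1#
        val-if v with sumV v ≡ᵇ k in sum≡ | wsumFrom 1 v ≡ᵇ n ℕ.+ k
        ... | false | _     = val-≈ (sym (zeroʳ _)) refl (val-0 1#)
        ... | true  | false = val-≈ (sym (zeroʳ _)) refl (val-0 1#)
        ... | true  | true  = val-bellTerm n k v (≡ᵇ-true (sumV v) k sum≡)
        val-sum : ∀ vs → Val
          (sumList (map (λ v → if (sumV v ≡ᵇ k) ∧ (wsumFrom 1 v ≡ᵇ n ℕ.+ k) then bellTerm (n ℕ.+ k) x v else 0q) vs))
          (∑ₗ vs (λ v → nat (((n ℕ.+ k) C k) ℕ.* n !) * bellSummand 1 k (n ℕ.+ k) v)) 1#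
        val-sum []       = val-0 1#
        val-sum (v ∷ vs) = val-+ (val-if v) (val-sum vs)

-- The root

-- A named copy of the recursion that is local to `deriv`.
derivFromSeq : ℕ → Poly → Poly
derivFromSeq i []       = []
derivFromSeq i (b ∷ bs) = (constℕ i ⊗ b) ∷ derivFromSeq (suc i) bs

-- The left-hand side left out in the type of deriv-tail is the function local to deriv, which cannot be named.
mutual
  deriv-∷ : ∀ a as → deriv (a ∷ as) ≡ derivFromSeq 1 as
  deriv-∷ a []       = ≡.refl
  -- Abstracting these two terms makes every argument of the local function a variable, so that
  -- unification can determine the omitted left-hand side.
  deriv-∷ a (b ∷ bs) with 2 | b ∷ bs
  ... | i | cs = ≡.cong (_ ∷_) (deriv-tail a cs i bs)

  deriv-tail : ∀ a cs i bs → _ ≡ derivFromSeq i bs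
  deriv-tail a cs i []       = ≡.refl
  deriv-tail a cs i (b ∷ bs) = ≡.cong (_ ∷_) (deriv-tail a cs (suc i) bs)

module Assembly {p : ℕ} (pr : Prime p) where
  open PAdicPrime pr
  open Hensel pr using (1+p-unit; unit; fixedPoint; Nonexpansive)
  open Values pr
  open CommutativeRing Zp-commutativeRing hiding (zero)
  open PowerSeries commutativeSemiring using (nat; _^^_; _∙_)
  open Sums commutativeSemiring using (∑; ∑-cong)
  open Evaluation commutativeSemiring
  open LagrangeInversion Zp-commutativeRing using (ε; module Inverse)
  open InverseSeries Zp-commutativeRing using (1^; inverse-term; inverse-sum)
  open import Algebra.Properties.Semiring.Exp semiring using (_^_; ^-congˡ)
  open import Algebra.Properties.CommutativeSemiring.Exp commutativeSemiring using (^-distrib-*)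
  open import Algebra.Properties.Ring ring using (-1*x≈-x; -‿distribʳ-*)
  open import Algebra.Properties.Group +-group using (inverseʳ-unique)
  open import Algebra.Solver.Ring.NaturalCoefficients.Default commutativeSemiring
    using (solve; _:+_; _:*_; _:=_)
  open import Relation.Binary.Reasoning.Setoid setoid

  infix 4 _≐_
  -- It relates a bare sequence, as used in the statement, to a ring element. Termwise equality is
  -- enough because both sides compute the same integers.
  _≐_ : Seq → Zp → Set
  a ≐ x = ∀ n → a n ≡ proj₁ x n

  abstract
    eval-≐ : ∀ {f F a x} → Pointwise _≐_ f F → a ≐ x → eval f a ≐ evalP F x
    eval-≐ []        a≐x = λ _ → ≡.refl
    eval-≐ {F = b ∷ F} {x = x} (e ∷ es) a≐x =
      seq-+-≗ b (x * evalP F x) e (seq-*-≗ x (evalP F x) a≐x (eval-≐ es a≐x))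

    constℕ-≐ : ∀ i → constℕ i ≐ nat i
    constℕ-≐ i n = ≡.sym (nat≡ i n)

    derivFrom-≐ : ∀ i {f F} → Pointwise _≐_ f F → Pointwise _≐_ (derivFromSeq i f) (derivFrom i F)
    derivFrom-≐ i []                   = []
    derivFrom-≐ i {F = b ∷ F} (e ∷ es) = seq-*-≗ (nat i) b (constℕ-≐ i) e ∷ derivFrom-≐ (suc i) es

    deriv-≐ : ∀ {f F} → Pointwise _≐_ f F → Pointwise _≐_ (deriv f) (derivP F)
    deriv-≐ []                = []
    deriv-≐ {a ∷ f} {b ∷ F} (e ∷ es) =
      ≡.subst (λ g → Pointwise _≐_ g (derivFrom 1 F)) (≡.sym (deriv-∷ a f)) (derivFrom-≐ 1 es)

    derivN-≐ : ∀ j {f F} → Pointwise _≐_ f F → Pointwise _≐_ (derivN j f) (derivNP j F)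
    derivN-≐ zero    es = es
    derivN-≐ (suc j) es = deriv-≐ (derivN-≐ j es)

    ≐-shift : ∀ r₀ κ (x : Zp) → (const r₀ ⊕ constℕ (p ℕ.^ κ) ⊗ proj₁ x) ≐ (cst r₀ + p^ κ * x)
    ≐-shift r₀ κ x = seq-+-≗ (cst r₀) (p^ κ * x) (λ _ → ≡.refl)
      (seq-*-≗ (p^ κ) x (λ _ → ≡.refl) (λ _ → ≡.refl))

    ≈-≐ : ∀ {a b x y} → a ≐ x → b ≐ y → x ≈ y → a ≈[ p ] b
    ≈-≐ {a} {b} {x} {y} a≐x b≐y x≈y = ≈ₚ-trans {a} {proj₁ x} {b} (≗⇒≈ₚ a≐x)
      (≈ₚ-trans {proj₁ x} {proj₁ y} {b} (unwrap x≈y) (≗⇒≈ₚ λ n → ≡.sym (b≐y n)))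

    p^-* : ∀ j κ → p^ (j ℕ.* κ) ≈ p^ κ ^ j
    p^-* zero    κ = refl
    p^-* (suc j) κ = trans (p^-+ κ (j ℕ.* κ)) (*-congˡ (p^-* j κ))

  -- The conclusion of the theorem for ν = 2κ + 1 + e, which turns the exponent ν - κ of the lift
  -- into κ + 1 + e.
  LiftedRoot : Poly → (κ e : ℕ) → ℤ → Set
  LiftedRoot f κ e r₀ = Σ Seq (λ s → Coherent p s
    × ConvergesTo p (seriesTerm p κ f r₀) s
    × (eval f (const r₀ ⊕ constℕ (p ℕ.^ κ) ⊗ s) ≈[ p ] constℕ 0)
    × Σ Seq (λ z → Coherent p z
      × ((const r₀ ⊕ constℕ (p ℕ.^ κ) ⊗ s) ≈[ p ] (const r₀ ⊕ constℕ (p ℕ.^ (κ ℕ.+ suc e)) ⊗ z))))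

  module Root (f : Poly) (F : List Zp) (f≐F : Pointwise _≐_ f F) (κ e : ℕ) (r₀ : ℤ) (z₀ γ₁ u : Zp)
    (T₀≈ : coef (taylor (cst r₀) F) 0 ≈ p^ (2 ℕ.* κ ℕ.+ suc e) * z₀)
    (T₁≈ : coef (taylor (cst r₀) F) 1 ≈ p^ κ * γ₁)
    (γ₁u≈1 : γ₁ * u ≈ 1#) where

    P : Zp
    P = p^ κ

    T rest H : List Zp
    T    = taylor (cst r₀) F
    rest = drop 1 (drop 1 T)
    H    = scale 1# P rest

    γ₀ : Zp
    γ₀ = p^ (suc e) * z₀

    -- The c_j as p-adic integers. From j = 2 on, the power of p in c_j has a nonnegative exponent
    -- and `scale` supplies it; for j = 0 and j = 1 the negative power is absorbed by the
    -- divisibility assumed in `T₀≈` and `T₁≈`.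
    γ : ℕ → Zp
    γ = coef (γ₀ ∷ γ₁ ∷ H)

    abstract
      p^2κ : p^ (2 ℕ.* κ) ≈ P * P
      p^2κ = trans (p^-* 2 κ) (*-congˡ (*-identityʳ P))

      T-γ : ∀ j → p^ (j ℕ.* κ) * coef T j ≈ p^ (2 ℕ.* κ) * γ j
      T-γ zero = trans (*-identityˡ _) (trans T₀≈
        (trans (*-congʳ (p^-+ (2 ℕ.* κ) (suc e))) (*-assoc _ _ _)))
      T-γ (suc zero) = trans (*-cong (trans (p^-* 1 κ) (*-identityʳ P)) T₁≈)
        (trans (sym (*-assoc _ _ _)) (*-congʳ (sym p^2κ)))
      T-γ (suc (suc j)) = begin
        p^ ((2 ℕ.+ j) ℕ.* κ) * coef T (2 ℕ.+ j)
          ≈⟨ *-cong (p^-* (2 ℕ.+ j) κ) (reflexive (≡.sym (≡.trans (coef-drop 1 (drop 1 T) j) (coef-drop 1 T (suc j))))) ⟩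
        P * (P * P ^ j) * coef rest j
          ≈⟨ lemma P (P ^ j) (coef rest j) ⟩
        P * P * (1# * P ^ j * coef rest j)
          ≈⟨ *-cong p^2κ (coef-scale 1# P rest j) ⟨
        p^ (2 ℕ.* κ) * coef H j ∎
        where
        lemma : ∀ x y z → x * (x * y) * z ≈ x * x * (1# * y * z)
        lemma x y z = trans (solve 3 (λ x y z → x :* (x :* y) :* z := x :* x :* (y :* z)) refl x y z)
          (*-congˡ (*-congʳ (sym (*-identityˡ y))))

      c-val : ∀ j → Val (cCoef p κ f r₀ j) (γ j) 1#
      c-val j = val
        {num = p^ (j ℕ.* κ) * evalP (derivNP j F) (cst r₀)}
        {den = cst (+ (p ℕ.^ (2 ℕ.* κ) ℕ.* j !))}
        (seq-*-≗ (p^ (j ℕ.* κ)) (evalP (derivNP j F) (cst r₀)) (λ _ → ≡.refl)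
          (eval-≐ (derivN-≐ j f≐F) (λ _ → ≡.refl)))
        (λ _ → ≡.refl)
        (begin
          p^ (j ℕ.* κ) * evalP (derivNP j F) (cst r₀) * 1#
            ≈⟨ trans (*-identityʳ _) (*-congˡ (evalP-derivNP (cst r₀) j F)) ⟩
          p^ (j ℕ.* κ) * (nat (j !) * coef T j)
            ≈⟨ swap (p^ (j ℕ.* κ)) (nat (j !)) (coef T j) ⟩
          nat (j !) * (p^ (j ℕ.* κ) * coef T j)
            ≈⟨ *-congˡ (T-γ j) ⟩
          nat (j !) * (p^ (2 ℕ.* κ) * γ j)
            ≈⟨ trans (sym (*-assoc _ _ _)) (*-congʳ (*-comm _ _)) ⟩
          p^ (2 ℕ.* κ) * nat (j !) * γ j
            ≈⟨ *-congʳ (*-congˡ (cst-nat (j !))) ⟨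
          p^ (2 ℕ.* κ) * cst (+ (j !)) * γ j
            ≈⟨ *-congʳ (cst-* (+ (p ℕ.^ (2 ℕ.* κ))) (+ (j !))) ⟨
          cst (+ (p ℕ.^ (2 ℕ.* κ)) ℤ.* + (j !)) * γ j
            ≡⟨ ≡.cong (λ m → cst m * γ j) (≡.sym (ℤₚ.pos-* (p ℕ.^ (2 ℕ.* κ)) (j !))) ⟩
          cst (+ (p ℕ.^ (2 ℕ.* κ) ℕ.* j !)) * γ j ∎)
        where
        swap : ∀ x y z → x * (y * z) ≈ y * (x * z)
        swap = solve 3 (λ x y z → x :* (y :* z) := y :* (x :* z)) refl

      -- The root of γ₀ + γ₁ s + s² H(s), as the fixed point of s ↦ - u (γ₀ + s² H(s)), after dividing s by p.
      fixed : ∃ λ s′ → s′ ≈ - u * (p^ e * z₀) + p^ 1 * (- u * (s′ * s′ * evalP H (p^ 1 * s′)))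
      fixed = fixedPoint (λ x → - u * (x * x * evalP H (p^ 1 * x))) ψ-mod (- u * (p^ e * z₀))
        where
        lemma₁ : ∀ q y d z → q * (y + d * z) ≈ q * y + d * (q * z)
        lemma₁ = solve 4 (λ q y d z → q :* (y :+ d :* z) := q :* y :+ d :* (q :* z)) refl
        lemma₂ : ∀ n y d z E z′ → n * ((y + d * z) * (y + d * z) * (E + d * z′)) ≈
          n * (y * y * E) + d * (n * (y * y * z′ + (z * y + y * z + d * z * z) * (E + d * z′)))
        lemma₂ = solve 6 (λ n y d z E z′ → n :* ((y :+ d :* z) :* (y :+ d :* z) :* (E :+ d :* z′)) :=
          n :* (y :* y :* E) :+ d :* (n :* (y :* y :* z′ :+ (z :* y :+ y :* z :+ d :* z :* z) :* (E :+ d :* z′)))) refl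
        ψ-mod : Nonexpansive (λ x → - u * (x * x * evalP H (p^ 1 * x)))
        ψ-mod x y d z x≈ =
          let z′ , E≈ = evalP-mod H d (p^ 1 * z) (trans (*-congˡ x≈) (lemma₁ (p^ 1) y d z))
          in _ , trans (*-congˡ (*-cong (*-cong x≈ x≈) E≈)) (lemma₂ (- u) y d z (evalP H (p^ 1 * y)) z′)

    s′ s E : Zp
    s′ = proj₁ fixed
    s  = p^ 1 * s′
    E  = evalP H s

    abstract
      s≈ : s ≈ - u * (γ₀ + s * s * E)
      s≈ = begin
        p^ 1 * s′
          ≈⟨ *-congˡ (proj₂ fixed) ⟩
        p^ 1 * (- u * (p^ e * z₀) + p^ 1 * (- u * (s′ * s′ * E)))
          ≈⟨ lemma (p^ 1) (- u) (p^ e) z₀ s′ E ⟩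
        - u * (p^ 1 * p^ e * z₀ + s * s * E)
          ≈⟨ *-congˡ (+-congʳ (*-congʳ (p^-+ 1 e))) ⟨
        - u * (γ₀ + s * s * E) ∎
        where
        lemma : ∀ q n x z t E → q * (n * (x * z) + q * (n * (t * t * E))) ≈ n * (q * x * z + q * t * (q * t) * E)
        lemma = solve 6 (λ q n x z t E → q :* (n :* (x :* z) :+ q :* (n :* (t :* t :* E)))
          := n :* (q :* x :* z :+ q :* t :* (q :* t) :* E)) refl

      root : γ₀ + s * (γ₁ + s * E) ≈ 0#
      root = begin
        γ₀ + s * (γ₁ + s * E)
          ≈⟨ lemma₁ γ₀ s γ₁ E ⟩
        X + γ₁ * s
          ≈⟨ +-congˡ (*-congˡ s≈) ⟩
        X + γ₁ * (- u * X)
          ≈⟨ lemma₂ X γ₁ (- u) ⟩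
        (1# + γ₁ * - u) * X
          ≈⟨ *-congʳ (+-congˡ (trans (sym (-‿distribʳ-* γ₁ u)) (-‿cong γ₁u≈1))) ⟩
        (1# + - 1#) * X
          ≈⟨ trans (*-congʳ (-‿inverseʳ 1#)) (zeroˡ X) ⟩
        0# ∎
        where
        X : Zp
        X = γ₀ + s * s * E
        lemma₁ : ∀ g s h E → g + s * (h + s * E) ≈ g + s * s * E + h * s
        lemma₁ = solve 4 (λ g s h E → g :+ s :* (h :+ s :* E) := g :+ s :* s :* E :+ h :* s) refl
        lemma₂ : ∀ X g n → X + g * (n * X) ≈ (1# + g * n) * X
        lemma₂ X g n = trans (+-cong (sym (*-identityˡ X)) (sym (*-assoc g n X))) (sym (distribʳ X 1# (g * n)))

      evalP-root : evalP F (cst r₀ + P * s) ≈ 0#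
      evalP-root = begin
        evalP F (cst r₀ + P * s)
          ≈⟨ evalP-taylor (cst r₀) F (P * s) ⟨
        evalP T (P * s)
          ≈⟨ evalP-drop T (P * s) ⟩
        coef T 0 + P * s * evalP (drop 1 T) (P * s)
          ≈⟨ +-congˡ (*-congˡ (evalP-drop (drop 1 T) (P * s))) ⟩
        coef T 0 + P * s * (coef (drop 1 T) 0 + P * s * evalP rest (P * s))
          ≈⟨ +-cong (trans (sym (*-identityˡ _)) (trans (T-γ 0) (*-congʳ p^2κ)))
               (*-congˡ (+-cong (trans (reflexive (coef-drop 1 T 0)) T₁≈)
                 (*-congˡ (trans (sym (*-identityˡ _)) (sym (evalP-scale 1# P rest s)))))) ⟩
        P * P * γ₀ + P * s * (P * γ₁ + P * s * E)
          ≈⟨ lemma P γ₀ s γ₁ E ⟩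
        P * P * (γ₀ + s * (γ₁ + s * E))
          ≈⟨ trans (*-congˡ root) (zeroʳ _) ⟩
        0# ∎
        where
        lemma : ∀ P g s h E → P * P * g + P * s * (P * h + P * s * E) ≈ P * P * (g + s * (h + s * E))
        lemma = solve 5 (λ P g s h E → P :* P :* g :+ P :* s :* (P :* h :+ P :* s :* E)
          := P :* P :* (g :+ s :* (h :+ s :* E))) refl

      -- The construction of s only gives divisibility by p. Moving the quadratic term of `s≈` to
      -- the left yields s (1 + p u s′ E) = - u γ₀, and the bracket is a unit, so s inherits the
      -- full power p^(e+1) from γ₀.
      s-divisible : ∃ λ z → s ≈ p^ (suc e) * z
      s-divisible =
        let w = u * (s′ * E)
            v , [1+pw]v≈1 = 1+p-unit w
        in - u * z₀ * v , (begin
          s                                     ≈⟨ *-identityʳ s ⟨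
          s * 1#                                ≈⟨ *-congˡ [1+pw]v≈1 ⟨
          s * ((1# + p^ 1 * w) * v)             ≈⟨ *-assoc _ _ _ ⟨
          s * (1# + p^ 1 * w) * v               ≈⟨ *-congʳ cancel ⟩
          - u * (p^ (suc e) * z₀) * v           ≈⟨ lemma (- u) (p^ (suc e)) z₀ v ⟩
          p^ (suc e) * (- u * z₀ * v)           ∎)
        where
        lemma : ∀ n q z v → n * (q * z) * v ≈ q * (n * z * v)
        lemma = solve 4 (λ n q z v → n :* (q :* z) :* v := q :* (n :* z :* v)) refl
        lemma₁ : ∀ q t u E → q * t * (1# + q * (u * (t * E))) ≈ q * t + u * (q * t * (q * t) * E)
        lemma₁ q t u E = trans (distribˡ _ _ _) (+-cong (*-identityʳ _)
          (solve 4 (λ q t u E → q :* t :* (q :* (u :* (t :* E))) := u :* (q :* t :* (q :* t) :* E)) refl q t u E))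
        lemma₂ : ∀ n u g X → n * (g + X) + u * X ≈ n * g + (n + u) * X
        lemma₂ = solve 4 (λ n u g X → n :* (g :+ X) :+ u :* X := n :* g :+ (n :+ u) :* X) refl
        cancel : s * (1# + p^ 1 * (u * (s′ * E))) ≈ - u * γ₀
        cancel = begin
          s * (1# + p^ 1 * (u * (s′ * E)))            ≈⟨ lemma₁ (p^ 1) s′ u E ⟩
          s + u * (s * s * E)                         ≈⟨ +-congʳ s≈ ⟩
          - u * (γ₀ + s * s * E) + u * (s * s * E)    ≈⟨ lemma₂ (- u) u γ₀ (s * s * E) ⟩
          - u * γ₀ + (- u + u) * (s * s * E)          ≈⟨ +-congˡ (trans (*-congʳ (-‿inverseˡ u)) (zeroˡ _)) ⟩
          - u * γ₀ + 0#                               ≈⟨ +-identityʳ _ ⟩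
          - u * γ₀                                    ∎

    ua₀≈1 : u * γ₁ ≈ 1#
    ua₀≈1 = trans (*-comm u γ₁) γ₁u≈1

    open Inverse torsionFree (u ∙ coef (γ₁ ∷ H)) ua₀≈1 using (inverse)

    term : ℕ → Zp
    term n = inverse (suc n) * (ε * (γ₀ * u)) ^ suc n

    abstract
      evals-h : ∀ M → EvalsTo s M (u ∙ coef (γ₁ ∷ H)) (u * (γ₁ + s * E))
      evals-h M = evals-∙ M u (evals-coef M (γ₁ ∷ H))

      s*h≈ : s * (u * (γ₁ + s * E)) ≈ ε * (γ₀ * u)
      s*h≈ = begin
        s * (u * (γ₁ + s * E))   ≈⟨ swap s u (γ₁ + s * E) ⟩
        s * (γ₁ + s * E) * u     ≈⟨ *-congʳ (trans (inverseʳ-unique _ _ root) (sym (-1*x≈-x γ₀))) ⟩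
        ε * γ₀ * u               ≈⟨ *-assoc _ _ _ ⟩
        ε * (γ₀ * u)             ∎
        where
        swap : ∀ x y z → x * (y * z) ≈ x * z * y
        swap = solve 3 (λ x y z → x :* (y :* z) := x :* z :* y) refl

      term-sum : ∀ k → ∃ λ q → ∑ (suc k) term ≈ s + s ^ (2 ℕ.+ k) * q
      term-sum k =
        let q , sum≈ = inverse-sum torsionFree (coef (γ₁ ∷ H)) u ua₀≈1 evals-h k
        in q , trans (∑-cong (suc k) λ n _ → *-congˡ (^-congˡ (suc n) (sym s*h≈))) sum≈

      s^-divisible : ∀ m k → m ℕ.≤ k → ∀ q → ∃ λ z → s ^ k * q ≈ p^ m * z
      s^-divisible m k m≤k q = p^ (k ℕ.∸ m) * (s′ ^ k * q) , (begin
        (p^ 1 * s′) ^ k * q               ≈⟨ *-congʳ (^-distrib-* (p^ 1) s′ k) ⟩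
        p^ 1 ^ k * s′ ^ k * q             ≈⟨ *-assoc _ _ _ ⟩
        p^ 1 ^ k * (s′ ^ k * q)           ≈⟨ *-congʳ (p^-* k 1) ⟨
        p^ (k ℕ.* 1) * (s′ ^ k * q)       ≡⟨ ≡.cong (λ j → p^ j * (s′ ^ k * q))
                                               (≡.trans (ℕₚ.*-identityʳ k) (≡.sym (ℕₚ.m+[n∸m]≡n m≤k))) ⟩
        p^ (m ℕ.+ (k ℕ.∸ m)) * (s′ ^ k * q)    ≈⟨ *-congʳ (p^-+ m (k ℕ.∸ m)) ⟩
        p^ m * p^ (k ℕ.∸ m) * (s′ ^ k * q)     ≈⟨ *-assoc _ _ _ ⟩
        p^ m * (p^ (k ℕ.∸ m) * (s′ ^ k * q))   ∎)

      cst-ε^ : ∀ j → cst (-[1+ 0 ] ℤ.^ j) ≈ ε ^ j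
      cst-ε^ zero    = refl
      cst-ε^ (suc j) = trans (cst-* -[1+ 0 ] (-[1+ 0 ] ℤ.^ j))
        (*-cong (≗⇒≈ᶻ λ n → ≡.sym (≡.cong-app (seq-neg 1#) n)) (cst-ε^ j))

      -- Summand k has the denominator γ₁^k (n+1)!. Its unit part moves to the numerator, which
      -- leaves the common denominator (n+1)!. By `inverse-term` the whole numerator contains (n+1)!
      -- as a factor, so the term is a p-adic integer.
      term-val : ∀ n → Val (seriesTerm p κ f r₀ n) (term n) 1#
      term-val n = val-cancel (nat (suc n !)) (nat-regular (suc n !) {{suc n ℕₚ.!≢0}})
        (val-≈ (inverse-term torsionFree (coef (γ₁ ∷ H)) u ua₀≈1 n (γ₀ * u)) (sym (*-identityʳ _))
          (val-*₁
            (val-Σ (suc n) λ k _ → summand k)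
            (val-^ c₀/c₁ (suc n))))
        where
        c : ℕ → Qp
        c = cCoef p κ f r₀
        c₀/c₁ : Val (c 0 /q c 1) (γ₀ * u) 1#
        c₀/c₁ = val-unit γ₁ u γ₁u≈1 (val-≈ refl (sym (*-identityˡ γ₁)) (val-/₁ (c-val 0) (c-val 1)))
        γ₁^u^≈1 : ∀ k → γ₁ ^ k * u ^ k ≈ 1#
        γ₁^u^≈1 k = trans (sym (^-distrib-* γ₁ u k)) (trans (^-congˡ k γ₁u≈1) (1^ k))
        open Bell (λ j → ιℕ (j !) *q c j) γ (λ j → val-*₁ (val-nat (j !)) (c-val j)) using (val-B)
        summand : ∀ k → Val
          ((ιℤ (-[1+ 0 ] ℤ.^ (n ℕ.∸ k ℕ.+ 1)) /q ((c 1 ^q k) *q ιℕ (suc n !)))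
            *q ιℕ ((2 ℕ.* n ℕ.+ 1) C (n ℕ.∸ k)) *q B (n ℕ.+ k) k (λ j → ιℕ (j !) *q c j))
          (ε ^ (n ℕ.∸ k ℕ.+ 1) * nat ((2 ℕ.* n ℕ.+ 1) C (n ℕ.∸ k))
            * (nat (((n ℕ.+ k) C k) ℕ.* n !) * (coef (γ₁ ∷ H) ^^ k) n) * u ^ k)
          (nat (suc n !))
        summand k = val-unit (γ₁ ^ k) (u ^ k) (γ₁^u^≈1 k)
          (val-≈ refl (*-comm _ _) (val-*₁ (val-*₁
            (val-/₁ (val-≈ (cst-ε^ (n ℕ.∸ k ℕ.+ 1)) refl (val-const _))
                    (val-*₁ (val-^ (c-val 1) k) (val-nat (suc n !))))
            (val-nat ((2 ℕ.* n ℕ.+ 1) C (n ℕ.∸ k))))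
            (val-B n k)))

      val⇒≃ : ∀ {q y} m z → Val q y 1# → y ≈ s + p^ m * z →
        q ≃[ p ] ι (proj₁ s ⊕ constℕ (p ℕ.^ m) ⊗ proj₁ z)
      val⇒≃ {a , d} m z (val {num} {den} num≗ den≗ cross) y≈ =
        ≈ₚ-trans {a ⊗ constℕ 1} {proj₁ (num * 1#)} {x ⊗ d}
          (≗⇒≈ₚ (seq-*-≗ num 1# num≗ (λ _ → ≡.refl)))
          (≈ₚ-trans {proj₁ (num * 1#)} {proj₁ ((s + p^ m * z) * den)} {x ⊗ d}
            (unwrap (trans cross (trans (*-congˡ y≈) (*-comm _ _))))
            (≗⇒≈ₚ λ n → ≡.sym (seq-*-≗ (s + p^ m * z) den
              (seq-+-≗ s (p^ m * z) (λ _ → ≡.refl) (seq-*-≗ (p^ m) z (λ _ → ≡.refl) (λ _ → ≡.refl))) den≗ n)))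
        where
        x : Seq
        x = proj₁ s ⊕ constℕ (p ℕ.^ m) ⊗ proj₁ z

      converges : ConvergesTo p (seriesTerm p κ f r₀) (proj₁ s)
      -- k + 1 terms are exact modulo s^(k+2), and p divides s. The bound m + 1 rather than m
      -- excludes the empty sum, so that M is k + 1 with k ≥ m.
      converges m = suc m , λ { (suc k) (s≤s m≤k) →
        let q , sum≈ = term-sum k
            z , sq≈  = s^-divisible m (2 ℕ.+ k) (ℕₚ.m≤n⇒m≤1+n (ℕₚ.m≤n⇒m≤1+n m≤k)) q
        in proj₁ z , proj₂ z , val⇒≃ m z (val-Σ (suc k) λ n _ → term-val n) (trans sum≈ (+-congˡ sq≈)) }

      lifted-root : LiftedRoot f κ e r₀
      lifted-root =
        let z , s≈p^z = s-divisible
        in proj₁ s , proj₂ s , converges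
          , ≈-≐ (eval-≐ f≐F (≐-shift r₀ κ s)) (λ _ → ≡.refl) evalP-root
          , proj₁ z , proj₂ z
          , ≈-≐ (≐-shift r₀ κ s) (≐-shift r₀ (κ ℕ.+ suc e) z)
              (+-congˡ (trans (*-congˡ s≈p^z) (trans (sym (*-assoc _ _ _)) (*-congʳ (sym (p^-+ κ (suc e)))))))

  fromSeqs : ∀ {f} → All (Coherent p) f → List Zp
  fromSeqs []       = []
  fromSeqs {x ∷ f} (c ∷ cs) = (x , c) ∷ fromSeqs cs

  fromSeqs-≐ : ∀ {f} (cs : All (Coherent p) f) → Pointwise _≐_ f (fromSeqs cs)
  fromSeqs-≐ []       = []
  fromSeqs-≐ (c ∷ cs) = (λ _ → ≡.refl) ∷ fromSeqs-≐ cs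

  abstract
    fromDivZp : ∀ d {y x} → y ≐ x → DivZp p (constℕ d) y → ∃ λ z → x ≈ cst (+ d) * z
    fromDivZp d {y} {x} y≐x (z , cz , y≈) = (z , cz) , wrap
      (≈ₚ-trans {proj₁ x} {y} {proj₁ (cst (+ d) * (z , cz))}
        (≗⇒≈ₚ λ n → ≡.sym (y≐x n))
        (≈ₚ-trans {y} {constℕ d ⊗ z} {proj₁ (cst (+ d) * (z , cz))} y≈
          (≗⇒≈ₚ (seq-*-≗ (cst (+ d)) (z , cz) (λ _ → ≡.refl) (λ _ → ≡.refl)))))

    toDivZp : ∀ d {y x} → y ≐ x → ∀ z → x ≈ cst (+ d) * z → DivZp p (constℕ d) y
    toDivZp d {y} {x} y≐x z x≈ = proj₁ z , proj₂ z ,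
      ≈ₚ-trans {y} {proj₁ x} {constℕ d ⊗ proj₁ z} (≗⇒≈ₚ y≐x)
        (≈ₚ-trans {proj₁ x} {proj₁ (cst (+ d) * z)} {constℕ d ⊗ proj₁ z} (unwrap x≈)
          (≗⇒≈ₚ λ n → ≡.sym (seq-*-≗ (cst (+ d)) z (λ _ → ≡.refl) (λ _ → ≡.refl) n)))

    -- If p divided the cofactor of p^κ, then p^(κ+1) would divide the value, against the second
    -- half of `HasVal`.
    hasVal-unit : ∀ κ {y x} → y ≐ x → HasVal p y κ → ∃ λ γ → x ≈ p^ κ * γ × (∃ λ u → γ * u ≈ 1#)
    hasVal-unit κ {y} {x} y≐x (div , ¬div) =
      let γ , x≈ = fromDivZp (p ℕ.^ κ) y≐x div
      in γ , x≈ , unit γ λ p∣γ₁ →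
        let w , γ≈ = p^-divides 1 γ (≡.subst (λ m → + m ∣ proj₁ γ 1) (≡.sym (ℕₚ.*-identityʳ p)) p∣γ₁)
        in ¬div (toDivZp (p ℕ.^ suc κ) y≐x w (begin
          x                  ≈⟨ x≈ ⟩
          p^ κ * γ           ≈⟨ *-congˡ γ≈ ⟩
          p^ κ * (p^ 1 * w)  ≈⟨ *-assoc _ _ _ ⟨
          p^ κ * p^ 1 * w    ≈⟨ *-congʳ (trans (*-comm _ _) (sym (p^-+ 1 κ))) ⟩
          p^ (suc κ) * w     ∎))

    lift : ∀ {f} → All (Coherent p) f → ∀ κ e r₀ →
      DivZp p (constℕ (p ℕ.^ (2 ℕ.* κ ℕ.+ suc e))) (eval f (const r₀)) →
      HasVal p (eval (deriv f) (const r₀)) κ →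
      LiftedRoot f κ e r₀
    lift {f} cf κ e r₀ f-div f′-val =
      let f≐F = fromSeqs-≐ cf
          F   = fromSeqs cf
          z₀ , f≈              = fromDivZp (p ℕ.^ (2 ℕ.* κ ℕ.+ suc e)) (eval-≐ {x = cst r₀} f≐F (λ _ → ≡.refl)) f-div
          γ₁ , f′≈ , u , γ₁u≈1 = hasVal-unit κ (eval-≐ {x = cst r₀} (deriv-≐ f≐F) (λ _ → ≡.refl)) f′-val
      in Root.lifted-root f F f≐F κ e r₀ z₀ γ₁ u
           (trans (taylor-0 (cst r₀) F) f≈)
           (trans (trans (sym (*-identityˡ _)) (trans (*-congʳ (sym (+-identityʳ 1#)))
             (sym (evalP-derivNP (cst r₀) 1 F)))) f′≈)
           γ₁u≈1

open import Data.Nat using (ℕ; _*_; _<_; _^_; _∸_)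

theorem3p2 : (p : ℕ) → Prime p → (f : List Seq) → All (Coherent p) f →
    (ν κ : ℕ) → 2 * κ < ν → (r0 : ℤ) →
    DivZp p (constℕ (p ^ ν)) (eval f (const r0)) →
    HasVal p (eval (deriv f) (const r0)) κ →
    Σ Seq (λ s → Coherent p s
    × ConvergesTo p (seriesTerm p κ f r0) s
    × (eval f (const r0 ⊕ constℕ (p ^ κ) ⊗ s) ≈[ p ] constℕ 0)
    × Σ Seq (λ z → Coherent p z
    × ((const r0 ⊕ constℕ (p ^ κ) ⊗ s) ≈[ p ] (const r0 ⊕ constℕ (p ^ (ν ∸ κ)) ⊗ z))))
theorem3p2 p pr f cf ν κ 2κ<ν r0 f-div f′-val =
  let s , cs , converges , root , z , cz , s≈ = Assembly.lift pr cf κ e r0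
        (≡.subst (λ m → DivZp p (constℕ (p ^ m)) (eval f (const r0))) ν≡ f-div) f′-val
  in s , cs , converges , root , z , cz
    , ≡.subst (λ m → (const r0 ⊕ constℕ (p ^ κ) ⊗ s) ≈[ p ] (const r0 ⊕ constℕ (p ^ m) ⊗ z)) (≡.sym ν∸κ≡) s≈
  where
  e : ℕ
  -- By `2κ<ν` nothing is truncated here, and e + 1 = ν - 2κ is the positive power of p that divides
  -- c₀.
  e = ν ∸ suc (2 * κ)
  ν≡ : ν ≡ 2 * κ ℕ.+ suc e
  ν≡ = ≡.trans (≡.sym (ℕₚ.m+[n∸m]≡n 2κ<ν)) (≡.sym (ℕₚ.+-suc (2 * κ) e))
  ν∸κ≡ : ν ∸ κ ≡ κ ℕ.+ suc e
  ν∸κ≡ = ≡.trans (≡.cong (_∸ κ) (≡.trans ν≡ (rearrange κ e))) (ℕₚ.m+n∸m≡n κ (κ ℕ.+ suc e))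
    where
    rearrange : ∀ κ e → 2 * κ ℕ.+ suc e ≡ κ ℕ.+ (κ ℕ.+ suc e)
    rearrange = solve-ℕ
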